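{- The linear map $r_A : \mathbf{Baxter} \to \mathbb{K}\langle A \rangle$ defined, for any pair of twin binary trees $J$, by $$r_A(\mathbf{P}_J) := \sum_{\substack{u \in A^* \\ (\mathrm{incr}(u),\, \mathrm{decr}(u)) \simeq J}} u,$$ provides a polynomial realization of $\mathbf{Baxter}$.
   Context: $\mathbb{K}$ is a field of characteristic zero. $A = \{a_1 < a_2 < \cdots\}$ is a totally ordered infinite alphabet; $\mathbb{K}\langle A\rangle$ denotes the algebra of (possibly infinite) $\mathbb{K}$-linear combinations of words on $A$ of bounded degree, with concatenation product. $\mathfrak{S}$ is the set of all permutations (of all sizes $n \ge 0$), seen as words; $\mathrm{std}(u)$ is the unique permutation of size $|u|$ with the same inversions as $u$. $\mathbf{FQSym}$ is the Hopf algebra over $\mathbb{K}$ with basis $\{\mathbf{F}_\sigma\}_{\sigma\in\mathfrak{S}}$, product $\mathbf{F}_\sigma\cdot\mathbf{F}_\nu = \sum_{\pi} \mathbf{F}_\pi$, where $\pi$ runs over all shuffles of $\sigma$ with the word obtained by adding $|\sigma|$ to every letter of $\nu$, and coproduct $\Delta(\mathbf{F}_\sigma) = \sum_{\sigma = uv} \mathbf{F}_{\mathrm{std}(u)} \otimes \mathbf{F}_{\mathrm{std}(v)}$. A binary tree is either a leaf (empty tree) or a node with a left and a right binary subtree. The canopy of a binary tree with $n$ nodes is the word of length $n-1$ obtained by reading its leaves from left to right except the first and the last, writing $0$ if the leaf is a right child and $1$ if it is a left child. A pair of twin binary trees is a pair of binary trees with the same number $n$ of nodes whose canopies differ at every position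 $1\le i\le n-1$. For a permutation $\sigma$, $\mathsf{P}(\sigma) = (T_L,T_R)$ where $T_L$ (resp. $T_R$) is the shape of the binary search tree obtained by inserting the letters of $\sigma$ from left to right (resp. right to left) with the standard binary search tree leaf insertion. $\mathbf{Baxter}$ is the Hopf subalgebra of $\mathbf{FQSym}$ with basis $\{\mathbf{P}_J\}$ indexed by pairs of twin binary trees, where $\mathbf{P}_J = \sum_{\sigma\in\mathfrak{S},\ \mathsf{P}(\sigma) = J} \mathbf{F}_\sigma$. For a word $u$, $\mathrm{incr}(u)$ is empty if $u$ is empty, and otherwise is the tree with root labeled $a$, left subtree $\mathrm{incr}(v)$ and right subtree $\mathrm{incr}(w)$, where $u = vaw$, $a = \min(u)$, $a < \min(v)$ (leftmost minimal letter). $\mathrm{decr}(u)$ is empty if $u$ is empty, and otherwise has root labeled $b$, left subtree $\mathrm{decr}(v)$, right subtree $\mathrm{decr}(w)$, where $u = vbw$, $b = \max(u)$, $b > \max(w)$ (rightmost maximal letter). $J_0 \simeq J_1$ means that the pairs of trees $J_0$ and $J_1$ have the same shape (labels forgotten). A polynomial realization is an injective algebra morphism $r_A$ into $\mathbb{K}\langle A\rangle$ which is compatible with the coalgebra structure in the sense that the coproduct is computed by the alphabet doubling trick: defining $r_X$ by the same formula for any totally ordered alphabet $X$, and letting $A \oplus B$ be the ordered sum of $A$ and a disjoint copy $B$ of $A$ (all letters of $A$ smaller than those of $B$), the image of $r_{A\oplus B}(x)$ after letting the letters of $A$ commute with those of $B$ (each word $u$ being sent to $u_{|A}\otimes u_{|B}$,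 its restrictions to $A$ and $B$) equals $(r_A \otimes r_B)(\Delta(x))$ for every $x$. -}

module Defs where

open import Level using (Level; 0ℓ; _⊔_) renaming (suc to lsuc)
open import Algebra.Apartness.Bundles using (HeytingField; HeytingCommutativeRing)
open import Algebra.Bundles using (CommutativeRing)
open import Algebra.Definitions.RawMonoid using () renaming (_×_ to multiple)
open import Algebra.Module.Bundles.Raw using (RawLeftModule)
open import Algebra.Module.Construct.TensorUnit using () renaming (rawLeftModule to scalars)
open import Algebra.Module.Morphism.Structures using (module LeftModuleMorphisms)
open import Data.Bool.Base using (if_then_else_)
open import Data.Empty using (⊥-elim)
open import Data.Fin.Base as Fin using (Fin)
import Data.Fin.Properties as Fin
open import Data.Fin.Patterns using (0F; 1F)
open import Data.List.Base as List
  using (List; []; _∷_; _++_; [_]; length; map; foldl; foldr; filter; concatMap; cartesianProduct;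
         take; drop; tabulate; allFin; lookup)
import Data.List.Properties as List
open import Data.List.Membership.Propositional using (_∈_; mapWith∈; lose)
open import Data.List.Membership.Propositional.Properties using (∈-map⁻; ∈-++⁻; ∈-allFin)
open import Data.List.Relation.Binary.Disjoint.Propositional using (Disjoint)
open import Data.List.Relation.Binary.Permutation.Propositional
  using (_↭_; prep; ↭-refl; ↭-reflexive; ↭-sym; ↭-trans; ↭⇒↭ₛ)
open import Data.List.Relation.Binary.Permutation.Propositional.Properties
  using (All-resp-↭; ↭-length; shift)
import Data.List.Relation.Binary.Permutation.Setoid.Properties as ↭ₛ
open import Data.List.Relation.Binary.Pointwise using (Pointwise)
open import Data.List.Relation.Unary.All as All using (All; []; _∷_)
import Data.List.Relation.Unary.All.Properties as All
open import Data.List.Relation.Unary.Any using (here; there)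
open import Data.List.Relation.Unary.Unique.Propositional using (Unique; []; _∷_)
import Data.List.Relation.Unary.Unique.Propositional.Properties as Unique
open import Data.Nat.Base as ℕ using (ℕ; zero; suc; z≤n; s≤s; s<s)
import Data.Nat.Properties as ℕ
open import Data.Product.Base using (∃; _×_; _,_; proj₁; proj₂; map₁)
open import Data.Product.Properties using () renaming (≡-dec to ×-≡-dec)
open import Data.Product.Relation.Binary.Pointwise.NonDependent using (×-decSetoid)
open import Data.Sum.Base using (_⊎_; inj₁; inj₂)
open import Data.Sum.Relation.Binary.LeftOrder
  using (_⊎-<_; ⊎-<-transitive; ⊎-<-trichotomous)
open import Data.Sum.Relation.Binary.Pointwise using (Pointwise-≡⇒≡; ≡⇒Pointwise-≡)
open import Data.Tree.Binary using (Tree; leaf; node; mapₙ; #nodes)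
open import Data.Unit.Base using (⊤; tt)
open import Function.Base using (_∘_; const)
open import Relation.Binary.Bundles using (DecSetoid)
open import Relation.Binary.Core using (Rel)
open import Relation.Binary.Definitions using (DecidableEquality; tri<; tri≈; tri>)
import Relation.Binary.Construct.On as On
open import Relation.Binary.PropositionalEquality
  using (_≡_; _≢_; refl; sym; trans; cong; cong₂; subst; isEquivalence)
import Relation.Binary.PropositionalEquality as ≡
open import Relation.Binary.Structures using (IsStrictTotalOrder)
open import Relation.Binary.Structures.Biased using (isStrictTotalOrderᶜ)
open import Relation.Nullary using (¬_; Dec; yes; no; does)
open import Relation.Nullary.Decidable using (_⊎-dec_; _×-dec_)

private variable
  a b c ℓ ℓ₁ ℓ₂ m ℓm : Level

------------------------------------------------------------------------
-- Words

module _ {A : Set a} where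

  splits : List A → List (List A × List A)
  splits []      = [ ([] , []) ]
  splits (x ∷ w) = ([] , x ∷ w) ∷ map (map₁ (x ∷_)) (splits w)

  -- With multiplicity; each shuffle occurs once when the two words have no
  -- letter in common.
  shuffles : List A → List A → List (List A)
  shuffles []      v       = [ v ]
  shuffles (x ∷ u) []      = [ x ∷ u ]
  shuffles (x ∷ u) (y ∷ v) =
    map (x ∷_) (shuffles u (y ∷ v)) ++ map (y ∷_) (shuffles (x ∷ u) v)

  splits-length : ∀ w → All (λ (u , v) → length u ℕ.+ length v ≡ length w) (splits w)
  splits-length []      = refl ∷ []
  splits-length (x ∷ w) = refl ∷ All.map⁺ (All.map (cong suc) (splits-length w))

  ∈-shuffles⇒↭ : ∀ u v {π} → π ∈ shuffles u v → π ↭ u ++ v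
  ∈-shuffles⇒↭ []      v  (here refl) = ↭-refl
  ∈-shuffles⇒↭ (x ∷ u) [] (here refl) = ↭-reflexive (sym (List.++-identityʳ (x ∷ u)))
  ∈-shuffles⇒↭ (x ∷ u) (y ∷ v) π∈
    with ∈-++⁻ (map (x ∷_) (shuffles u (y ∷ v))) π∈
  ... | inj₁ π∈ˡ with _ , ρ∈ , refl ← ∈-map⁻ (x ∷_) π∈ˡ = prep x (∈-shuffles⇒↭ u (y ∷ v) ρ∈)
  ... | inj₂ π∈ʳ with _ , ρ∈ , refl ← ∈-map⁻ (y ∷_) π∈ʳ =
    ↭-trans (prep y (∈-shuffles⇒↭ (x ∷ u) v ρ∈)) (↭-sym (shift y (x ∷ u) v))

module _ {A : Set a} {P Q : A → Set} (P? : ∀ x → Dec (P x)) (Q? : ∀ x → Dec (Q x))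
         (P⇒Q : ∀ {x} → P x → Q x) where

  filter-length-≤ : ∀ xs → length (filter P? xs) ℕ.≤ length (filter Q? xs)
  filter-length-≤ []       = z≤n
  filter-length-≤ (x ∷ xs) with P? x | Q? x
  ... | yes _ | yes _ = s≤s (filter-length-≤ xs)
  ... | yes p | no ¬q = ⊥-elim (¬q (P⇒Q p))
  ... | no _  | yes _ = ℕ.m≤n⇒m≤1+n (filter-length-≤ xs)
  ... | no _  | no _  = filter-length-≤ xs

  filter-length-< : ∀ {e xs} → e ∈ xs → ¬ P e → Q e →
                    length (filter P? xs) ℕ.< length (filter Q? xs)
  filter-length-< {xs = x ∷ xs} (here refl) ¬pe qe with P? x | Q? x
  ... | yes p | _     = ⊥-elim (¬pe p)
  ... | no _  | yes _ = s≤s (filter-length-≤ xs)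
  ... | no _  | no ¬q = ⊥-elim (¬q qe)
  filter-length-< {xs = x ∷ xs} (there e∈) ¬pe qe with P? x | Q? x
  ... | yes _ | yes _ = s<s (filter-length-< e∈ ¬pe qe)
  ... | yes p | no ¬q = ⊥-elim (¬q (P⇒Q p))
  ... | no _  | yes _ = ℕ.m≤n⇒m≤1+n (filter-length-< e∈ ¬pe qe)
  ... | no _  | no _  = filter-length-< e∈ ¬pe qe

------------------------------------------------------------------------
-- Permutations

-- A word of length n with n distinct letters in {1 , … , n}.
record Permutation : Set where
  field
    word     : List ℕ
    range    : All (λ x → 1 ℕ.≤ x × x ℕ.≤ length word) word
    distinct : Unique word

open Permutation public

permutationDecSetoid : DecSetoid 0ℓ 0ℓ
permutationDecSetoid = On.decSetoid (≡.decSetoid (List.≡-dec ℕ._≟_)) word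

emptyPermutation : Permutation
emptyPermutation = record { word = [] ; range = [] ; distinct = [] }

singletonPermutation : Permutation
singletonPermutation = record
  { word = [ 1 ] ; range = (ℕ.≤-refl , ℕ.≤-refl) ∷ [] ; distinct = [] ∷ [] }

module ShiftedShuffle (σ ν : Permutation) where

  shifted : List ℕ
  shifted = map (length (word σ) ℕ.+_) (word ν)

  w = word σ ++ shifted

  length-w : length w ≡ length (word σ) ℕ.+ length (word ν)
  length-w = trans (List.length-++ (word σ))
                   (cong (length (word σ) ℕ.+_) (List.length-map _ (word ν)))

  range-w : All (λ x → 1 ℕ.≤ x × x ℕ.≤ length w) w
  range-w rewrite length-w = All.++⁺
    (All.map (λ (1≤x , x≤m) → 1≤x , ℕ.≤-trans x≤m (ℕ.m≤m+n _ _)) (range σ))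
    (All.map⁺ (All.map (λ (1≤x , x≤n) → ℕ.≤-trans 1≤x (ℕ.m≤n+m _ (length (word σ)))
                                       , ℕ.+-monoʳ-≤ (length (word σ)) x≤n) (range ν)))

  disjoint : Disjoint (word σ) shifted
  disjoint (x∈σ , x∈ν) with y , y∈ν , refl ← ∈-map⁻ _ x∈ν =
    ℕ.<⇒≱ (ℕ.m<m+n (length (word σ)) (proj₁ (All.lookup (range ν) y∈ν)))
          (proj₂ (All.lookup (range σ) x∈σ))

  distinct-w : Unique w
  distinct-w = Unique.++⁺ (distinct σ)
    (Unique.map⁺ (ℕ.+-cancelˡ-≡ (length (word σ)) _ _) (distinct ν)) disjoint

  fromShuffle : ∀ {π} → π ∈ shuffles (word σ) shifted → Permutation
  fromShuffle {π} π∈ = record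
    { word     = π
    ; range    = subst (λ n → All (λ x → 1 ℕ.≤ x × x ℕ.≤ n) π) (sym (↭-length π↭w))
                       (All-resp-↭ (↭-sym π↭w) range-w)
    ; distinct = ↭ₛ.Unique-resp-↭ (≡.setoid ℕ) (↭⇒↭ₛ (↭-sym π↭w)) distinct-w
    }
    where π↭w = ∈-shuffles⇒↭ (word σ) shifted π∈

_⧢_ : Permutation → Permutation → List Permutation
σ ⧢ ν = mapWith∈ (shuffles (word σ) shifted) fromShuffle
  where open ShiftedShuffle σ ν

-- Every permutation of size n, once: the permutations of size n + 1 arise by
-- inserting the letter n + 1 at every place of a permutation of size n.
permutations : ℕ → List Permutation
permutations zero    = [ emptyPermutation ]
permutations (suc n) = concatMap (_⧢ singletonPermutation) (permutations n)

-- Position i of std(u) carries the rank of u_i when the positions of u are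
-- ordered by their letters, equal letters being ordered from left to right:
-- for i < j, the pair (i , j) is an inversion of std(u) iff u_i > u_j.
module Standardization (u : List ℕ) where

  Position : Set
  Position = Fin (length u)

  _≺_ : Rel Position 0ℓ
  j ≺ i = lookup u j ℕ.< lookup u i ⊎ (lookup u j ≡ lookup u i × j Fin.< i)

  _≺?_ : ∀ j i → Dec (j ≺ i)
  j ≺? i = (lookup u j ℕ.<? lookup u i)
             ⊎-dec ((lookup u j ℕ.≟ lookup u i) ×-dec (j Fin.<? i))

  rank : Position → ℕ
  rank i = suc (length (filter (_≺? i) (allFin (length u))))

  ≺-irrefl : ∀ i → ¬ (i ≺ i)
  ≺-irrefl i (inj₁ lt)       = ℕ.<-irrefl refl lt
  ≺-irrefl i (inj₂ (_ , lt)) = ℕ.<-irrefl refl lt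

  ≺-trans : ∀ {i j k} → i ≺ j → j ≺ k → i ≺ k
  ≺-trans (inj₁ p)       (inj₁ q)       = inj₁ (ℕ.<-trans p q)
  ≺-trans (inj₁ p)       (inj₂ (e , _)) = inj₁ (subst (_ ℕ.<_) e p)
  ≺-trans (inj₂ (e , _)) (inj₁ q)       = inj₁ (subst (ℕ._< _) (sym e) q)
  ≺-trans (inj₂ (e , p)) (inj₂ (f , q)) = inj₂ (trans e f , ℕ.<-trans p q)

  ≺-connex : ∀ i j → i ≢ j → i ≺ j ⊎ j ≺ i
  ≺-connex i j i≢j with ℕ.<-cmp (lookup u i) (lookup u j) | Fin.<-cmp i j
  ... | tri< lt _ _ | _           = inj₁ (inj₁ lt)
  ... | tri> _ _ gt | _           = inj₂ (inj₁ gt)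
  ... | tri≈ _ e _  | tri< lt _ _ = inj₁ (inj₂ (e , lt))
  ... | tri≈ _ _ _  | tri≈ _ e _  = ⊥-elim (i≢j e)
  ... | tri≈ _ e _  | tri> _ _ gt = inj₂ (inj₂ (sym e , gt))

  rank-mono : ∀ {i j} → i ≺ j → rank i ℕ.< rank j
  rank-mono {i} {j} i≺j = s<s (filter-length-< (_≺? i) (_≺? j) (λ k≺i → ≺-trans k≺i i≺j)
                               (∈-allFin i) (≺-irrefl i) i≺j)

  rank-injective : ∀ {i j} → rank i ≡ rank j → i ≡ j
  rank-injective {i} {j} e with i Fin.≟ j
  ... | yes i≡j = i≡j
  ... | no  i≢j with ≺-connex i j i≢j
  ...   | inj₁ i≺j = ⊥-elim (ℕ.<⇒≢ (rank-mono i≺j) e)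
  ...   | inj₂ j≺i = ⊥-elim (ℕ.<⇒≢ (rank-mono j≺i) (sym e))

  rank-≤ : ∀ i → rank i ℕ.≤ length u
  rank-≤ i = subst (rank i ℕ.≤_) (List.length-tabulate {n = length u} (λ k → k))
    (List.filter-notAll (_≺? i) (allFin (length u)) (lose (∈-allFin i) (≺-irrefl i)))

std : List ℕ → Permutation
std u = record
  { word     = tabulate rank
  ; range    = All.tabulate⁺ λ i → s≤s z≤n ,
                 subst (rank i ℕ.≤_) (sym (List.length-tabulate rank)) (rank-≤ i)
  ; distinct = Unique.tabulate⁺ rank-injective
  }
  where open Standardization u

------------------------------------------------------------------------
-- Pairs of twin binary trees

Shape : Set
Shape = Tree ⊤ ⊤

shape : {A : Set a} → Tree A ⊤ → Shape
shape = mapₙ (const tt)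

infix 4 _≟ˢ_
_≟ˢ_ : DecidableEquality Shape
leaf tt      ≟ˢ leaf tt         = yes refl
leaf _       ≟ˢ node _ _ _      = no λ ()
node _ _ _   ≟ˢ leaf _          = no λ ()
node l tt r  ≟ˢ node l′ tt r′ with l ≟ˢ l′ | r ≟ˢ r′
... | yes refl | yes refl = yes refl
... | no  l≢l′ | _        = no λ { refl → l≢l′ refl }
... | yes _    | no r≢r′  = no λ { refl → r≢r′ refl }

ShapePair : Set
ShapePair = Shape × Shape

_≟ˢˢ_ : DecidableEquality ShapePair
_≟ˢˢ_ = ×-≡-dec _≟ˢ_ _≟ˢ_

-- The first argument is the letter written when the tree is a single leaf:
-- 0 for a right child, 1 for a left child.
leafWord : Fin 2 → Shape → List (Fin 2)
leafWord d (leaf _)     = [ d ]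
leafWord d (node l _ r) = leafWord 1F l ++ leafWord 0F r

-- The letter passed at the root is irrelevant: it is only used for the tree
-- without nodes, whose canopy is empty.
canopy : Shape → List (Fin 2)
canopy t = take (#nodes t ℕ.∸ 1) (drop 1 (leafWord 0F t))

record TwinTrees : Set where
  field
    left right : Shape
    sameSize   : #nodes left ≡ #nodes right
    twin       : Pointwise _≢_ (canopy left) (canopy right)

  shapes : ShapePair
  shapes = left , right

open TwinTrees public

twinTreesDecSetoid : DecSetoid 0ℓ 0ℓ
twinTreesDecSetoid = On.decSetoid (≡.decSetoid _≟ˢˢ_) shapes

insert : ℕ → Tree ℕ ⊤ → Tree ℕ ⊤
insert x (leaf _)     = node (leaf tt) x (leaf tt)
insert x (node l y r) with x ℕ.≤? y
... | yes _ = node (insert x l) y r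
... | no  _ = node l y (insert x r)

Pˢ : Permutation → ShapePair
Pˢ σ = shape (foldl (λ t x → insert x t) (leaf tt) (word σ))
     , shape (foldr insert (leaf tt) (word σ))

fibre : TwinTrees → List Permutation
fibre J = filter (λ σ → Pˢ σ ≟ˢˢ shapes J) (permutations (#nodes (left J)))

------------------------------------------------------------------------
-- Totally ordered alphabets

record Alphabet : Set₁ where
  field
    Letter             : Set
    _<_                : Rel Letter 0ℓ
    isStrictTotalOrder : IsStrictTotalOrder _≡_ _<_

  open IsStrictTotalOrder isStrictTotalOrder public using (_<?_; compare)

open Alphabet public using (Letter)

-- The letter a_i is i - 1.
𝔸 : Alphabet
𝔸 = record { Letter = ℕ ; _<_ = ℕ._<_ ; isStrictTotalOrder = ℕ.<-isStrictTotalOrder }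

infixl 6 _⊕_
_⊕_ : Alphabet → Alphabet → Alphabet
X ⊕ Y = record
  { Letter             = Letter X ⊎ Letter Y
  ; _<_                = X._<_ ⊎-< Y._<_
  ; isStrictTotalOrder = isStrictTotalOrderᶜ record
    { isEquivalence = isEquivalence
    ; trans         = ⊎-<-transitive X.trans Y.trans
    ; compare       = compare
    }
  }
  where
  module X where
    open Alphabet X public using (_<_)
    open IsStrictTotalOrder (Alphabet.isStrictTotalOrder X) public
  module Y where
    open Alphabet Y public using (_<_)
    open IsStrictTotalOrder (Alphabet.isStrictTotalOrder Y) public
  compare : ∀ x y → _
  compare x y with ⊎-<-trichotomous X.compare Y.compare x y
  ... | tri< lt ne gt = tri< lt (ne ∘ ≡⇒Pointwise-≡) gt
  ... | tri≈ lt eq gt = tri≈ lt (Pointwise-≡⇒≡ eq) gt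
  ... | tri> lt ne gt = tri> lt (ne ∘ ≡⇒Pointwise-≡) gt

module IncrDecr (X : Alphabet) where

  open Alphabet X using (_<?_)

  Word : Set
  Word = List (Letter X)

  -- The factorization v b w of the nonempty word x ∷ u at its leftmost
  -- minimal letter b.
  splitMin : Letter X → Word → Word × Letter X × Word
  splitMin x []      = [] , x , []
  splitMin x (y ∷ u) with splitMin y u
  ... | v , b , w with b <? x
  ...   | yes _ = x ∷ v , b , w
  ...   | no  _ = [] , x , y ∷ u

  -- The same at the rightmost maximal letter.
  splitMax : Letter X → Word → Word × Letter X × Word
  splitMax x []      = [] , x , []
  splitMax x (y ∷ u) with splitMax y u
  ... | v , b , w with b <? x
  ...   | yes _ = [] , x , y ∷ u
  ...   | no  _ = x ∷ v , b , w

  -- The numeric argument bounds the depth of the recursion; the length of the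
  -- word is always enough.
  buildTree : (Letter X → Word → Word × Letter X × Word) → ℕ → Word → Tree (Letter X) ⊤
  buildTree split (suc n) (x ∷ u) with split x u
  ... | v , b , w = node (buildTree split n v) b (buildTree split n w)
  buildTree split _       _       = leaf tt

  incr decr : Word → Tree (Letter X) ⊤
  incr u = buildTree splitMin (length u) u
  decr u = buildTree splitMax (length u) u

  treeShapes : Word → ShapePair
  treeShapes u = shape (incr u) , shape (decr u)

  splitMin-≡ : ∀ x u → let v , b , w = splitMin x u in v ++ b ∷ w ≡ x ∷ u
  splitMin-≡ x []      = refl
  splitMin-≡ x (y ∷ u) with splitMin y u | splitMin-≡ y u
  ... | v , b , w | eq with b <? x
  ...   | yes _ = cong (x ∷_) eq
  ...   | no  _ = refl

  #nodes-incr : ∀ u → #nodes (shape (incr u)) ≡ length u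
  #nodes-incr u = go (length u) u ℕ.≤-refl
    where
    open ≡.≡-Reasoning
    go : ∀ n u → length u ℕ.≤ n → #nodes (shape (buildTree splitMin n u)) ≡ length u
    go zero    []      _   = refl
    go (suc n) []      _   = refl
    go (suc n) (x ∷ u) (s≤s u≤n) with splitMin x u | splitMin-≡ x u
    ... | v , b , w | eq = begin
      #nodes (shape (buildTree splitMin n v)) ℕ.+ suc (#nodes (shape (buildTree splitMin n w)))
        ≡⟨ cong₂ (λ k l → k ℕ.+ suc l) (go n v v≤n) (go n w w≤n) ⟩
      length v ℕ.+ suc (length w)  ≡⟨ List.length-++ v ⟨
      length (v ++ b ∷ w)          ≡⟨ cong length eq ⟩
      suc (length u)               ∎
      where
      total : length v ℕ.+ length w ≡ length u
      total = ℕ.suc-injective (trans (sym (ℕ.+-suc (length v) (length w)))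
                (trans (sym (List.length-++ v)) (cong length eq)))
      v≤n : length v ℕ.≤ n
      v≤n = ℕ.≤-trans (ℕ.≤-trans (ℕ.m≤m+n _ _) (ℕ.≤-reflexive total)) u≤n
      w≤n : length w ℕ.≤ n
      w≤n = ℕ.≤-trans (ℕ.≤-trans (ℕ.m≤n+m _ (length v)) (ℕ.≤-reflexive total)) u≤n

------------------------------------------------------------------------
-- Linear algebra over a field

module _ (K : HeytingField c ℓ₁ ℓ₂) where

  open HeytingField K using (heytingCommutativeRing)

  CharacteristicZero : Set ℓ₁
  CharacteristicZero = ∀ n → multiple +-rawMonoid n 1# ≈ 0# → n ≡ 0
    where open CommutativeRing (HeytingCommutativeRing.commutativeRing heytingCommutativeRing)
            using (_≈_; 0#; 1#; +-rawMonoid)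

module OverField (K : HeytingField c ℓ₁ ℓ₂) where

  open CommutativeRing
    (HeytingCommutativeRing.commutativeRing (HeytingField.heytingCommutativeRing K))
    using (Carrier; _≈_; _+_; _*_; -_; 0#; 1#; rawRing;
           +-cong; +-identityˡ; *-congˡ; *-congʳ; zeroˡ; zeroʳ; -‿cong; +-group)
    renaming (refl to ≈-refl; trans to ≈-trans)
  open import Algebra.Properties.Group +-group using () renaming (ε⁻¹≈ε to -0≈0)

  sum : List Carrier → Carrier
  sum = foldr _+_ 0#

  Module : ∀ m ℓm → Set _
  Module m ℓm = RawLeftModule Carrier m ℓm

  -- The free module on a decidable setoid: formal linear combinations, equal
  -- when all their coefficients are.
  module _ (B : DecSetoid b ℓ) where

    open DecSetoid B using (_≟_) renaming (Carrier to Basis)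

    coefficient : Basis → List (Carrier × Basis) → Carrier
    coefficient e x = sum (map (λ (k , e′) → if does (e′ ≟ e) then k else 0#) x)

    free : Module (c ⊔ b) (b ⊔ ℓ₁)
    free = record
      { Carrierᴹ = List (Carrier × Basis)
      ; _≈ᴹ_     = λ x y → ∀ e → coefficient e x ≈ coefficient e y
      ; _+ᴹ_     = _++_
      ; _*ₗ_     = λ k → map (map₁ (k *_))
      ; 0ᴹ       = []
      ; -ᴹ_      = map (map₁ -_)
      }

  basisSum : {B : Set b} → List B → List (Carrier × B)
  basisSum = map (1# ,_)

  -- The linear extension of a map defined on a basis.
  extend : {B : Set b} (M : Module m ℓm) →
           (B → RawLeftModule.Carrierᴹ M) → List (Carrier × B) → RawLeftModule.Carrierᴹ M
  extend M f = foldr (λ (k , e) y → k *ₗ f e +ᴹ y) 0ᴹ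
    where open RawLeftModule M

  ----------------------------------------------------------------------
  -- FQSym

  FQSym FQSym⊗FQSym : Module c ℓ₁
  FQSym       = free permutationDecSetoid
  FQSym⊗FQSym = free (×-decSetoid permutationDecSetoid permutationDecSetoid)

  module FQSym = RawLeftModule FQSym
  module FQSym⊗FQSym = RawLeftModule FQSym⊗FQSym

  1ᶠ : FQSym.Carrierᴹ
  1ᶠ = basisSum [ emptyPermutation ]

  infixl 7 _∙ᶠ_
  _∙ᶠ_ : FQSym.Carrierᴹ → FQSym.Carrierᴹ → FQSym.Carrierᴹ
  x ∙ᶠ y = extend FQSym (λ σ → extend FQSym (λ ν → basisSum (σ ⧢ ν)) y) x

  Δ : FQSym.Carrierᴹ → FQSym⊗FQSym.Carrierᴹ
  Δ = extend FQSym⊗FQSym λ σ → basisSum (map (λ (u , v) → std u , std v) (splits (word σ)))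

  ----------------------------------------------------------------------
  -- Baxter, in coordinates on the basis P; ι is its inclusion in FQSym

  Baxter Baxter⊗Baxter : Module c ℓ₁
  Baxter        = free twinTreesDecSetoid
  Baxter⊗Baxter = free (×-decSetoid twinTreesDecSetoid twinTreesDecSetoid)

  module Baxter = RawLeftModule Baxter
  module Baxter⊗Baxter = RawLeftModule Baxter⊗Baxter

  P : TwinTrees → Baxter.Carrierᴹ
  P J = basisSum [ J ]

  ι : Baxter.Carrierᴹ → FQSym.Carrierᴹ
  ι = extend FQSym (basisSum ∘ fibre)

  ι⊗ι : Baxter⊗Baxter.Carrierᴹ → FQSym⊗FQSym.Carrierᴹ
  ι⊗ι = extend FQSym⊗FQSym λ (J , J′) → basisSum (cartesianProduct (fibre J) (fibre J′))

  IsUnit : Baxter.Carrierᴹ → Set ℓ₁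
  IsUnit z = ι z FQSym.≈ᴹ 1ᶠ

  IsProduct : (x y z : Baxter.Carrierᴹ) → Set ℓ₁
  IsProduct x y z = ι z FQSym.≈ᴹ ι x ∙ᶠ ι y

  IsCoproduct : Baxter.Carrierᴹ → Baxter⊗Baxter.Carrierᴹ → Set ℓ₁
  IsCoproduct x d = ι⊗ι d FQSym⊗FQSym.≈ᴹ Δ (ι x)

  -- Being graded and connected, a subbialgebra of FQSym is a Hopf subalgebra.
  record BaxterIsHopfSubalgebra : Set (c ⊔ ℓ₁) where
    field
      ι-mono : LeftModuleMorphisms.IsLeftModuleMonomorphism Baxter FQSym ι
      unit   : ∃ λ z → IsUnit z
      prod   : ∀ x y → ∃ λ z → IsProduct x y z
      coprod : ∀ x → ∃ λ d → IsCoproduct x d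

  ----------------------------------------------------------------------
  -- Linear combinations of words of bounded degree

  module Polynomials (X : Alphabet) where

    open IncrDecr X public

    record Polynomial : Set (c ⊔ ℓ₁) where
      field
        coef    : Word → Carrier
        degree  : ℕ
        bounded : ∀ w → degree ℕ.< length w → coef w ≈ 0#

    open Polynomial public

    polynomials : Module (c ⊔ ℓ₁) ℓ₁
    polynomials = record
      { Carrierᴹ = Polynomial
      ; _≈ᴹ_     = λ f g → ∀ w → coef f w ≈ coef g w
      ; _+ᴹ_     = λ f g → record
        { coef    = λ w → coef f w + coef g w
        ; degree  = degree f ℕ.⊔ degree g
        ; bounded = λ w lt → ≈-trans
            (+-cong (bounded f w (ℕ.≤-<-trans (ℕ.m≤m⊔n (degree f) (degree g)) lt))
                    (bounded g w (ℕ.≤-<-trans (ℕ.m≤n⊔m (degree f) (degree g)) lt)))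
            (+-identityˡ 0#)
        }
      ; _*ₗ_     = λ k f → record
        { coef    = λ w → k * coef f w
        ; degree  = degree f
        ; bounded = λ w lt → ≈-trans (*-congˡ (bounded f w lt)) (zeroʳ k)
        }
      ; 0ᴹ       = record { coef = λ _ → 0# ; degree = 0 ; bounded = λ _ _ → ≈-refl }
      ; -ᴹ_      = λ f → record
        { coef    = λ w → - coef f w
        ; degree  = degree f
        ; bounded = λ w lt → ≈-trans (-‿cong (bounded f w lt)) -0≈0
        }
      }

    1ᵖ : Polynomial
    1ᵖ = record
      { coef    = λ { [] → 1# ; (_ ∷ _) → 0# }
      ; degree  = 0
      ; bounded = λ { (_ ∷ _) _ → ≈-refl }
      }

    sum-zero : {B : Set} (f : B → Carrier) {es : List B} →
               All (λ e → f e ≈ 0#) es → sum (map f es) ≈ 0#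
    sum-zero f []        = ≈-refl
    sum-zero f (p ∷ ps) = ≈-trans (+-cong p (sum-zero f ps)) (+-identityˡ 0#)

    infixl 7 _∙ᵖ_
    _∙ᵖ_ : Polynomial → Polynomial → Polynomial
    f ∙ᵖ g = record
      { coef    = λ w → sum (map term (splits w))
      ; degree  = degree f ℕ.+ degree g
      ; bounded = λ w lt → sum-zero term
          (All.map (λ {s} eq → zero-term s (subst (_ ℕ.<_) (sym eq) lt)) (splits-length w))
      }
      where
      term : Word × Word → Carrier
      term (u , v) = coef f u * coef g v
      zero-term : ∀ s → degree f ℕ.+ degree g ℕ.< length (proj₁ s) ℕ.+ length (proj₂ s) →
                  term s ≈ 0#
      zero-term (u , v) lt with degree f ℕ.<? length u
      ... | yes f<u = ≈-trans (*-congʳ (bounded f u f<u)) (zeroˡ _)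
      ... | no  f≮u = ≈-trans (*-congˡ (bounded g v (ℕ.≰⇒>
              (λ v≤g → ℕ.<⇒≱ lt (ℕ.+-mono-≤ (ℕ.≮⇒≥ f≮u) v≤g))))) (zeroʳ _)

    -- The sum of the words u such that (incr(u) , decr(u)) ≃ J.
    wordSum : TwinTrees → Polynomial
    wordSum J = record
      { coef    = λ u → if does (treeShapes u ≟ˢˢ shapes J) then 1# else 0#
      ; degree  = #nodes (left J)
      ; bounded = bounded′
      }
      where
      bounded′ : ∀ u → #nodes (left J) ℕ.< length u →
                 (if does (treeShapes u ≟ˢˢ shapes J) then 1# else 0#) ≈ 0#
      bounded′ u lt with treeShapes u ≟ˢˢ shapes J
      ... | no  _  = ≈-refl
      ... | yes eq =
        ⊥-elim (ℕ.<⇒≢ lt (trans (cong #nodes (sym (cong proj₁ eq))) (#nodes-incr u)))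

  open Polynomials using (Polynomial; polynomials; coef; 1ᵖ; wordSum)

  r : ∀ X → Baxter.Carrierᴹ → Polynomial X
  r X = extend (polynomials X) (wordSum X)

  -- Both sides of the alphabet doubling formula are elements of K⟨X⟩ ⊗ K⟨Y⟩
  -- and its completion, seen as functions giving the coefficient of each
  -- p ⊗ q with p a word on X and q a word on Y.
  BiSeries : Alphabet → Alphabet → Set c
  BiSeries X Y = List (Letter X) → List (Letter Y) → Carrier

  -- Letting the letters of X commute with those of Y: the words on X ⊕ Y with
  -- restrictions p and q are the shuffles of p and q, each arising once.
  commute : ∀ X Y → Polynomial (X ⊕ Y) → BiSeries X Y
  commute X Y f p q = sum (map (coef f) (shuffles (map inj₁ p) (map inj₂ q)))

  tensor : ∀ X Y → (Baxter.Carrierᴹ → Polynomial X) → (Baxter.Carrierᴹ → Polynomial Y) →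
           Baxter⊗Baxter.Carrierᴹ → BiSeries X Y
  tensor X Y f g d p q =
    extend (scalars {R = rawRing}) (λ (J , J′) → coef (f (P J)) p * coef (g (P J′)) q) d

  record IsPolynomialRealization (ρ : ∀ X → Baxter.Carrierᴹ → Polynomial X) : Set (c ⊔ ℓ₁) where
    open Polynomials 𝔸 using (_∙ᵖ_)
    open RawLeftModule (polynomials 𝔸) using (_≈ᴹ_)
    field
      linear-injective : LeftModuleMorphisms.IsLeftModuleMonomorphism Baxter (polynomials 𝔸) (ρ 𝔸)
      unit-homo        : ∀ z → IsUnit z → ρ 𝔸 z ≈ᴹ 1ᵖ 𝔸
      prod-homo        : ∀ x y z → IsProduct x y z → ρ 𝔸 z ≈ᴹ (ρ 𝔸 x ∙ᵖ ρ 𝔸 y)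
      doubling         : ∀ x d → IsCoproduct x d → ∀ p q →
                         commute 𝔸 𝔸 (ρ (𝔸 ⊕ 𝔸) x) p q ≈ tensor 𝔸 𝔸 (ρ 𝔸) (ρ 𝔸) d p q

{-# OPTIONS --safe #-}

module Submission where

-- Sorting the positions of a word u by their letters, equal letters from left to
-- right, yields a permutation σ, the inverse of std(u), and the binary search
-- trees of σ have the shapes of incr(u) and decr(u).  Hence r_A(F_σ), the sum of
-- these words u, realizes FQSym, and the coefficient of F_σ in an element of
-- Baxter is the coefficient of every such u in its image under r_A.  Baxter is
-- stable because the shapes of a word determine those of its prefixes and
-- suffixes (product) and, together with the set of positions of the letters of A,
-- those of a shuffle of a word on A and a word on B (coproduct).  Injectivity needs
-- each pair of twin trees to come from a word: the root of the left tree is a node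
-- without children of the right one, and can be removed from both.

open import Defs
open import Level using (Level; 0ℓ)
open import Algebra.Apartness.Bundles using (HeytingField; HeytingCommutativeRing)
open import Algebra.Bundles using (CommutativeRing; CommutativeMonoid)
open import Algebra.Module.Morphism.Structures using (module LeftModuleMorphisms)
open import Data.Bool.Base using (Bool; true; false; not; if_then_else_)
import Data.Bool.Properties as Bool
open import Data.Empty using (⊥-elim)
open import Data.Fin.Base as Fin using (Fin)
open import Data.Fin.Patterns using (0F; 1F)
open import Data.List.Base as List
  using (List; []; _∷_; _++_; [_]; length; map; foldl; foldr; filter; concatMap; cartesianProduct;
         take; drop; allFin; lookup; replicate; reverse; deduplicate)
import Data.List.Properties as List
open import Data.List.Membership.Propositional using (_∈_)
open import Data.List.Membership.Propositional.Properties
open import Data.List.Relation.Binary.Permutation.Propositional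
  using (_↭_; prep; ↭-swap; ↭-refl; ↭-reflexive; ↭-sym; ↭-trans; ↭⇒↭ₛ)
import Data.List.Relation.Binary.Permutation.Propositional.Properties as ↭
import Data.List.Relation.Binary.Permutation.Setoid.Properties as ↭ₛ
open import Data.List.Relation.Binary.Pointwise as Pointwise using (Pointwise; []; _∷_)
open import Data.List.Relation.Unary.All as All using (All; []; _∷_)
import Data.List.Relation.Unary.All.Properties as All
open import Data.List.Relation.Unary.AllPairs as AllPairs using (AllPairs; []; _∷_)
import Data.List.Relation.Unary.AllPairs.Properties as AllPairs
open import Data.List.Relation.Unary.Any as Any using (Any; here; there)
import Data.List.Relation.Unary.Any.Properties as Any
open import Data.List.Relation.Unary.Unique.DecSetoid.Properties using (deduplicate-!)
open import Data.List.Relation.Unary.Unique.Propositional using (Unique)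
import Data.List.Relation.Unary.Unique.Propositional.Properties as Unique
open import Data.Nat.Base as ℕ using (ℕ; zero; suc; z≤n; s≤s; s<s; z<s)
import Data.Nat.Properties as ℕ
open import Data.Product.Base using (∃; ∃₂; _×_; _,_; proj₁; proj₂; map₁; map₂; swap)
open import Data.Product.Properties using () renaming (≡-dec to ×-≡-dec)
open import Data.Product.Relation.Binary.Pointwise.NonDependent using (×-decSetoid)
open import Data.Sum.Base using (_⊎_; inj₁; inj₂)
open import Data.Sum.Relation.Binary.LeftOrder using (₁∼₂; ₁∼₁; ₂∼₂; drop-inj₁; drop-inj₂)
open import Data.Tree.Binary using (Tree; leaf; node; #nodes)
open import Data.Unit.Base using (⊤; tt)
open import Function.Base using (_∘_; flip; id)
open import Relation.Binary.Bundles using (DecSetoid)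
import Relation.Binary.Construct.On as On
open import Relation.Binary.Core using (Rel)
open import Relation.Binary.Definitions using (tri<; tri≈; tri>)
open import Relation.Binary.PropositionalEquality hiding ([_])
open import Relation.Binary.Structures using (IsStrictTotalOrder)
open import Relation.Nullary using (¬_; Dec; yes; no; does)
open import Relation.Nullary.Decidable using (_×-dec_; decidable-stable; ¬?)

-- Products and coproducts are never computed on trees. The coefficient of a permutation in a
-- product, or of a pair of permutations in a coproduct, is rewritten as a coefficient on the side
-- of words, at any words that these permutations sort. Lying in the image of `ι` amounts to being
-- constant on the fibres of `Pˢ`, which thereby becomes a statement on shapes of words. The same
-- rewriting then yields the morphism property and the doubling formula. Minima and maxima are
-- treated at once by abstracting a relation `R`. Ties go to the left for `incr` and to the right
-- for `decr`, so that the two relations, x ≤ y and x > y, are exact complements. This is why the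
-- two canopies are opposite, and why reversing the sorted positions exchanges the two trees. Trees
-- are described by an inductive relation `Build`, which keeps the depth bound of `buildTree` out of
-- all arguments but one.

private variable
  A B : Set

-- Decision trees of words

++-∷-split : ∀ (v : List A) {a w} p {q} → v ++ a ∷ w ≡ p ++ q →
             (∃ λ q′ → v ≡ p ++ q′ × q ≡ q′ ++ a ∷ w) ⊎ (∃ λ p′ → p ≡ v ++ a ∷ p′ × w ≡ p′ ++ q)
++-∷-split v       []      eq   = inj₁ (v , refl , sym eq)
++-∷-split []      (_ ∷ p) refl = inj₂ (p , refl , refl)
++-∷-split (x ∷ v) (y ∷ p) eq with refl , eq′ ← List.∷-injective eq
  with ++-∷-split v p eq′
... | inj₁ (q′ , refl , refl) = inj₁ (q′ , refl , refl)
... | inj₂ (p′ , refl , refl) = inj₂ (p′ , refl , refl)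

-- R x y means that x is preferred to y when x occurs before y.  The tree of a
-- word has its preferred letter at the root: incr and decr are the cases
-- where x R y is x ≤ y and x > y respectively.
data Build (R : Rel A 0ℓ) : List A → Shape → Set where
  leaf : Build R [] (leaf tt)
  node : ∀ {u l r} v a w → u ≡ v ++ a ∷ w → All (λ x → ¬ R x a) v → All (R a) w →
         Build R v l → Build R w r → Build R u (node l tt r)

module _ {R : Rel A 0ℓ} where

  -- If the two cuts differed, the left one would have to be preferred to the right one by its own
  -- condition and not preferred by the condition of the other. Nothing is asked of `R`.
  factorization-unique : ∀ v {a w} v′ {a′ w′} → v ++ a ∷ w ≡ v′ ++ a′ ∷ w′ →
    All (λ x → ¬ R x a) v → All (R a) w → All (λ x → ¬ R x a′) v′ → All (R a′) w′ →
    v ≡ v′ × a ≡ a′ × w ≡ w′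
  factorization-unique [] [] refl _ _ _ _ = refl , refl , refl
  factorization-unique [] (_ ∷ v′) refl _ aw (na ∷ _) _ =
    ⊥-elim (na (All.lookup aw (∈-++⁺ʳ v′ (here refl))))
  factorization-unique (_ ∷ v) [] refl (na ∷ _) _ _ aw =
    ⊥-elim (na (All.lookup aw (∈-++⁺ʳ v (here refl))))
  factorization-unique (x ∷ v) (_ ∷ v′) eq (_ ∷ p) q (_ ∷ p′) q′
    with refl , eq′ ← List.∷-injective eq
    with refl , refl , refl ← factorization-unique v v′ eq′ p q p′ q′ = refl , refl , refl

  Build-unique : ∀ {u t t′} → Build R u t → Build R u t′ → t ≡ t′
  Build-unique leaf leaf = refl
  Build-unique leaf (node [] _ _ () _ _ _ _)
  Build-unique leaf (node (_ ∷ _) _ _ () _ _ _ _)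
  Build-unique (node [] _ _ () _ _ _ _) leaf
  Build-unique (node (_ ∷ _) _ _ () _ _ _ _) leaf
  Build-unique (node v a w refl p q bv bw) (node v′ a′ w′ eq p′ q′ bv′ bw′)
    with refl , refl , refl ← factorization-unique v v′ eq p q p′ q′ =
    cong₂ (λ l r → node l tt r) (Build-unique bv bv′) (Build-unique bw bw′)

  #nodes-Build : ∀ {u t} → Build R u t → #nodes t ≡ length u
  #nodes-Build leaf = refl
  #nodes-Build (node v _ _ refl _ _ bv bw) =
    trans (cong₂ (λ k l → k ℕ.+ suc l) (#nodes-Build bv) (#nodes-Build bw))
          (sym (List.length-++ v))

  -- `f` has to reflect the relation as well, because the condition on the letters left of a root is
  -- a negation.
  Build-map : ∀ {R′ : Rel B 0ℓ} (f : A → B) →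
              (∀ {x y} → R x y → R′ (f x) (f y)) → (∀ {x y} → R′ (f x) (f y) → R x y) →
              ∀ {u t} → Build R u t → Build R′ (map f u) t
  Build-map f pres refl′ leaf = leaf
  Build-map f pres refl′ (node v a w refl p q bv bw) =
    node (map f v) (f a) (map f w) (List.map-++ f v (a ∷ w))
         (All.map⁺ (All.map (_∘ refl′) p)) (All.map⁺ (All.map pres q))
         (Build-map f pres refl′ bv) (Build-map f pres refl′ bw)

-- The trees of the prefix of length k and of the remaining suffix.
cut : ℕ → Shape → Shape × Shape
cut k (leaf _) = leaf tt , leaf tt
cut k (node l _ r) with k ℕ.≤? #nodes l
... | yes _ = map₂ (λ s → node s tt r) (cut k l)
... | no  _ = map₁ (node l tt) (cut (k ℕ.∸ suc (#nodes l)) r)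

cut-left : ∀ {k} l r → k ℕ.≤ #nodes l →
           cut k (node l tt r) ≡ map₂ (λ s → node s tt r) (cut k l)
cut-left {k} l r k≤ with k ℕ.≤? #nodes l
... | yes _  = refl
... | no  k≰ = ⊥-elim (k≰ k≤)

cut-right : ∀ k l r → cut (#nodes l ℕ.+ suc k) (node l tt r) ≡ map₁ (node l tt) (cut k r)
cut-right k l r with #nodes l ℕ.+ suc k ℕ.≤? #nodes l
... | yes ≤l = ⊥-elim (ℕ.m+1+n≰m (#nodes l) ≤l)
... | no  _  = cong (λ j → map₁ (node l tt) (cut j r))
  (trans (cong (ℕ._∸ suc (#nodes l)) (ℕ.+-suc (#nodes l) k)) (ℕ.m+n∸m≡n (suc (#nodes l)) k))

module _ {R : Rel A 0ℓ} where

  -- The conditions on a root range over all letters on either side, so they survive in the factor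
  -- that keeps the root letter; the other factor lies in one subtree. As `cut` sees only a length
  -- and a shape, this is the source of stability under products.
  Build-cut : ∀ p {q t} → Build R (p ++ q) t →
              Build R p (proj₁ (cut (length p) t)) × Build R q (proj₂ (cut (length p) t))
  Build-cut p b = go p b refl
    where
    go : ∀ {u t} p {q} → Build R u t → u ≡ p ++ q →
         Build R p (proj₁ (cut (length p) t)) × Build R q (proj₂ (cut (length p) t))
    go []      {[]} leaf refl = leaf , leaf
    go p {q} (node {l = l} {r} v a w refl na aw bv bw) eq with ++-∷-split v p eq
    ... | inj₁ (q′ , refl , refl)
      rewrite cut-left {length p} l r
        (subst (length p ℕ.≤_) (sym (trans (#nodes-Build bv) (List.length-++ p))) (ℕ.m≤m+n _ _))
      with bp , bq ← go p bv refl
      = bp , node q′ a w refl (All.++⁻ʳ p na) aw bq bw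
    ... | inj₂ (p′ , refl , refl)
      rewrite List.length-++ v {a ∷ p′} | sym (#nodes-Build bv) | cut-right (length p′) l r
      with bp , bq ← go p′ bw refl
      = node v a p′ refl na (All.++⁻ˡ p′ aw) bv bp , bq

-- Trees of shuffles in which the letters of one word win

data Mix {A : Set} : List Bool → List A → List A → List A → Set where
  []    : Mix [] [] [] []
  takeˡ : ∀ {S p q w} x → Mix S p q w → Mix (true ∷ S) (x ∷ p) q (x ∷ w)
  takeʳ : ∀ {S p q w} x → Mix S p q w → Mix (false ∷ S) p (x ∷ q) (x ∷ w)

Mix-swap : ∀ {S} {p q w : List A} → Mix S p q w → Mix (map not S) q p w
Mix-swap []          = []
Mix-swap (takeˡ x m)  = takeʳ x (Mix-swap m)
Mix-swap (takeʳ x m) = takeˡ x (Mix-swap m)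

Mix-[]ˡ : ∀ {S} {q w : List A} → Mix S [] q w → w ≡ q
Mix-[]ˡ []          = refl
Mix-[]ˡ (takeʳ x m) = cong (x ∷_) (Mix-[]ˡ m)

All-Mix : ∀ {P : A → Set} {S p q w} → Mix S p q w → All P p → All P q → All P w
All-Mix []          _        _        = []
All-Mix (takeˡ _ m)  (a ∷ ap) aq       = a ∷ All-Mix m ap aq
All-Mix (takeʳ _ m) ap       (a ∷ aq) = a ∷ All-Mix m ap aq

-- A mixture cut at a letter of its left component.
record Cut {A : Set} (S₁ S₂ : List Bool) (v : List A) (a : A) (u q w : List A) : Set where
  constructor mkCut
  field
    q₁ q₂ w₁ w₂ : List A
    q-≡  : q ≡ q₁ ++ q₂
    w-≡  : w ≡ w₁ ++ a ∷ w₂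
    mix₁ : Mix S₁ v q₁ w₁
    mix₂ : Mix S₂ u q₂ w₂

-- The two cuts happen at the same place, since the selectors agree.
Mix-cut : ∀ {S} v v′ {a a′ u u′ q q′ w w′} → length {A = A} v ≡ length {A = B} v′ →
          Mix S (v ++ a ∷ u) q w → Mix S (v′ ++ a′ ∷ u′) q′ w′ →
          ∃₂ λ S₁ S₂ → Cut S₁ S₂ v a u q w × Cut S₁ S₂ v′ a′ u′ q′ w′
Mix-cut [] [] _ (takeˡ a m) (takeˡ a′ m′) =
  [] , _ , mkCut [] _ [] _ refl refl [] m , mkCut [] _ [] _ refl refl [] m′
Mix-cut (x ∷ v) (x′ ∷ v′) eq (takeˡ _ m) (takeˡ _ m′)
  with S₁ , S₂ , mkCut q₁ _ w₁ _ refl refl m₁ m₂ , mkCut q₁′ _ w₁′ _ refl refl m₁′ m₂′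
       ← Mix-cut v v′ (ℕ.suc-injective eq) m m′ =
  true ∷ S₁ , S₂ , mkCut q₁ _ (x ∷ w₁) _ refl refl (takeˡ x m₁) m₂ ,
                   mkCut q₁′ _ (x′ ∷ w₁′) _ refl refl (takeˡ x′ m₁′) m₂′
Mix-cut v v′ eq (takeʳ y m) (takeʳ y′ m′)
  with S₁ , S₂ , mkCut q₁ _ w₁ _ refl refl m₁ m₂ , mkCut q₁′ _ w₁′ _ refl refl m₁′ m₂′
       ← Mix-cut v v′ eq m m′ =
  false ∷ S₁ , S₂ , mkCut (y ∷ q₁) _ (y ∷ w₁) _ refl refl (takeʳ y m₁) m₂ ,
                    mkCut (y′ ∷ q₁′) _ (y′ ∷ w₁′) _ refl refl (takeʳ y′ m₁′) m₂′

Mix-lengthʳ : ∀ {S} {p q w : List A} {p′ q′ w′ : List B} →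
              Mix S p q w → Mix S p′ q′ w′ → length q ≡ length q′
Mix-lengthʳ []          []           = refl
Mix-lengthʳ (takeˡ _ m)  (takeˡ _ m′)  = Mix-lengthʳ m m′
Mix-lengthʳ (takeʳ _ m) (takeʳ _ m′) = cong suc (Mix-lengthʳ m m′)

-- The two conditions cover the two possible orders of occurrence, so `x` is preferred to the
-- letters of `q` wherever they are mixed in.
Wins : Rel A 0ℓ → A → List A → Set
Wins R x q = All (λ y → R x y × ¬ R y x) q

module _ {R : Rel A 0ℓ} where

  -- The root of a mixture is the root letter of its winning component. Cutting there also cuts `q`
  -- in two, and the trees of the pieces come from `Build-cut`; the recursion follows the tree of
  -- `p` and ends on a factor of `q`. The place of every cut depends only on `S` and the tree of
  -- `p`, hence is common to both mixtures.
  Build-Mix : ∀ {S p p′ q q′ w w′ s t} → All (λ x → Wins R x q) p → All (λ x → Wins R x q′) p′ →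
              Build R p s → Build R p′ s → Build R q t → Build R q′ t →
              Mix S p q w → Mix S p′ q′ w′ → ∃ λ o → Build R w o × Build R w′ o
  Build-Mix _ _ leaf leaf bq bq′ m m′ with refl ← Mix-[]ˡ m | refl ← Mix-[]ˡ m′ = _ , bq , bq′
  Build-Mix ap ap′ (node v a u refl na au bv bu) (node v′ a′ u′ refl na′ au′ bv′ bu′) bq bq′ m m′
    with S₁ , S₂ , mkCut q₁ q₂ w₁ w₂ refl refl m₁ m₂ , mkCut q₁′ q₂′ w₁′ w₂′ refl refl m₁′ m₂′
         ← Mix-cut v v′ (trans (sym (#nodes-Build bv)) (#nodes-Build bv′)) m m′
    with bq₁ , bq₂ ← Build-cut q₁ bq | bq₁′ , bq₂′ ← Build-cut q₁′ bq′
    -- With equal lengths both factors of `q` and `q′` carry the same cut of `t`.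
    rewrite Mix-lengthʳ m₁ m₁′
    with xs , x ∷ ys ← All.++⁻ v ap | xs′ , x′ ∷ ys′ ← All.++⁻ v′ ap′
    with o₁ , b₁ , b₁′ ← Build-Mix (All.map (All.++⁻ˡ q₁) xs) (All.map (All.++⁻ˡ q₁′) xs′)
                                   bv bv′ bq₁ bq₁′ m₁ m₁′
       | o₂ , b₂ , b₂′ ← Build-Mix (All.map (All.++⁻ʳ q₁) ys) (All.map (All.++⁻ʳ q₁′) ys′)
                                   bu bu′ bq₂ bq₂′ m₂ m₂′
    = node o₁ tt o₂
    , node w₁ a w₂ refl (All-Mix m₁ na (All.map proj₂ (All.++⁻ˡ q₁ x)))
           (All-Mix m₂ au (All.map proj₁ (All.++⁻ʳ q₁ x))) b₁ b₂
    , node w₁′ a′ w₂′ refl (All-Mix m₁′ na′ (All.map proj₂ (All.++⁻ˡ q₁′ x′)))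
           (All-Mix m₂′ au′ (All.map proj₁ (All.++⁻ʳ q₁′ x′))) b₁′ b₂′

-- Canopies

-- The canopy with the two outer leaves never written; innerˡ and innerʳ also
-- keep the leaf that a subtree shares with its parent.
inner innerˡ innerʳ : Shape → List (Fin 2)
inner (leaf _)     = []
inner (node l _ r) = innerˡ l ++ innerʳ r
innerˡ (leaf _)       = []
innerˡ t@(node _ _ _) = inner t ++ [ 0F ]
innerʳ (leaf _)       = []
innerʳ t@(node _ _ _) = 1F ∷ inner t

leafWord-innerˡ : ∀ t → leafWord 1F t ≡ 1F ∷ innerˡ t
leafWord-innerʳ : ∀ t → leafWord 0F t ≡ innerʳ t ++ [ 0F ]
leafWord-inner  : ∀ {d} l r → leafWord d (node l tt r) ≡ 1F ∷ inner (node l tt r) ++ [ 0F ]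
leafWord-innerˡ (leaf _)      = refl
leafWord-innerˡ (node l tt r) = leafWord-inner {1F} l r
leafWord-innerʳ (leaf _)      = refl
leafWord-innerʳ (node l tt r) = leafWord-inner {0F} l r
leafWord-inner l r = trans (cong₂ _++_ (leafWord-innerˡ l) (leafWord-innerʳ r))
                           (cong (1F ∷_) (sym (List.++-assoc (innerˡ l) (innerʳ r) _)))

length-inner  : ∀ l r → length (inner (node l tt r)) ≡ #nodes l ℕ.+ #nodes r
length-innerˡ : ∀ t → length (innerˡ t) ≡ #nodes t
length-innerʳ : ∀ t → length (innerʳ t) ≡ #nodes t
length-inner l r = trans (List.length-++ (innerˡ l)) (cong₂ ℕ._+_ (length-innerˡ l) (length-innerʳ r))
length-innerˡ (leaf _)      = refl
length-innerˡ (node l tt r) = trans (List.length-++ (inner (node l tt r)))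
  (trans (cong (ℕ._+ 1) (length-inner l r))
         (trans (ℕ.+-assoc (#nodes l) _ 1) (cong (#nodes l ℕ.+_) (ℕ.+-comm _ 1))))
length-innerʳ (leaf _)      = refl
length-innerʳ (node l tt r) = trans (cong suc (length-inner l r)) (sym (ℕ.+-suc (#nodes l) _))

canopy-inner : ∀ t → canopy t ≡ inner t
canopy-inner (leaf _) = refl
canopy-inner t@(node l tt r) rewrite leafWord-inner {0F} l r | ℕ.+-suc (#nodes l) (#nodes r) =
  subst (λ n → take n (inner t ++ [ 0F ]) ≡ inner t) (length-inner l r)
        (take-length-++ (inner t))
  where
  take-length-++ : ∀ (xs : List (Fin 2)) {ys} → take (length xs) (xs ++ ys) ≡ xs
  take-length-++ []       = refl
  take-length-++ (x ∷ xs) = cong (x ∷_) (take-length-++ xs)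

module Steps {R : Rel A 0ℓ} (R? : ∀ x y → Dec (R x y)) where

  step : A → A → Fin 2
  step x y = if does (R? x y) then 1F else 0F

  step-yes : ∀ {x y} → R x y → step x y ≡ 1F
  step-yes {x} {y} r with R? x y
  ... | yes _ = refl
  ... | no ¬r = ⊥-elim (¬r r)

  step-no : ∀ {x y} → ¬ R x y → step x y ≡ 0F
  step-no {x} {y} ¬r with R? x y
  ... | yes r = ⊥-elim (¬r r)
  ... | no _  = refl

  steps : List A → List (Fin 2)
  steps []          = []
  steps (x ∷ [])    = []
  steps (x ∷ y ∷ u) = step x y ∷ steps (y ∷ u)

  -- Of two consecutive letters one is an ancestor of the other, and the leaf between them hangs
  -- from the lower one: as a left child, written 1, exactly when the earlier letter is preferred.
  -- So a canopy records the preferences between neighbours.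
  inner-Build  : ∀ {u t} → Build R u t → inner t ≡ steps u
  innerʳ-Build : ∀ {a w t} → All (R a) w → Build R w t → innerʳ t ≡ steps (a ∷ w)
  innerˡ-Build : ∀ {v a w t} → All (λ x → ¬ R x a) v → Build R v t →
                 innerˡ t ++ steps (a ∷ w) ≡ steps (v ++ a ∷ w)
  inner-Build leaf = refl
  inner-Build (node v a w refl p q bv bw) =
    trans (cong (_ ++_) (innerʳ-Build q bw)) (innerˡ-Build p bv)
  innerʳ-Build _ leaf = refl
  innerʳ-Build (r ∷ _) b@(node [] _ _ refl _ _ _ _) = cong₂ _∷_ (sym (step-yes r)) (inner-Build b)
  innerʳ-Build (r ∷ _) b@(node (_ ∷ _) _ _ refl _ _ _ _) =
    cong₂ _∷_ (sym (step-yes r)) (inner-Build b)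
  innerˡ-Build _ leaf = refl
  innerˡ-Build {v} {a} {w} p b@(node {l = l} {r} _ _ _ eq _ _ _ _) =
    trans (List.++-assoc (inner (node l tt r)) [ 0F ] (steps (a ∷ w)))
          (trans (cong (_++ 0F ∷ steps (a ∷ w)) (inner-Build b))
                 (last-step v p (λ { refl → nonempty _ eq })))
    where
    nonempty : ∀ v {b : A} {w} → [] ≢ v ++ b ∷ w
    nonempty []      ()
    nonempty (_ ∷ _) ()
    last-step : ∀ v → All (λ x → ¬ R x a) v → v ≢ [] →
                steps v ++ 0F ∷ steps (a ∷ w) ≡ steps (v ++ a ∷ w)
    last-step []          _        v≢[] = ⊥-elim (v≢[] refl)
    last-step (x ∷ [])    (¬r ∷ _) _    = cong (_∷ _) (sym (step-no ¬r))
    last-step (x ∷ y ∷ v) (_ ∷ p)  _    = cong (step x y ∷_) (last-step (y ∷ v) p (λ ()))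

module _ {R R′ : Rel A 0ℓ} (R? : ∀ x y → Dec (R x y))
         (opp : ∀ {x y} → ¬ R x y → R′ x y) (opp′ : ∀ {x y} → R x y → ¬ R′ x y) where

  private
    R′? : ∀ x y → Dec (R′ x y)
    R′? x y with R? x y
    ... | yes r = no (opp′ r)
    ... | no ¬r = yes (opp ¬r)
    module S = Steps R?
    module S′ = Steps R′?

  -- Both canopies are words of steps, and complementary relations have opposite steps.
  inner-opposite : ∀ {u t t′} → Build R u t → Build R′ u t′ → Pointwise _≢_ (inner t) (inner t′)
  inner-opposite b b′ = subst₂ (Pointwise _≢_) (sym (S.inner-Build b)) (sym (S′.inner-Build b′)) (go _)
    where
    go : ∀ u → Pointwise _≢_ (S.steps u) (S′.steps u)
    go []          = []
    go (x ∷ [])    = []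
    go (x ∷ y ∷ u) = step≢ ∷ go (y ∷ u)
      where
      step≢ : S.step x y ≢ S′.step x y
      step≢ with R? x y
      ... | yes _ = λ ()
      ... | no _  = λ ()

-- Every pair of twin binary trees comes from a word

-- Known from the Loday-Ronco algebra: `over` grafts its second tree on the rightmost leaf of the
-- first, `under` its first tree on the leftmost leaf of the second. They are the two ways in which
-- `realize` merges the subtrees of a removed root.
over : Shape → Shape → Shape
over (leaf _)     t = t
over (node l _ r) t = node l tt (over r t)

under : Shape → Shape → Shape
under t (leaf _)     = t
under t (node l _ r) = node (under t l) tt r

cut-0 : ∀ t → cut 0 t ≡ (leaf tt , t)
cut-0 (leaf _)     = refl
cut-0 (node l _ r) = cong (map₂ λ s → node s tt r) (cut-0 l)

cut-all : ∀ t → cut (#nodes t) t ≡ (t , leaf tt)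
cut-all (leaf _)     = refl
cut-all (node l _ r) = trans (cut-right (#nodes r) l r) (cong (map₁ (node l tt)) (cut-all r))

cut-over : ∀ l r → cut (#nodes l) (over l r) ≡ (l , r)
cut-over (leaf _)     t = cut-0 t
cut-over (node l _ r) t =
  trans (cut-right (#nodes r) l (over r t)) (cong (map₁ (node l tt)) (cut-over r t))

#nodes-over : ∀ l r → #nodes (over l r) ≡ #nodes l ℕ.+ #nodes r
#nodes-over (leaf _)     t = refl
#nodes-over (node l _ r) t = trans (cong (λ k → #nodes l ℕ.+ suc k) (#nodes-over r t))
                                   (sym (ℕ.+-assoc (#nodes l) (suc (#nodes r)) (#nodes t)))

#nodes-under : ∀ l r → #nodes (under l r) ≡ #nodes l ℕ.+ #nodes r
#nodes-under t (leaf _)     = sym (ℕ.+-identityʳ (#nodes t))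
#nodes-under t (node l _ r) = trans (cong (ℕ._+ _) (#nodes-under t l))
                                    (ℕ.+-assoc (#nodes t) (#nodes l) _)

cut-under : ∀ l r → cut (#nodes l) (under l r) ≡ (l , r)
cut-under t (leaf _)     = cut-all t
cut-under t (node l _ r) =
  trans (cut-left (under t l) r (subst (#nodes t ℕ.≤_) (sym (#nodes-under t l)) (ℕ.m≤m+n _ _)))
        (cong (map₂ λ s → node s tt r) (cut-under t l))

-- Between two nonempty trees the leaf at the junction reads 1 for `over` and 0 for `under`. This
-- choice lets the merged tree remain a twin.
innerʳ-over : ∀ b t → innerʳ (over b t) ≡ innerʳ b ++ innerʳ t
inner-over  : ∀ l r t → inner (over (node l tt r) t) ≡ inner (node l tt r) ++ innerʳ t
innerʳ-over (leaf _)     t = refl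
innerʳ-over (node l _ r) t = cong (1F ∷_) (inner-over l r t)
inner-over l r t = trans (cong (innerˡ l ++_) (innerʳ-over r t)) (sym (List.++-assoc (innerˡ l) (innerʳ r) _))

innerˡ-under : ∀ t b → innerˡ (under t b) ≡ innerˡ t ++ innerˡ b
inner-under  : ∀ t l r → inner (under t (node l tt r)) ≡ innerˡ t ++ inner (node l tt r)
innerˡ-under t (leaf _)     = sym (List.++-identityʳ (innerˡ t))
innerˡ-under t (node l _ r) =
  trans (cong (_++ [ 0F ]) (inner-under t l r)) (List.++-assoc (innerˡ t) (inner (node l tt r)) _)
inner-under t l r = trans (cong (_++ innerʳ r) (innerˡ-under t l)) (List.++-assoc (innerˡ t) (innerˡ l) _)

-- Cherry k t t′: growing a node without children at leaf k of t yields t′.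
data Cherry : ℕ → Shape → Shape → Set where
  here    : Cherry 0 (leaf tt) (node (leaf tt) tt (leaf tt))
  inleft  : ∀ {k l l′} r → Cherry k l l′ → Cherry k (node l tt r) (node l′ tt r)
  inright : ∀ {k r r′} l → Cherry k r r′ → Cherry (#nodes l ℕ.+ suc k) (node l tt r) (node l tt r′)

Cherry-≤ : ∀ {k t t′} → Cherry k t t′ → k ℕ.≤ #nodes t
Cherry-≤ here          = z≤n
Cherry-≤ (inleft r c)  = ℕ.≤-trans (Cherry-≤ c) (ℕ.m≤m+n _ _)
Cherry-≤ (inright l c) = ℕ.+-monoʳ-≤ (#nodes l) (s≤s (Cherry-≤ c))

#nodes-Cherry : ∀ {k t t′} → Cherry k t t′ → #nodes t′ ≡ suc (#nodes t)
#nodes-Cherry here          = refl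
#nodes-Cherry (inleft r c)  = cong (ℕ._+ _) (#nodes-Cherry c)
#nodes-Cherry (inright l c) = trans (cong (λ k → #nodes l ℕ.+ suc k) (#nodes-Cherry c)) (ℕ.+-suc _ _)

-- The letter `m` loses to all others on either side, so it is never chosen as a root before it
-- stands alone: it occupies the leaf at the place where it is inserted.
Build-Cherry : ∀ {R : Rel A 0ℓ} {t t′} p {m q} → Cherry (length p) t t′ → Build R (p ++ q) t →
               All (λ x → R x m × ¬ R m x) (p ++ q) → Build R (p ++ m ∷ q) t′
Build-Cherry {R = R} p {m} {q} c b lo = go p c b refl {refl} lo
  where
  go : ∀ {u k t t′} p {q} → Cherry k t t′ → Build R u t → u ≡ p ++ q → {k ≡ length p} →
       All (λ x → R x m × ¬ R m x) (p ++ q) → Build R (p ++ m ∷ q) t′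
  go [] here leaf refl _ = node [] m [] refl [] [] leaf leaf
  go p (inleft r c) (node v a w refl na aw bv bw) eq {k≡} lo with ++-∷-split v p eq
  ... | inj₁ (q′ , refl , refl) =
    node (p ++ m ∷ q′) a w (sym (List.++-assoc p (m ∷ q′) (a ∷ w)))
         (All.++⁺ (All.++⁻ˡ p na) (proj₂ (All.lookup lo (∈-++⁺ʳ p (∈-++⁺ʳ q′ (here refl))))
                                  ∷ All.++⁻ʳ p na))
         aw (go p c bv refl {k≡} (All.++⁻ˡ (p ++ q′) (subst (All _) (sym (List.++-assoc p q′ _)) lo))) bw
  -- The leaf lies in the left subtree, so its index cannot exceed the length of `v`.
  ... | inj₂ (p′ , refl , refl) = ⊥-elim (ℕ.m+1+n≰m (length v)
    (subst₂ ℕ._≤_ (trans k≡ (List.length-++ v)) (#nodes-Build bv) (Cherry-≤ c)))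
  go p {q} (inright {k} l c) (node v a w refl na aw bv bw) eq {k≡} lo with ++-∷-split v p eq
  ... | inj₁ (q′ , refl , refl) = ⊥-elim (ℕ.m+1+n≢m (length p) (trans
          (trans (ℕ.+-suc (length p) _) (cong suc (sym (ℕ.+-assoc (length p) (length q′) k))))
          (trans (sym (ℕ.+-suc _ k))
                 (trans (cong (ℕ._+ suc k) (sym (trans (#nodes-Build bv) (List.length-++ p)))) k≡))))
  ... | inj₂ (p′ , refl , refl) =
    node v a (p′ ++ m ∷ q) (List.++-assoc v (a ∷ p′) (m ∷ q)) na
         (All.++⁺ (All.++⁻ˡ p′ aw) (proj₁ (All.lookup lo (∈-++⁺ˡ (∈-++⁺ʳ v (here refl))))
                                    ∷ All.++⁻ʳ p′ aw))
         bv (go p′ c bw refl {k≡′} (All.++⁻ʳ (v ++ [ a ]) (subst (All _) eq′ lo)))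
    where
    k≡′ : k ≡ length p′
    k≡′ = ℕ.suc-injective (ℕ.+-cancelˡ-≡ (length v) _ _
      (trans (cong (ℕ._+ suc k) (sym (#nodes-Build bv))) (trans k≡ (List.length-++ v))))
    eq′ : (v ++ a ∷ p′) ++ q ≡ (v ++ [ a ]) ++ p′ ++ q
    eq′ = trans (List.++-assoc v (a ∷ p′) q) (sym (List.++-assoc v [ a ] (p′ ++ q)))

length-leafWord : ∀ d t → length (leafWord d t) ≡ suc (#nodes t)
length-leafWord d (leaf _)     = refl
length-leafWord d (node l _ r) = trans (List.length-++ (leafWord 1F l))
  (cong₂ ℕ._+_ (length-leafWord 1F l) (length-leafWord 0F r))

-- A leaf which is a left child followed by a leaf which is a right child hang
-- from the same node.
leafWord-Cherry : ∀ d t α {β} → leafWord d t ≡ α ++ 1F ∷ 0F ∷ β →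
                  ∃₂ λ t′ e → Cherry (length α) t′ t × leafWord d t′ ≡ α ++ e ∷ β
leafWord-Cherry d (leaf _) []          ()
leafWord-Cherry d (leaf _) (_ ∷ [])    ()
leafWord-Cherry d (leaf _) (_ ∷ _ ∷ _) ()
leafWord-Cherry d (node l tt r) α {β} eq with ++-∷-split α (leafWord 1F l) (sym eq)
... | inj₁ (α′ , refl , eqʳ)
  with r′ , e , c , eq′ ← leafWord-Cherry 0F r α′ eqʳ =
  node l tt r′ , e ,
  subst (λ k → Cherry k (node l tt r′) (node l tt r)) length-α (inright l c) ,
  trans (cong (leafWord 1F l ++_) eq′) (sym (List.++-assoc (leafWord 1F l) α′ _))
  where
  length-α : #nodes l ℕ.+ suc (length α′) ≡ length (leafWord 1F l ++ α′)
  length-α = trans (ℕ.+-suc (#nodes l) _)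
    (sym (trans (List.length-++ (leafWord 1F l)) (cong (ℕ._+ length α′) (length-leafWord 1F l))))
... | inj₂ (_ ∷ β′ , eqˡ , eqβ) with refl , refl ← List.∷-injective eqβ
  with l′ , e , c , eq′ ← leafWord-Cherry 1F l α eqˡ =
  node l′ tt r , e , inleft r c ,
  trans (cong (_++ leafWord 0F r) eq′) (List.++-assoc α (e ∷ β′) _)
-- The two letters straddle the subtrees. The leaf word of a nonempty tree begins with 1 and ends
-- with 0, so both subtrees are leaves; the leaf replacing the node reads `d`, the side on which it
-- hangs.
leafWord-Cherry d (node (leaf _) tt (leaf _)) [] _
    | inj₂ ([] , _ , refl) = leaf tt , d , here , refl
leafWord-Cherry d (node (leaf _) tt _) (_ ∷ [])    _ | inj₂ ([] , () , _)
leafWord-Cherry d (node (leaf _) tt _) (_ ∷ _ ∷ _) _ | inj₂ ([] , () , _)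
leafWord-Cherry d (node (node a _ b) tt _) α _ | inj₂ ([] , eqˡ , _)
  with () ← List.∷ʳ-injectiveʳ (1F ∷ inner (node a tt b)) α (trans (sym (leafWord-inner {1F} a b)) eqˡ)
leafWord-Cherry d (node _ tt (node a _ b)) α _ | inj₂ ([] , _ , eqʳ)
  with () ← trans (sym (leafWord-inner {0F} a b)) (sym eqʳ)

inner-leafWord : ∀ t {e x e′} → leafWord 0F t ≡ e ∷ x ++ [ e′ ] → inner t ≡ x
inner-leafWord (leaf _) {x = []}    ()
inner-leafWord (leaf _) {x = _ ∷ _} ()
inner-leafWord (node l tt r) {x = x} eq = List.∷ʳ-injectiveˡ (inner (node l tt r)) x
  (List.∷-injectiveʳ (trans (sym (leafWord-inner {0F} l r)) eq))

Pointwise-++⁻ : ∀ {C : Set} {_∼_ : A → C → Set} xs {ys zs} → Pointwise _∼_ (xs ++ ys) zs →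
                ∃₂ λ e f → zs ≡ e ++ f × Pointwise _∼_ xs e × Pointwise _∼_ ys f
Pointwise-++⁻ []       ps = [] , _ , refl , [] , ps
Pointwise-++⁻ (x ∷ xs) (p ∷ ps) with e , f , refl , q , r ← Pointwise-++⁻ xs ps =
  _ ∷ e , f , refl , p ∷ q , r

≢0⇒≡1 : ∀ {x : Fin 2} → 0F ≢ x → x ≡ 1F
≢0⇒≡1 {0F} ne = ⊥-elim (ne refl)
≢0⇒≡1 {1F} ne = refl

≢1⇒≡0 : ∀ {x : Fin 2} → 1F ≢ x → x ≡ 0F
≢1⇒≡0 {0F} ne = refl
≢1⇒≡0 {1F} ne = ⊥-elim (ne refl)

#nodes≡0 : ∀ (t : Shape) → #nodes t ≡ 0 → t ≡ leaf tt
#nodes≡0 (leaf _)     _  = refl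
#nodes≡0 (node l _ _) eq with () ← trans (sym (ℕ.+-suc (#nodes l) _)) eq

Realizes : List ℕ → Shape → Shape → Set
Realizes w l r = Build (λ x y → ¬ y ℕ.< x) w l × Build (λ x y → y ℕ.< x) w r

-- The root of L carries the least letter, which has no child in R: the word is
-- found by removing it from both trees, where L′ is one of the two ways of
-- merging the subtrees of the root of L.
realize : ∀ n L R → #nodes L ≡ n → #nodes R ≡ n → Pointwise _≢_ (inner L) (inner R) →
          ∃ λ w → Realizes w L R
realize zero L R #L #R _
  rewrite #nodes≡0 L #L | #nodes≡0 R #R = [] , leaf , leaf
realize (suc n) (node l tt r) R@(node Rˡ tt Rʳ) #L #R opp
  with e , f , R≡ , oppˡ , oppʳ ← Pointwise-++⁻ (innerˡ l) opp = go l r e f refl refl oppˡ oppʳ R≡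
  where
  #l+#r : #nodes l ℕ.+ #nodes r ≡ n
  #l+#r = ℕ.suc-injective (trans (sym (ℕ.+-suc (#nodes l) _)) #L)

  -- Common end of all cases: the letters of a word for `L′` and `R′` are raised by one and 0 is
  -- inserted after `#nodes l` of them. Being least, 0 is the root for `incr`, with subtrees
  -- recovered by `cut`, and a new childless node for `decr`.
  grow : ∀ L′ {R′ k} → #nodes L′ ≡ #nodes l ℕ.+ #nodes r → cut (#nodes l) L′ ≡ (l , r) →
         Cherry k R′ R → k ≡ #nodes l →
         Pointwise _≢_ (inner L′) (inner R′) → ∃ λ w → Realizes w (node l tt r) R
  grow L′ {R′} #L′ cut≡ c k≡ opp′
    with w , bL , bR ← realize n L′ R′ (trans #L′ #l+#r)
                               (ℕ.suc-injective (trans (sym (#nodes-Cherry c)) #R)) opp′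
    = p ++ 0 ∷ q
    , node p 0 q refl (All.map⁺ (All.universal (λ _ ¬¬z<s → ¬¬z<s z<s) (take (#nodes l) w)))
           (All.map⁺ (All.universal (λ _ ()) (drop (#nodes l) w)))
           (subst (Build _ p) (cong proj₁ cut-p) (proj₁ bpq))
           (subst (Build _ q) (cong proj₂ cut-p) (proj₂ bpq))
    , Build-Cherry p (subst (λ k → Cherry k R′ R) (trans k≡ (sym p≡)) c)
        (subst (λ u → Build _ u R′) w≡ (Build-map suc s<s ℕ.s<s⁻¹ bR))
        (subst (All _) w≡ (All.map⁺ (All.universal (λ _ → z<s , λ ()) w)))
    where
    p = map suc (take (#nodes l) w)
    q = map suc (drop (#nodes l) w)
    w≡ : map suc w ≡ p ++ q
    w≡ = trans (cong (map suc) (sym (List.take++drop≡id (#nodes l) w)))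
               (List.map-++ suc (take (#nodes l) w) _)
    p≡ : length p ≡ #nodes l
    p≡ = trans (List.length-map suc (take (#nodes l) w)) (trans (List.length-take (#nodes l) w)
           (ℕ.m≤n⇒m⊓n≡m (subst (#nodes l ℕ.≤_) (trans (sym #L′) (#nodes-Build bL)) (ℕ.m≤m+n _ _))))
    cut-p : cut (length p) L′ ≡ (l , r)
    cut-p rewrite p≡ = cut≡
    bpq = Build-cut p (subst (λ u → Build _ u L′) w≡
            (Build-map suc (λ ¬lt lt → ¬lt (ℕ.s<s⁻¹ lt)) (λ ¬lt lt → ¬lt (s<s lt)) bL))

  go : ∀ l′ r′ e f → l ≡ l′ → r ≡ r′ → Pointwise _≢_ (innerˡ l′) e → Pointwise _≢_ (innerʳ r′) f →
       inner R ≡ e ++ f → ∃ λ w → Realizes w (node l tt r) R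
  -- Around its root the canopy of the left tree reads 0 1, so that of `R` reads 1 0. If a subtree
  -- is empty, the missing letter is supplied by an outer leaf of `R`, which reads 1 on the left and
  -- 0 on the right. In all cases a childless node of `R` is found at leaf `#nodes l`.
  go (leaf _) (leaf _) [] [] refl refl [] [] R≡
    with R′ , d , c , eq ← leafWord-Cherry 0F R [] (trans (leafWord-inner {0F} Rˡ Rʳ)
                             (cong (λ x → 1F ∷ x ++ [ 0F ]) R≡))
    with refl ← #nodes≡0 R′ (ℕ.suc-injective (trans (sym (#nodes-Cherry c))
                                                    (trans #R (cong suc (sym #l+#r)))))
    = grow (leaf tt) refl refl c refl []
  go (leaf _) (node a tt b) [] (x ∷ f) refl refl [] (1≢x ∷ opp′) R≡ with refl ← ≢1⇒≡0 1≢x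
    with R′ , d , c , eq ← leafWord-Cherry 0F R [] (trans (leafWord-inner {0F} Rˡ Rʳ)
                             (cong (λ x → 1F ∷ x ++ [ 0F ]) R≡))
    = grow r refl (cut-0 r) c refl (subst (Pointwise _≢_ (inner r)) (sym (inner-leafWord R′ eq)) opp′)
  go (node a tt b) r′ e f refl refl oppˡ oppʳ R≡
    with e , _ ∷ [] , refl , oppe , 0≢x ∷ [] ← Pointwise-++⁻ (inner l) oppˡ
    with refl ← ≢0⇒≡1 0≢x = go′ r′ f refl oppʳ R≡
    where
    α≡ : length (1F ∷ e) ≡ #nodes l
    α≡ = trans (cong suc (trans (sym (Pointwise.Pointwise-length oppe)) (length-inner a b)))
               (sym (ℕ.+-suc (#nodes a) _))
    go′ : ∀ r′ f → r ≡ r′ → Pointwise _≢_ (innerʳ r′) f → inner R ≡ (e ++ [ 1F ]) ++ f →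
          ∃ λ w → Realizes w (node l tt r) R
    go′ (leaf _) [] refl [] R≡
      with R′ , d , c , eq ← leafWord-Cherry 0F R (1F ∷ e) (trans (leafWord-inner {0F} Rˡ Rʳ)
                               (cong (1F ∷_) (trans (cong (_++ [ 0F ]) (trans R≡ (List.++-identityʳ _)))
                                                    (List.++-assoc e [ 1F ] [ 0F ]))))
      = grow l (sym (ℕ.+-identityʳ _)) (cut-all l) c α≡
             (subst (Pointwise _≢_ (inner l)) (sym (inner-leafWord R′ eq)) oppe)
    go′ (node a′ tt b′) (x ∷ f) refl (1≢x ∷ oppf) R≡ with refl ← ≢1⇒≡0 1≢x
      with leafWord-Cherry 0F R (1F ∷ e) (trans (leafWord-inner {0F} Rˡ Rʳ)
             (cong (1F ∷_) (trans (cong (_++ [ 0F ]) (trans R≡ (List.++-assoc e [ 1F ] _)))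
                                  (List.++-assoc e (1F ∷ 0F ∷ f) [ 0F ]))))
    -- The leaf left behind in `R′` may read 0 or 1. The junction of the merged tree has to read the
    -- opposite, which selects `over` for 0 and `under` for 1.
    ... | R′ , 0F , c , eq = grow (over l r) (#nodes-over l r) (cut-over l r) c α≡
      (subst₂ (Pointwise _≢_) (sym (inner-over a b r)) (sym (inner-leafWord R′ (trans eq
        (cong (1F ∷_) (sym (List.++-assoc e (0F ∷ f) [ 0F ]))))))
        (Pointwise.++⁺ oppe ((λ ()) ∷ oppf)))
    ... | R′ , 1F , c , eq = grow (under l r) (#nodes-under l r) (cut-under l r) c α≡
      (subst₂ (Pointwise _≢_) (trans (sym (List.++-assoc (inner l) [ 0F ] (inner r)))
                                     (sym (inner-under l a′ b′)))
        (sym (inner-leafWord R′ (trans eq (cong (1F ∷_) (sym (List.++-assoc e (1F ∷ f) [ 0F ]))))))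
        (Pointwise.++⁺ oppe ((λ ()) ∷ oppf)))

-- Sorting the positions of a word

number : ℕ → List A → List (ℕ × A)
number o []      = []
number o (x ∷ w) = (suc o , x) ∷ number (suc o) w

number-++ : ∀ o (u : List A) {v} → number o (u ++ v) ≡ number o u ++ number (o ℕ.+ length u) v
number-++ o []      {v} = cong (λ k → number k v) (sym (ℕ.+-identityʳ o))
number-++ o (x ∷ u) {v} = cong ((suc o , x) ∷_) (trans (number-++ (suc o) u)
  (cong (λ k → number (suc o) u ++ number k v) (sym (ℕ.+-suc o (length u)))))

number-shift : ∀ k o (w : List A) → number (k ℕ.+ o) w ≡ map (map₁ (k ℕ.+_)) (number o w)
number-shift k o []      = refl
number-shift k o (x ∷ w) = cong₂ _∷_ (cong (_, x) (sym (ℕ.+-suc k o)))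
  (trans (cong (λ j → number j w) (sym (ℕ.+-suc k o))) (number-shift k (suc o) w))

number-map : ∀ (f : A → B) o w → number o (map f w) ≡ map (map₂ f) (number o w)
number-map f o []      = refl
number-map f o (x ∷ w) = cong (_ ∷_) (number-map f (suc o) w)

number-bounds : ∀ o (w : List A) → All (λ b → o ℕ.< proj₁ b × proj₁ b ℕ.≤ o ℕ.+ length w) (number o w)
number-bounds o []      = []
number-bounds o (x ∷ w) =
  (ℕ.≤-refl , subst (suc o ℕ.≤_) (sym (ℕ.+-suc o _)) (s≤s (ℕ.m≤m+n o _)))
  ∷ All.map (λ (o< , ≤w) → ℕ.<-trans (ℕ.n<1+n o) o< , ℕ.≤-trans ≤w (ℕ.≤-reflexive (sym (ℕ.+-suc o _))))
            (number-bounds (suc o) w)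

number-letters : ∀ {P : A → Set} o w → All (P ∘ proj₂) (number o w) → All P w
number-letters o []      []       = []
number-letters o (x ∷ w) (p ∷ ps) = p ∷ number-letters (suc o) w ps

∈-number : ∀ {i} {x : A} o w → (i , x) ∈ number o w →
           ∃₂ λ v u → w ≡ v ++ x ∷ u × i ≡ suc (o ℕ.+ length v)
∈-number o (x ∷ w) (here refl) = [] , w , refl , cong suc (sym (ℕ.+-identityʳ o))
∈-number o (y ∷ w) (there i∈) with v , u , refl , refl ← ∈-number (suc o) w i∈ =
  y ∷ v , u , refl , cong suc (sym (ℕ.+-suc o (length v)))

Positions : ℕ → ℕ → List ℕ
Positions o n = map proj₁ (number o (replicate n tt))

number-positions : ∀ o (w : List A) → map proj₁ (number o w) ≡ Positions o (length w)
number-positions o []      = refl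
number-positions o (x ∷ w) = cong (suc o ∷_) (number-positions (suc o) w)

Positions-bounds : ∀ o n → All (λ i → o ℕ.< i × i ℕ.≤ o ℕ.+ n) (Positions o n)
Positions-bounds o n = All.map⁺ (All.map
  (λ (o< , ≤w) → o< , ℕ.≤-trans ≤w (ℕ.≤-reflexive (cong (o ℕ.+_) (List.length-replicate n))))
  (number-bounds o (replicate n tt)))

Positions-unique : ∀ o n → Unique (Positions o n)
Positions-unique o zero    = []
Positions-unique o (suc n) =
  All.map (λ (o< , _) → ℕ.<⇒≢ o<) (Positions-bounds (suc o) n) ∷ Positions-unique (suc o) n

length-Positions : ∀ o n → length (Positions o n) ≡ n
length-Positions o zero    = refl
length-Positions o (suc n) = cong suc (length-Positions (suc o) n)

filter-map : ∀ {P : B → Set} (P? : ∀ x → Dec (P x)) (f : A → B) xs →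
             filter P? (map f xs) ≡ map f (filter (P? ∘ f) xs)
filter-map P? f []       = refl
filter-map P? f (x ∷ xs) with does (P? (f x))
... | true  = cong (f x ∷_) (filter-map P? f xs)
... | false = filter-map P? f xs

module _ {P : A → Set} (P? : ∀ x → Dec (P x)) where

  filter-++-≡ˡ : ∀ {xs ys} → All P xs → All (¬_ ∘ P) ys → filter P? (xs ++ ys) ≡ xs
  filter-++-≡ˡ {xs} {ys} pxs pys = trans (List.filter-++ P? xs ys)
    (trans (cong₂ _++_ (List.filter-all P? pxs) (List.filter-none P? pys)) (List.++-identityʳ xs))

  filter-++-≡ʳ : ∀ {xs ys} → All P xs → All (¬_ ∘ P) ys → filter (¬? ∘ P?) (xs ++ ys) ≡ ys
  filter-++-≡ʳ {xs} {ys} pxs pys = trans (List.filter-++ (¬? ∘ P?) xs ys)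
    (cong₂ _++_ (List.filter-none (¬? ∘ P?) (All.map (λ p ¬p → ¬p p) pxs))
                (List.filter-all (¬? ∘ P?) pys))

-- `R` compares two letters only in their order of occurrence; the two components say in either
-- order that the first one is preferred.
Before : Rel A 0ℓ → Rel (ℕ × A) 0ℓ
Before R (i , x) (j , y) = (i ℕ.< j → R x y) × (j ℕ.< i → ¬ R y x)

-- π lists the positions of w, counted from o + 1, by decreasing preference.
Sorts : Rel A 0ℓ → ℕ → List ℕ → List A → Set
Sorts R o π w = ∃ λ B → B ↭ number o w × AllPairs (Before R) B × map proj₁ B ≡ π

insertAll : Tree ℕ ⊤ → List ℕ → Tree ℕ ⊤
insertAll = foldl λ t x → insert x t

insertionShapes : List ℕ → ShapePair
insertionShapes π = shape (insertAll (leaf tt) π) , shape (foldr insert (leaf tt) π)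

-- Leaf insertion never moves a root, so the later letters separate into two independent insertions.
insertAll-node : ∀ l y r xs → insertAll (node l y r) xs ≡
  node (insertAll l (filter (ℕ._≤? y) xs)) y (insertAll r (filter (λ x → ¬? (x ℕ.≤? y)) xs))
insertAll-node l y r []       = refl
insertAll-node l y r (x ∷ xs) with x ℕ.≤? y
... | yes x≤y = trans (insertAll-node (insert x l) y r xs)
  (cong₂ (λ us vs → node (insertAll l us) y (insertAll r vs))
         (sym (List.filter-accept (ℕ._≤? y) x≤y))
         (sym (List.filter-reject (λ x → ¬? (x ℕ.≤? y)) (λ ¬p → ¬p x≤y))))
... | no x≰y = trans (insertAll-node l y (insert x r) xs)
  (cong₂ (λ us vs → node (insertAll l us) y (insertAll r vs))
         (sym (List.filter-reject (ℕ._≤? y) x≰y))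
         (sym (List.filter-accept (λ x → ¬? (x ℕ.≤? y)) x≰y)))

positions-distinct : ∀ o (w : List A) {B} → B ↭ number o w → AllPairs (λ b c → proj₁ b ≢ proj₁ c) B
positions-distinct o w B↭ = AllPairs.map⁻ (↭ₛ.Unique-resp-↭ (setoid ℕ) (↭⇒↭ₛ (↭-sym (↭.map⁺ proj₁ B↭)))
  (subst Unique (sym (number-positions o w)) (Positions-unique o (length w))))

module _ {R : Rel A 0ℓ} where

  private
    at≤? : ∀ i (b : ℕ × A) → Dec (proj₁ b ℕ.≤ i)
    at≤? i b = proj₁ b ℕ.≤? i

  number-≤ : ∀ o (u v : List A) → All (λ b → proj₁ b ℕ.≤ o ℕ.+ length u) (number o u)
                                  × All (λ b → ¬ proj₁ b ℕ.≤ o ℕ.+ length u) (number (o ℕ.+ length u) v)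
  number-≤ o u v = All.map proj₂ (number-bounds o u) , All.map (ℕ.<⇒≱ ∘ proj₁) (number-bounds _ v)

  -- The first entry of `π` is the position of the preferred letter, and inserting the others sends
  -- the positions to its left into one subtree and those to its right into the other. The filtered
  -- lists are not structurally smaller, whence the bound on the length.
  Sorts-Build : ∀ {o π w} → Sorts R o π w → Build R w (shape (insertAll (leaf tt) π))
  Sorts-Build (B , B↭ , sorted , refl) = go (length B) B _ _ ℕ.≤-refl B↭ sorted
    where
    go : ∀ n B o w → length B ℕ.≤ n → B ↭ number o w → AllPairs (Before R) B →
         Build R w (shape (insertAll (leaf tt) (map proj₁ B)))
    go _ [] o []      _ _   _ = leaf
    go _ [] o (_ ∷ _) _ B↭ _ with () ← ↭.↭-empty-inv (↭-sym B↭)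
    go (suc n) ((i , x) ∷ B) o w (s≤s B≤n) B↭ (before ∷ sorted)
      with v , u , refl , refl ← ∈-number o w (↭.∈-resp-↭ B↭ (here refl)) =
      subst (λ t → Build R (v ++ x ∷ u) (shape t))
            (trans (cong₂ (λ xs ys → node (insertAll (leaf tt) xs) i (insertAll (leaf tt) ys))
                          (sym (filter-map _ proj₁ B)) (sym (filter-map _ proj₁ B)))
                   (sym (insertAll-node (leaf tt) i (leaf tt) (map proj₁ B))))
        (node v x u refl
          (number-letters o v (All.zipWith (λ ((_ , b) , j≤) → b (s≤s j≤))
            (↭.All-resp-↭ L↭ (All.filter⁺ (at≤? i) before) , ≤v)))
          (number-letters i u (All.zipWith (λ ((b , _) , i<) → b (ℕ.≰⇒> (≰u i<)))
            (↭.All-resp-↭ R↭ (All.filter⁺ (¬? ∘ at≤? i) before) , All.map proj₁ (number-bounds i u))))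
          (go n _ o v (ℕ.≤-trans (List.length-filter (at≤? i) B) B≤n) L↭
              (AllPairs.filter⁺ (at≤? i) sorted))
          (go n _ i u (ℕ.≤-trans (List.length-filter (¬? ∘ at≤? i) B) B≤n) R↭
              (AllPairs.filter⁺ (¬? ∘ at≤? i) sorted)))
      where
      ≤v : All (λ b → proj₁ b ℕ.≤ o ℕ.+ length v) (number o v)
      ≤v = proj₁ (number-≤ o v u)
      ≰u : ∀ {j} → i ℕ.< j → ¬ j ℕ.≤ i
      ≰u = ℕ.<⇒≱
      B↭′ : B ↭ number o v ++ number i u
      B↭′ = ↭.drop-∷ (↭-trans B↭ (↭-trans (↭-reflexive (number-++ o v)) (↭.shift _ (number o v) _)))
      all≤ = All.map (ℕ.m≤n⇒m≤1+n) ≤v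
      none≤ : All (λ b → ¬ proj₁ b ℕ.≤ i) (number i u)
      none≤ = All.map (ℕ.<⇒≱ ∘ proj₁) (number-bounds i u)
      L↭ : filter (at≤? i) B ↭ number o v
      L↭ = ↭-trans (↭.filter-↭ (at≤? i) B↭′) (↭-reflexive (filter-++-≡ˡ (at≤? i) all≤ none≤))
      R↭ : filter (¬? ∘ at≤? i) B ↭ number i u
      R↭ = ↭-trans (↭.filter-↭ (¬? ∘ at≤? i) B↭′) (↭-reflexive (filter-++-≡ʳ (at≤? i) all≤ none≤))

  Sorts-positions : ∀ {o π w} → Sorts R o π w → π ↭ Positions o (length w)
  Sorts-positions {o} {w = w} (B , B↭ , _ , refl) =
    ↭-trans (↭.map⁺ proj₁ B↭) (↭-reflexive (number-positions o w))

  -- The values of `π` are positions, so a prefix of the word corresponds to the small values of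
  -- `π`, kept in order. This is dual to the shifted shuffle.
  Sorts-++ : ∀ {o π} u {v} → Sorts R o π (u ++ v) →
             Sorts R o (filter (ℕ._≤? (o ℕ.+ length u)) π) u ×
             Sorts R (o ℕ.+ length u) (filter (λ i → ¬? (i ℕ.≤? (o ℕ.+ length u))) π) v
  Sorts-++ {o} u {v} (B , B↭ , sorted , refl) =
    ( filter (at≤? k) B
    , ↭-trans (↭.filter-↭ (at≤? k) B↭′) (↭-reflexive (filter-++-≡ˡ (at≤? k) all≤ none≤))
    , AllPairs.filter⁺ (at≤? k) sorted , sym (filter-map _ proj₁ B) ) ,
    ( filter (¬? ∘ at≤? k) B
    , ↭-trans (↭.filter-↭ (¬? ∘ at≤? k) B↭′) (↭-reflexive (filter-++-≡ʳ (at≤? k) all≤ none≤))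
    , AllPairs.filter⁺ (¬? ∘ at≤? k) sorted , sym (filter-map _ proj₁ B) )
    where
    k = o ℕ.+ length u
    B↭′ : B ↭ number o u ++ number k v
    B↭′ = ↭-trans B↭ (↭-reflexive (number-++ o u))
    all≤ = proj₁ (number-≤ o u v)
    none≤ = proj₂ (number-≤ o u v)

  Sorts-shift : ∀ k {o π w} → Sorts R (k ℕ.+ o) π w → ∃ λ ν → π ≡ map (k ℕ.+_) ν × Sorts R o ν w
  Sorts-shift k {o} {w = w} (B , B↭ , sorted , refl)
    with B′ , refl , ↭B′ ← ↭.↭-map-inv (map₁ (k ℕ.+_)) (↭-trans (↭-reflexive (sym (number-shift k o w))) (↭-sym B↭)) =
    map proj₁ B′ , trans (sym (List.map-∘ B′)) (List.map-∘ B′) , B′ , ↭-sym ↭B′ ,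
    AllPairs.map (λ (p , q) → p ∘ ℕ.+-monoʳ-< k , q ∘ ℕ.+-monoʳ-< k) (AllPairs.map⁻ sorted) , refl

  Sorts-map : ∀ {R′ : Rel B 0ℓ} (f : A → B) → (∀ {x y} → R x y → R′ (f x) (f y)) →
              (∀ {x y} → R′ (f x) (f y) → R x y) → ∀ {o π w} → Sorts R o π w → Sorts R′ o π (map f w)
  Sorts-map f pres refl′ {o} {w = w} (B , B↭ , sorted , refl) =
    map (map₂ f) B , ↭-trans (↭.map⁺ (map₂ f) B↭) (↭-reflexive (sym (number-map f o w))) ,
    AllPairs.map⁺ (AllPairs.map (λ (p , q) → pres ∘ p , λ lt → q lt ∘ refl′) sorted) ,
    sym (List.map-∘ B)

AllPairs-reverse : ∀ {_∼_ : Rel A 0ℓ} xs → AllPairs _∼_ xs → AllPairs (flip _∼_) (reverse xs)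
AllPairs-reverse []       []       = []
AllPairs-reverse {_∼_ = _∼_} (x ∷ xs) (p ∷ ps) =
  subst (AllPairs (flip _∼_)) (sym (List.unfold-reverse x xs))
    (AllPairs.++⁺ (AllPairs-reverse xs ps) ([] ∷ [])
      (All.map (_∷ []) (↭.All-resp-↭ (↭-sym (↭.↭-reverse xs)) p)))

-- Reversing turns one preference into the other: Pˢ inserts the letters of a
-- permutation in both directions.
Sorts-reverse : ∀ {R R′ : Rel A 0ℓ} → (∀ {x y} → ¬ R x y → R′ x y) → (∀ {x y} → R x y → ¬ R′ x y) →
                ∀ {o π w} → Sorts R o π w → Sorts R′ o (reverse π) w
Sorts-reverse opp opp′ (B , B↭ , sorted , refl) =
  reverse B , ↭-trans (↭.↭-reverse B) B↭ ,
  AllPairs.map (λ (p , q) → opp ∘ q , opp′ ∘ p) (AllPairs-reverse B sorted) , List.reverse-map proj₁ B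

module Sorting {R : Rel A 0ℓ} (R? : ∀ x y → Dec (R x y))
               (R-trans : ∀ {x y z} → R x y → R y z → R x z)
               (R-cotrans : ∀ {x y z} → ¬ R x y → ¬ R y z → ¬ R x z) where

  private
    -- If `z` occurs before `y`, only `¬ R z y` is known; failure of `R x z` would then give
    -- `¬ R x y` by cotransitivity.
    after : ∀ {x i y j z} → R x y → i ≢ j → Before R (i , y) (j , z) → R x z
    after {x} {i} {y} {j} {z} xy i≢j (f , g) with ℕ.<-cmp i j
    ... | tri< lt _ _ = R-trans xy (f lt)
    ... | tri≈ _ eq _ = ⊥-elim (i≢j eq)
    ... | tri> _ _ gt with R? x z
    ...   | yes xz = xz
    ...   | no ¬xz = ⊥-elim (R-cotrans ¬xz (g gt) xy)

    -- Since `x` occurs before every letter of `B`, it belongs just before the first `y` with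
    -- `R x y`, and `after` extends the preference to the remaining letters.
    insertFirst : ∀ o x B → All (λ b → suc o ℕ.< proj₁ b) B → AllPairs (λ b c → proj₁ b ≢ proj₁ c) B →
                  AllPairs (Before R) B →
                  ∃ λ B⁺ → B⁺ ↭ (suc o , x) ∷ B × AllPairs (Before R) B⁺
    insertFirst o x [] _ _ _ = _ , ↭-refl , [] ∷ []
    insertFirst o x ((i , y) ∷ B) (o<i ∷ o<B) (n ∷ ns) (p ∷ ps) with R? x y
    ... | yes xy = _ , ↭-refl ,
      (((λ _ → xy) , (λ i<o → ⊥-elim (ℕ.<-asym i<o o<i)))
       ∷ All.zipWith (λ (o<j , i≢j , b) → (λ _ → after xy i≢j b) , λ j<o → ⊥-elim (ℕ.<-asym j<o o<j))
                     (o<B , All.zip (n , p))) ∷ p ∷ ps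
    ... | no ¬xy with B⁺ , B⁺↭ , sorted ← insertFirst o x B o<B ns ps =
      (i , y) ∷ B⁺ , ↭-trans (prep _ B⁺↭) (↭-swap _ _ ↭-refl) ,
      ↭.All-resp-↭ (↭-sym B⁺↭) (((λ i<o → ⊥-elim (ℕ.<-asym i<o o<i)) , λ _ → ¬xy) ∷ p) ∷ sorted

  sort : ∀ o w → ∃ λ π → Sorts R o π w
  sort o []      = [] , [] , ↭-refl , [] , refl
  sort o (x ∷ w)
    with _ , B , B↭ , sorted , _ ← sort (suc o) w
    with B⁺ , B⁺↭ , sorted⁺ ← insertFirst o x B
           (↭.All-resp-↭ (↭-sym B↭) (All.map proj₁ (number-bounds (suc o) w)))
           (positions-distinct (suc o) w B↭) sorted =
    map proj₁ B⁺ , B⁺ , ↭-trans B⁺↭ (prep _ B↭) , sorted⁺ , refl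

-- Sorting a shuffle

number-letters⁺ : ∀ {P : A → Set} o {w} → All P w → All (P ∘ proj₂) (number o w)
number-letters⁺ o []       = []
number-letters⁺ o (p ∷ ps) = p ∷ number-letters⁺ (suc o) ps

-- The place of the i-th letter true of S, counting from 1.
pos : List Bool → ℕ → ℕ
pos S           zero    = zero
-- Beyond the end of `S` the values go on, and 0 is fixed: `pos S` is strictly increasing on all
-- numbers, without any range condition.
pos []          (suc i) = suc i
pos (true ∷ S)  (suc i) = suc (pos S i)
pos (false ∷ S) (suc i) = suc (pos S (suc i))

pos-mono : ∀ S {i j} → i ℕ.< j → pos S i ℕ.< pos S j
pos-mono []          {zero}  {suc j} _         = z<s
pos-mono (true ∷ S)  {zero}  {suc j} _         = z<s
pos-mono (false ∷ S) {zero}  {suc j} _         = z<s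
pos-mono []          {suc i} {suc j} i<j       = i<j
pos-mono (true ∷ S)  {suc i} {suc j} (s<s i<j) = s<s (pos-mono S i<j)
pos-mono (false ∷ S) {suc i} {suc j} i<j       = s<s (pos-mono S i<j)

pos-cancel : ∀ S {i j} → pos S i ℕ.< pos S j → i ℕ.< j
pos-cancel S {i} {j} lt with ℕ.<-cmp i j
... | tri< i<j _ _  = i<j
... | tri≈ _ refl _ = ⊥-elim (ℕ.<-irrefl refl lt)
... | tri> _ _ j<i  = ⊥-elim (ℕ.<-asym lt (pos-mono S j<i))

place : List Bool → List (ℕ × A) → List (ℕ × A)
place S = map (map₁ (pos S))

place-true : ∀ S (p : List A) → place (true ∷ S) (number 1 p) ≡ map (map₁ suc) (place S (number 0 p))
place-true S p = trans (cong (place (true ∷ S)) (number-shift 1 0 p))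
                       (trans (sym (List.map-∘ (number 0 p))) (List.map-∘ (number 0 p)))

place-false : ∀ S (q : List A) → place (false ∷ S) (number 0 q) ≡ map (map₁ suc) (place S (number 0 q))
place-false S q = trans (List.map-cong-local (All.map (λ { (s<s _ , _) → refl }) (number-bounds 0 q)))
                        (List.map-∘ (number 0 q))

number-Mix : ∀ {S} {p q w : List A} → Mix S p q w →
             number 0 w ↭ place S (number 0 p) ++ place (map not S) (number 0 q)
number-Mix-suc : ∀ {S} {p q w : List A} → Mix S p q w →
  number 1 w ↭ map (map₁ suc) (place S (number 0 p)) ++ map (map₁ suc) (place (map not S) (number 0 q))
number-Mix [] = ↭-refl
number-Mix {S = true ∷ S} {p = _ ∷ p} {q} (takeˡ x m) = prep (1 , x) (↭-trans (number-Mix-suc m)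
  (↭-reflexive (sym (cong₂ _++_ (place-true S p) (place-false (map not S) q)))))
number-Mix {S = false ∷ S} {p = p} {_ ∷ q} (takeʳ x m) = ↭-trans (prep (1 , x) (↭-trans (number-Mix-suc m)
  (↭-reflexive (sym (cong₂ _++_ (place-false S p) (place-true (map not S) q))))))
  (↭-sym (↭.shift (1 , x) (place (false ∷ S) (number 0 p)) _))
number-Mix-suc {S = S} {p} {w = w} m = ↭-trans (↭-reflexive (number-shift 1 0 w))
  (↭-trans (↭.map⁺ (map₁ suc) (number-Mix m))
           (↭-reflexive (List.map-++ (map₁ suc) (place S (number 0 p)) _)))

module _ {R : Rel A 0ℓ} where

  private
    place-sorted : ∀ S {B} → AllPairs (Before R) B → AllPairs (Before R) (place S B)
    place-sorted S sorted =
      AllPairs.map⁺ (AllPairs.map (λ (f , g) → f ∘ pos-cancel S , g ∘ pos-cancel S) sorted)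

    letters : ∀ {P : A → Set} {B o w} S → B ↭ number o w → All P w → All (P ∘ proj₂) (place S B)
    letters {o = o} S B↭ ps = All.map⁺ (↭.All-resp-↭ (↭-sym B↭) (number-letters⁺ o ps))

  -- Winning letters come first wherever they stand, so the sorted positions of a shuffle form a
  -- concatenation. Here the doubled alphabet meets the deconcatenation coproduct.
  Sorts-Mix : ∀ {S α β p q w} → Sorts R 0 α p → Sorts R 0 β q → Mix S p q w →
              All (λ x → Wins R x q) p → Sorts R 0 (map (pos S) α ++ map (pos (map not S)) β) w
  Sorts-Mix {S} (B , B↭ , sorted , refl) (B′ , B′↭ , sorted′ , refl) m wins =
    place S B ++ place S̄ B′ ,
    ↭-trans (↭.++⁺ (↭.map⁺ _ B↭) (↭.map⁺ _ B′↭)) (↭-sym (number-Mix m)) ,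
    AllPairs.++⁺ (place-sorted S sorted) (place-sorted S̄ sorted′)
      (All.map (λ wins → All.map (λ (xy , ¬yx) → (λ _ → xy) , λ _ → ¬yx) (letters S̄ B′↭ wins))
               (letters S B↭ wins)) ,
    trans (List.map-++ proj₁ (place S B) _)
          (cong₂ _++_ (trans (sym (List.map-∘ B)) (List.map-∘ B)) (trans (sym (List.map-∘ B′)) (List.map-∘ B′)))
    where S̄ = map not S

-- Selectors of shuffles

-- Selectors are encoded as shuffles of two constant words, so that `∑-shuffles` counts them too.
choices : ℕ → ℕ → List (List Bool)
choices n m = shuffles (replicate n true) (replicate m false)

merge : List Bool → List A → List A → List A
merge (true ∷ S)  (x ∷ p) q       = x ∷ merge S p q
merge (false ∷ S) p       (y ∷ q) = y ∷ merge S p q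
-- Apart from the end of both words, this default covers selectors that do not fit, and these are
-- not among the `choices`.
merge _           _       _       = []

merge-false : ∀ (v : List A) → merge (replicate (length v) false) [] v ≡ v
merge-false []      = refl
merge-false (x ∷ v) = cong (x ∷_) (merge-false v)

merge-true : ∀ (v : List A) → merge (replicate (length v) true) v [] ≡ v
merge-true []      = refl
merge-true (x ∷ v) = cong (x ∷_) (merge-true v)

shuffles-merge : ∀ (u v : List A) →
                 shuffles u v ≡ map (λ S → merge S u v) (choices (length u) (length v))
shuffles-merge []      v       = cong [_] (sym (merge-false v))
shuffles-merge (x ∷ u) []      = cong (λ w → [ x ∷ w ]) (sym (merge-true u))
shuffles-merge (x ∷ u) (y ∷ v) = trans
  (cong₂ _++_ (trans (cong (map (x ∷_)) (shuffles-merge u (y ∷ v)))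
                     (trans (sym (List.map-∘ Sˡ)) (List.map-∘ Sˡ)))
              (trans (cong (map (y ∷_)) (shuffles-merge (x ∷ u) v))
                     (trans (sym (List.map-∘ Sʳ)) (List.map-∘ Sʳ))))
  (sym (List.map-++ (λ S → merge S (x ∷ u) (y ∷ v)) (map (true ∷_) Sˡ) _))
  where
  Sˡ = choices (length u) (suc (length v))
  Sʳ = choices (suc (length u)) (length v)

Mix-false : ∀ (v : List A) → Mix (replicate (length v) false) [] v v
Mix-false []      = []
Mix-false (x ∷ v) = takeʳ x (Mix-false v)

Mix-true : ∀ (v : List A) → Mix (replicate (length v) true) v [] v
Mix-true []      = []
Mix-true (x ∷ v) = takeˡ x (Mix-true v)

Mix-merge : ∀ (u v : List A) {S} → S ∈ choices (length u) (length v) → Mix S u v (merge S u v)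
Mix-merge []      v       (here refl) rewrite merge-false v = Mix-false v
Mix-merge (x ∷ u) []      (here refl) rewrite merge-true u  = takeˡ x (Mix-true u)
Mix-merge (x ∷ u) (y ∷ v) S∈
  with ∈-++⁻ (map (true ∷_) (choices (length u) (suc (length v)))) S∈
... | inj₁ S∈ˡ with _ , S∈′ , refl ← ∈-map⁻ (true ∷_) S∈ˡ  = takeˡ x (Mix-merge u (y ∷ v) S∈′)
... | inj₂ S∈ʳ with _ , S∈′ , refl ← ∈-map⁻ (false ∷_) S∈ʳ = takeʳ y (Mix-merge (x ∷ u) v S∈′)

-- Permutations and words

length-word-Positions : ∀ {π n} → π ↭ Positions 0 n → length π ≡ n
length-word-Positions {n = n} π↭ = trans (↭.↭-length π↭) (length-Positions 0 n)

toPermutation : ∀ {n} π → π ↭ Positions 0 n → ∃ λ σ → word σ ≡ π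
toPermutation {n} π π↭ = record
  { word     = π
  ; range    = subst (λ m → All (λ i → 1 ℕ.≤ i × i ℕ.≤ m) π) (sym (length-word-Positions π↭))
                     (↭.All-resp-↭ (↭-sym π↭) (Positions-bounds 0 n))
  ; distinct = ↭ₛ.Unique-resp-↭ (setoid ℕ) (↭⇒↭ₛ (↭-sym π↭)) (Positions-unique 0 n)
  } , refl

pigeonhole : ∀ {xs ys : List A} → Unique xs → All (_∈ ys) xs → length ys ℕ.≤ length xs → xs ↭ ys
pigeonhole {ys = []}    []       []        _  = ↭-refl
pigeonhole {xs = x ∷ xs} (x∉ ∷ uniq) (x∈ ∷ xs⊆) ys≤
  with zs , ts , refl ← ∈-∃++ x∈ =
  ↭-trans (prep x (pigeonhole uniq (All.zipWith drop-x (x∉ , xs⊆)) shorter)) (↭-sym (↭.shift x zs ts))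
  where
  drop-x : ∀ {y} → x ≢ y × y ∈ zs ++ [ x ] ++ ts → y ∈ zs ++ ts
  drop-x (x≢y , y∈) with ∈-++⁻ zs y∈
  ... | inj₁ y∈zs         = ∈-++⁺ˡ y∈zs
  ... | inj₂ (here refl)  = ⊥-elim (x≢y refl)
  ... | inj₂ (there y∈ts) = ∈-++⁺ʳ zs y∈ts
  shorter : length (zs ++ ts) ℕ.≤ length xs
  shorter = ℕ.s≤s⁻¹ (subst (ℕ._≤ suc (length xs)) (↭.↭-length (↭.shift x zs ts)) ys≤)

∈-Positions : ∀ {i} o n → o ℕ.< i → i ℕ.≤ o ℕ.+ n → i ∈ Positions o n
∈-Positions o zero    o<i i≤ = ⊥-elim (ℕ.<⇒≱ o<i (subst (_ ℕ.≤_) (ℕ.+-identityʳ o) i≤))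
∈-Positions {i} o (suc n) o<i i≤ with suc o ℕ.≟ i
... | yes refl = here refl
... | no  o≢i  = there (∈-Positions (suc o) n (ℕ.≤∧≢⇒< o<i o≢i) (subst (i ℕ.≤_) (ℕ.+-suc o n) i≤))

word-Positions : ∀ σ → word σ ↭ Positions 0 (length (word σ))
word-Positions σ = pigeonhole (distinct σ)
  (All.map (λ (1≤i , i≤n) → ∈-Positions 0 _ 1≤i i≤n) (range σ))
  (ℕ.≤-reflexive (length-Positions 0 (length (word σ))))

number-sorted : ∀ o (w : List A) → AllPairs (λ b c → proj₁ b ℕ.< proj₁ c) (number o w)
number-sorted o []      = []
number-sorted o (x ∷ w) = All.map proj₁ (number-bounds (suc o) w) ∷ number-sorted (suc o) w

number-letters-≡ : ∀ o (B : List (ℕ × A)) → map proj₁ B ≡ Positions o (length B) → number o (map proj₂ B) ≡ B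
number-letters-≡ o []            eq = refl
number-letters-≡ o ((_ , x) ∷ B) eq with refl , eq′ ← List.∷-injective eq =
  cong (_ ∷_) (number-letters-≡ (suc o) B eq′)

number-proj₂ : ∀ o (w : List A) → map proj₂ (number o w) ≡ w
number-proj₂ o []      = refl
number-proj₂ o (x ∷ w) = cong (x ∷_) (number-proj₂ (suc o) w)

-- Used twice: with swapped pairs it inverts a permutation, and with positions flagged by a truth
-- value it produces a selector.
fromPositions : ∀ {n} (D : List (ℕ × A)) → map proj₁ D ↭ Positions 0 n → ∃ λ w → number 0 w ↭ D
fromPositions {n = n} D positions with D′ , eq , D↭ ← ↭.↭-map-inv proj₁ positions =
  map proj₂ D′ , ↭-trans (↭-reflexive (number-letters-≡ 0 D′ (trans (sym eq) (cong (Positions 0) length-D′))))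
                         (↭-sym D↭)
  where
  length-D′ : n ≡ length D′
  length-D′ = trans (sym (length-Positions 0 n)) (trans (cong length eq) (List.length-map proj₁ D′))

-- One such word is the inverse of σ.
unsort : ∀ σ → ∃ λ w → Sorts (λ x y → ¬ y ℕ.< x) 0 (word σ) w
unsort σ with w , w↭ ← fromPositions (map swap (number 0 (word σ)))
                (↭-trans (↭-reflexive (trans (sym (List.map-∘ (number 0 (word σ)))) (number-proj₂ 0 (word σ))))
                         (word-Positions σ)) =
  w , map swap (number 0 (word σ)) , ↭-sym w↭ ,
  AllPairs.map⁺ (AllPairs.map (λ x<y → (λ _ → ℕ.<-asym x<y) , (λ _ ¬x<y → ¬x<y x<y))
                              (number-sorted 0 (word σ))) ,
  trans (sym (List.map-∘ (number 0 (word σ)))) (number-proj₂ 0 (word σ))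

-- Increasing and decreasing trees

module Splitting {R : Rel A 0ℓ} (R? : ∀ x y → Dec (R x y))
                 (R-trans : ∀ {x y z} → R x y → R y z → R x z)
                 (R-cotrans : ∀ {x y z} → ¬ R x y → ¬ R y z → ¬ R x z) where

  Splits : A → List A → List A × A × List A → Set
  Splits x u (v , b , w) = x ∷ u ≡ v ++ b ∷ w × All (λ y → ¬ R y b) v × All (R b) w

  -- The letters before `b` are not preferred to `b`, so by cotransitivity `x`, being preferred to
  -- `b`, is preferred to them as well.
  Splits-head : ∀ {x y u s} → R x (proj₁ (proj₂ s)) → Splits y u s → Splits x (y ∷ u) ([] , x , y ∷ u)
  Splits-head {x} {s = v , b , w} xb (eq , p , q) =
    refl , [] , subst (All (R x)) (sym eq) (All.++⁺ (All.map before p) (xb ∷ All.map (R-trans xb) q))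
    where
    before : ∀ {z} → ¬ R z b → R x z
    before {z} ¬zb with R? x z
    ... | yes xz = xz
    ... | no ¬xz = ⊥-elim (R-cotrans ¬xz ¬zb xb)

  Splits-tail : ∀ {x y u v b w} → ¬ R x b → Splits y u (v , b , w) → Splits x (y ∷ u) (x ∷ v , b , w)
  Splits-tail ¬xb (eq , p , q) = cong (_ ∷_) eq , ¬xb ∷ p , q

module _ (X : Alphabet) where

  open Alphabet X using (_<_; _<?_; compare; isStrictTotalOrder)
  open IncrDecr X

  private
    <-trans = IsStrictTotalOrder.trans isStrictTotalOrder
    <-asym = IsStrictTotalOrder.asym isStrictTotalOrder

  _≼_ _≻_ : Rel (Letter X) 0ℓ
  x ≼ y = ¬ y < x
  x ≻ y = y < x

  _≼?_ : ∀ x y → Dec (x ≼ y)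
  x ≼? y = ¬? (y <? x)

  _≻?_ : ∀ x y → Dec (x ≻ y)
  x ≻? y = y <? x

  ≼-trans : ∀ {x y z} → x ≼ y → y ≼ z → x ≼ z
  ≼-trans {x} {y} {z} y≮x z≮y z<x with compare y z
  ... | tri< y<z _ _  = y≮x (<-trans y<z z<x)
  ... | tri≈ _ refl _ = y≮x z<x
  ... | tri> _ _ z<y  = z≮y z<y

  ≻-trans : ∀ {x y z} → x ≻ y → y ≻ z → x ≻ z
  ≻-trans y<x z<y = <-trans z<y y<x

  ≼-cotrans : ∀ {x y z} → ¬ x ≼ y → ¬ y ≼ z → ¬ x ≼ z
  ≼-cotrans p q z≮x = p λ y<x → q λ z<y → z≮x (<-trans z<y y<x)

  open Sorting {R = _≼_} _≼?_ ≼-trans ≼-cotrans public using () renaming (sort to ≼-sort)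

  private
    module Min = Splitting {R = _≼_} _≼?_ ≼-trans ≼-cotrans
    -- Unfolded, `¬ x ≻ y` is `x ≼ y`, so `≼-trans` is the cotransitivity required of `_≻_`.
    module Max = Splitting {R = _≻_} _≻?_ ≻-trans ≼-trans

  splitMin-Splits : ∀ x u → Min.Splits x u (splitMin x u)
  splitMin-Splits x []      = refl , [] , []
  splitMin-Splits x (y ∷ u) with splitMin y u | splitMin-Splits y u
  ... | v , b , w | sp with b <? x
  ...   | yes b<x = Min.Splits-tail (λ b≮x → b≮x b<x) sp
  ...   | no  b≮x = Min.Splits-head b≮x sp

  splitMax-Splits : ∀ x u → Max.Splits x u (splitMax x u)
  splitMax-Splits x []      = refl , [] , []
  splitMax-Splits x (y ∷ u) with splitMax y u | splitMax-Splits y u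
  ... | v , b , w | sp with b <? x
  ...   | yes b<x = Max.Splits-head b<x sp
  ...   | no  b≮x = Max.Splits-tail b≮x sp

  Build-buildTree : ∀ {R : Rel (Letter X) 0ℓ} {split : Letter X → Word → Word × Letter X × Word} →
    (∀ x u → let v , b , w = split x u in x ∷ u ≡ v ++ b ∷ w × All (λ y → ¬ R y b) v × All (R b) w) →
    ∀ n u → length u ℕ.≤ n → Build R u (shape (buildTree split n u))
  Build-buildTree sp zero    []      _ = leaf
  Build-buildTree sp (suc n) []      _ = leaf
  Build-buildTree {split = split} sp (suc n) (x ∷ u) (s≤s u≤n) with split x u | sp x u
  ... | v , b , w | eq , p , q = node v b w eq p q
    (Build-buildTree sp n v (ℕ.≤-trans (ℕ.m≤m+n _ _) vw≤n))
    (Build-buildTree sp n w (ℕ.≤-trans (ℕ.m≤n+m _ (length v)) vw≤n))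
    where
    vw≤n : length v ℕ.+ length w ℕ.≤ n
    vw≤n = subst (ℕ._≤ n) (ℕ.suc-injective (trans (cong length eq)
             (trans (List.length-++ v) (ℕ.+-suc (length v) _)))) u≤n

  Trees : Word → ShapePair → Set
  Trees u (s , t) = Build _≼_ u s × Build _≻_ u t

  Trees-treeShapes : ∀ u → Trees u (treeShapes u)
  Trees-treeShapes u = Build-buildTree splitMin-Splits (length u) u ℕ.≤-refl
                     , Build-buildTree splitMax-Splits (length u) u ℕ.≤-refl

  Trees⇒treeShapes : ∀ {u s} → Trees u s → treeShapes u ≡ s
  Trees⇒treeShapes {u} (b , b′) = cong₂ _,_ (Build-unique (proj₁ (Trees-treeShapes u)) b)
                                            (Build-unique (proj₂ (Trees-treeShapes u)) b′)

  -- The bridge between words and permutations: inserting from right to left is inserting the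
  -- reversed word, which sorts `u` for `_≻_`.
  treeShapes-Pˢ : ∀ {u} σ → Sorts _≼_ 0 (word σ) u → treeShapes u ≡ Pˢ σ
  treeShapes-Pˢ {u} σ s = Trees⇒treeShapes
    ( Sorts-Build s
    , subst (λ t → Build _≻_ u (shape t)) (List.reverse-foldl (λ t x → insert x t) (leaf tt) (word σ))
        (Sorts-Build (Sorts-reverse (λ {x} {y} → decidable-stable (y <? x)) (λ y≮x y<x → y≮x y<x) s)) )

  treeShapes-cut : ∀ p q → let s , t = treeShapes (p ++ q) ; k = length p in
    treeShapes p ≡ (proj₁ (cut k s) , proj₁ (cut k t)) × treeShapes q ≡ (proj₂ (cut k s) , proj₂ (cut k t))
  treeShapes-cut p q
    with b , b′ ← Trees-treeShapes (p ++ q)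
    with bp , bq ← Build-cut p b | bp′ , bq′ ← Build-cut p b′ =
    Trees⇒treeShapes (bp , bp′) , Trees⇒treeShapes (bq , bq′)

  treeShapes-++ : ∀ p {q p′ q′} → length p ≡ length p′ → treeShapes (p ++ q) ≡ treeShapes (p′ ++ q′) →
                  treeShapes p ≡ treeShapes p′ × treeShapes q ≡ treeShapes q′
  treeShapes-++ p {q} {p′} {q′} p≡ eq with cp , cq ← treeShapes-cut p q | cp′ , cq′ ← treeShapes-cut p′ q′ =
    trans cp (trans (cong₂ (λ k (s , t) → proj₁ (cut k s) , proj₁ (cut k t)) p≡ eq) (sym cp′)) ,
    trans cq (trans (cong₂ (λ k (s , t) → proj₂ (cut k s) , proj₂ (cut k t)) p≡ eq) (sym cq′))

  length-treeShapes : ∀ {u v} → treeShapes u ≡ treeShapes v → length u ≡ length v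
  length-treeShapes {u} {v} eq =
    trans (sym (#nodes-incr u)) (trans (cong (#nodes ∘ proj₁) eq) (#nodes-incr v))

  treeShapes-twin : ∀ u → ∃ λ J → shapes J ≡ treeShapes u
  treeShapes-twin u with b , b′ ← Trees-treeShapes u = record
    { left     = proj₁ (treeShapes u)
    ; right    = proj₂ (treeShapes u)
    ; sameSize = trans (#nodes-Build b) (sym (#nodes-Build b′))
    ; twin     = subst₂ (Pointwise _≢_) (sym (canopy-inner (proj₁ (treeShapes u))))
                                            (sym (canopy-inner (proj₂ (treeShapes u))))
                   (inner-opposite _≼?_ (λ {x} {y} → decidable-stable (y <? x)) (λ y≮x y<x → y≮x y<x) b b′)
    } , refl

twin-word : ∀ J → ∃ λ w → IncrDecr.treeShapes 𝔸 w ≡ shapes J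
twin-word J
  with w , b , b′ ← realize (#nodes (left J)) (left J) (right J) refl (sym (sameSize J))
         (subst₂ (Pointwise _≢_) (canopy-inner (left J)) (canopy-inner (right J)) (twin J)) =
  w , Trees⇒treeShapes 𝔸 (b , b′)

sorted-permutation : ∀ X w → ∃ λ σ → Sorts (_≼_ X) 0 (word σ) w
sorted-permutation X w with π , s ← ≼-sort X 0 w with σ , refl ← toPermutation π (Sorts-positions s) = σ , s

Pˢ-twin : ∀ σ → ∃ λ J → shapes J ≡ Pˢ σ
Pˢ-twin σ with w , s ← unsort σ with J , eq ← treeShapes-twin 𝔸 w = J , trans eq (treeShapes-Pˢ 𝔸 σ s)

twin-permutation : ∀ J → ∃ λ σ → Pˢ σ ≡ shapes J
twin-permutation J with w , eq ← twin-word J with σ , s ← sorted-permutation 𝔸 w =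
  σ , trans (sym (treeShapes-Pˢ 𝔸 σ s)) eq

length-sorted : ∀ {R : Rel A 0ℓ} {o π w} → Sorts R o π w → length π ≡ length w
length-sorted {o = o} {w = w} s = trans (↭.↭-length (Sorts-positions s)) (length-Positions o (length w))

#nodes-Pˢ : ∀ σ → #nodes (proj₁ (Pˢ σ)) ≡ length (word σ)
#nodes-Pˢ σ with w , s ← unsort σ = trans (cong (#nodes ∘ proj₁) (sym (treeShapes-Pˢ 𝔸 σ s)))
  (trans (IncrDecr.#nodes-incr 𝔸 w) (sym (length-sorted s)))

Mix-⊕ : ∀ (p : List A) (q : List B) {S} → S ∈ choices (length p) (length q) →
        Mix S (map inj₁ p) (map inj₂ q) (merge S (map inj₁ p) (map inj₂ q))
Mix-⊕ p q {S} S∈ = Mix-merge (map inj₁ p) (map inj₂ q)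
  (subst₂ (λ n m → S ∈ choices n m) (sym (List.length-map inj₁ p)) (sym (List.length-map inj₂ q)) S∈)

≼-wins : ∀ X Y p q → All (λ x → Wins (_≼_ (X ⊕ Y)) x (map inj₂ q)) (map inj₁ p)
≼-wins X Y p q = All.map⁺ (All.universal (λ _ → All.map⁺ (All.universal (λ _ → (λ ()) , λ ¬lt → ¬lt ₁∼₂) q)) p)

≻-wins : ∀ X Y p q → All (λ y → Wins (_≻_ (X ⊕ Y)) y (map inj₁ p)) (map inj₂ q)
≻-wins X Y p q = All.map⁺ (All.universal (λ _ → All.map⁺ (All.universal (λ _ → ₁∼₂ , λ ()) p)) q)

-- All letters of X precede those of Y: a letter of X wins against those of Y
-- for ≼ and loses for ≻.
treeShapes-merge : ∀ X Y p p′ q q′ {S} → S ∈ choices (length p) (length q) →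
  IncrDecr.treeShapes X p ≡ IncrDecr.treeShapes X p′ → IncrDecr.treeShapes Y q ≡ IncrDecr.treeShapes Y q′ →
  IncrDecr.treeShapes (X ⊕ Y) (merge S (map inj₁ p) (map inj₂ q)) ≡
  IncrDecr.treeShapes (X ⊕ Y) (merge S (map inj₁ p′) (map inj₂ q′))
treeShapes-merge X Y p p′ q q′ {S} S∈ eqp eqq =
  trans (Trees⇒treeShapes (X ⊕ Y) (proj₁ (proj₂ low) , proj₁ (proj₂ high)))
        (sym (Trees⇒treeShapes (X ⊕ Y) (proj₂ (proj₂ low) , proj₂ (proj₂ high))))
  where
  S∈′ : S ∈ choices (length p′) (length q′)
  S∈′ = subst₂ (λ n m → S ∈ choices n m) (length-treeShapes X eqp) (length-treeShapes Y eqq) S∈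
  m = Mix-⊕ p q S∈
  m′ = Mix-⊕ p′ q′ S∈′
  Tp = Trees-treeShapes X p
  Tp′ = subst (Trees X p′) (sym eqp) (Trees-treeShapes X p′)
  Tq = Trees-treeShapes Y q
  Tq′ = subst (Trees Y q′) (sym eqq) (Trees-treeShapes Y q′)
  low = Build-Mix (≼-wins X Y p q) (≼-wins X Y p′ q′)
    (Build-map inj₁ (_∘ drop-inj₁) (_∘ ₁∼₁) (proj₁ Tp)) (Build-map inj₁ (_∘ drop-inj₁) (_∘ ₁∼₁) (proj₁ Tp′))
    (Build-map inj₂ (_∘ drop-inj₂) (_∘ ₂∼₂) (proj₁ Tq)) (Build-map inj₂ (_∘ drop-inj₂) (_∘ ₂∼₂) (proj₁ Tq′))
    m m′
  high = Build-Mix (≻-wins X Y p q) (≻-wins X Y p′ q′)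
    (Build-map inj₂ ₂∼₂ drop-inj₂ (proj₂ Tq)) (Build-map inj₂ ₂∼₂ drop-inj₂ (proj₂ Tq′))
    (Build-map inj₁ ₁∼₁ drop-inj₁ (proj₂ Tp)) (Build-map inj₁ ₁∼₁ drop-inj₁ (proj₂ Tp′))
    (Mix-swap m) (Mix-swap m′)

-- Standardization and selectors

rankIn : List ℕ → ℕ → ℕ
rankIn u a = suc (length (filter (ℕ._<? a) u))

lookup-injective : ∀ {u : List ℕ} → Unique u → ∀ {i j} → lookup u i ≡ lookup u j → i ≡ j
lookup-injective (_ ∷ _)    {Fin.zero}  {Fin.zero}  _  = refl
lookup-injective (x∉ ∷ _)   {Fin.zero}  {Fin.suc j} eq = ⊥-elim (All.lookup x∉ (∈-lookup j) eq)
lookup-injective (x∉ ∷ _)   {Fin.suc i} {Fin.zero}  eq = ⊥-elim (All.lookup x∉ (∈-lookup i) (sym eq))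
lookup-injective (_ ∷ uniq) {Fin.suc i} {Fin.suc j} eq = cong Fin.suc (lookup-injective uniq eq)

std-Unique : ∀ {u} → Unique u → word (std u) ≡ map (rankIn u) u
std-Unique {u} uniq = trans (List.tabulate-cong rank-≡) (trans (sym (List.map-tabulate (lookup u) (rankIn u)))
                                                               (cong (map (rankIn u)) (List.tabulate-lookup u)))
  where
  open Standardization u
  rank-≡ : ∀ i → rank i ≡ rankIn u (lookup u i)
  rank-≡ i = cong suc (begin
    length (filter (_≺? i) (allFin (length u)))
      ≡⟨ cong length (List.filter-≐ (_≺? i) (λ j → lookup u j ℕ.<? lookup u i) (smaller , inj₁) (allFin _)) ⟩
    length (filter (λ j → lookup u j ℕ.<? lookup u i) (allFin (length u)))
      ≡⟨ List.length-map (lookup u) (filter (λ j → lookup u j ℕ.<? lookup u i) (allFin (length u))) ⟨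
    length (map (lookup u) (filter (λ j → lookup u j ℕ.<? lookup u i) (allFin (length u))))
      ≡⟨ cong length (filter-map (ℕ._<? lookup u i) (lookup u) (allFin _)) ⟨
    length (filter (ℕ._<? lookup u i) (map (lookup u) (allFin (length u))))
      ≡⟨ cong (length ∘ filter (ℕ._<? lookup u i)) (trans (List.map-tabulate id (lookup u)) (List.tabulate-lookup u)) ⟩
    length (filter (ℕ._<? lookup u i) u) ∎)
    where
    open ≡-Reasoning
    smaller : ∀ {j} → j ≺ i → lookup u j ℕ.< lookup u i
    smaller (inj₁ lt)         = lt
    smaller (inj₂ (eq , j<i)) = ⊥-elim (ℕ.<⇒≢ j<i (cong Fin.toℕ (lookup-injective uniq eq)))

count-Positions : ∀ o n a → o ℕ.< a → a ℕ.≤ suc (o ℕ.+ n) →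
                  length (filter (ℕ._<? a) (Positions o n)) ℕ.+ suc o ≡ a
count-Positions o zero a o<a a≤ = ℕ.≤-antisym o<a (subst (λ k → a ℕ.≤ suc k) (ℕ.+-identityʳ o) a≤)
count-Positions o (suc n) a o<a a≤ with suc o ℕ.<? a
... | yes so<a = trans (cong (λ xs → length xs ℕ.+ suc o) (List.filter-accept (ℕ._<? a) so<a))
  (trans (sym (ℕ.+-suc _ (suc o)))
         (count-Positions (suc o) n a so<a (subst (λ k → a ℕ.≤ suc k) (ℕ.+-suc o n) a≤)))
... | no  so≮a = trans (cong (λ xs → length xs ℕ.+ suc o) (List.filter-none (ℕ._<? a)
    (so≮a ∷ All.map (λ (so< , _) lt → so≮a (ℕ.<-trans so< lt)) (Positions-bounds (suc o) n))))
  (ℕ.≤-antisym o<a (ℕ.≮⇒≥ so≮a))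

std-map : ∀ {f : ℕ → ℕ} → (∀ {i j} → i ℕ.< j → f i ℕ.< f j) → (∀ {i j} → f i ℕ.< f j → i ℕ.< j) →
          ∀ α → word (std (map f (word α))) ≡ word α
std-map {f} mono cancel α = begin
  word (std (map f (word α)))                    ≡⟨ std-Unique (Unique.map⁺ f-injective (distinct α)) ⟩
  map (rankIn (map f (word α))) (map f (word α)) ≡⟨ List.map-∘ (word α) ⟨
  map (rankIn (map f (word α)) ∘ f) (word α)     ≡⟨ List.map-id-local (All.map rank-f (range α)) ⟩
  word α                                         ∎
  where
  open ≡-Reasoning
  f-injective : ∀ {i j} → f i ≡ f j → i ≡ j
  f-injective {i} {j} eq with ℕ.<-cmp i j
  ... | tri< lt _ _  = ⊥-elim (ℕ.<⇒≢ (mono lt) eq)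
  ... | tri≈ _ i≡j _ = i≡j
  ... | tri> _ _ gt  = ⊥-elim (ℕ.<⇒≢ (mono gt) (sym eq))
  rank-f : ∀ {a} → 1 ℕ.≤ a × a ℕ.≤ length (word α) → rankIn (map f (word α)) (f a) ≡ a
  rank-f {a} (1≤a , a≤n) = begin
    suc (length (filter (ℕ._<? f a) (map f (word α))))
      ≡⟨ cong (suc ∘ length) (filter-map (ℕ._<? f a) f (word α)) ⟩
    suc (length (map f (filter (λ b → f b ℕ.<? f a) (word α))))
      ≡⟨ cong suc (List.length-map f (filter (λ b → f b ℕ.<? f a) (word α))) ⟩
    suc (length (filter (λ b → f b ℕ.<? f a) (word α)))
      ≡⟨ cong (suc ∘ length) (List.filter-≐ (λ b → f b ℕ.<? f a) (ℕ._<? a) (cancel , mono) (word α)) ⟩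
    suc (length (filter (ℕ._<? a) (word α)))
      ≡⟨ cong suc (↭.↭-length (↭.filter-↭ (ℕ._<? a) (word-Positions α))) ⟩
    suc (length (filter (ℕ._<? a) (Positions 0 (length (word α)))))
      ≡⟨ ℕ.+-comm 1 _ ⟩
    length (filter (ℕ._<? a) (Positions 0 (length (word α)))) ℕ.+ 1
      ≡⟨ count-Positions 0 (length (word α)) a 1≤a (ℕ.m≤n⇒m≤1+n a≤n) ⟩
    a ∎

std-pos : ∀ S α → word (std (map (pos S) (word α))) ≡ word α
std-pos S = std-map (pos-mono S) (pos-cancel S)

number-replicate : ∀ {x : A} o n → number o (replicate n x) ≡ map (_, x) (Positions o n)
number-replicate o zero    = refl
number-replicate o (suc n) = cong (_ ∷_) (number-replicate (suc o) n)

-- Up to permutation this retains only which letters lie in `u` and which in `v`, and that is the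
-- numbering of a selector.
flagged : List ℕ → List ℕ → List (ℕ × Bool)
flagged u v = map (_, true) u ++ map (_, false) v

Mix-flagged : ∀ {S n m} → Mix S (replicate n true) (replicate m false) S →
              number 0 S ↭ flagged (map (pos S) (Positions 0 n)) (map (pos (map not S)) (Positions 0 m))
Mix-flagged {S} {n} {m} mix = ↭-trans (number-Mix mix) (↭-reflexive (cong₂ _++_ (places S n) (places (map not S) m)))
  where
  places : ∀ S n {x : Bool} → place S (number 0 (replicate n x)) ≡ map (_, x) (map (pos S) (Positions 0 n))
  places S n = trans (cong (place S) (number-replicate 0 n))
    (trans (sym (List.map-∘ (Positions 0 n))) (List.map-∘ (Positions 0 n)))

choices-Mix : ∀ n m {S} → S ∈ choices n m → Mix S (replicate n true) (replicate m false) S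
choices-Mix zero    m       (here refl) = go m
  where
  go : ∀ m → Mix (replicate m false) [] (replicate m false) (replicate m false)
  go zero    = []
  go (suc m) = takeʳ false (go m)
choices-Mix (suc n) zero    (here refl) = go (suc n)
  where
  go : ∀ n → Mix (replicate n true) (replicate n true) [] (replicate n true)
  go zero    = []
  go (suc n) = takeˡ true (go n)
choices-Mix (suc n) (suc m) S∈ with ∈-++⁻ (map (true ∷_) (choices n (suc m))) S∈
... | inj₁ S∈ˡ with _ , S∈′ , refl ← ∈-map⁻ (true ∷_) S∈ˡ  = takeˡ true (choices-Mix n (suc m) S∈′)
... | inj₂ S∈ʳ with _ , S∈′ , refl ← ∈-map⁻ (false ∷_) S∈ʳ = takeʳ false (choices-Mix (suc n) m S∈′)

Mix-choices : ∀ {S} {p q w : List A} → Mix S p q w → S ∈ choices (length p) (length q)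
Mix-choices []                        = here refl
Mix-choices (takeˡ {p = p} {[]} _ m)  = here (cong (true ∷_) (only p (Mix-choices m)))
  where
  only : ∀ {S} (p : List A) → S ∈ choices (length p) 0 → S ≡ replicate (length p) true
  only []      (here refl) = refl
  only (_ ∷ _) (here refl) = refl
Mix-choices (takeˡ {q = _ ∷ _} _ m)   = ∈-++⁺ˡ (∈-map⁺ (true ∷_) (Mix-choices m))
Mix-choices (takeʳ {p = []} _ m) with here refl ← Mix-choices m = here refl
Mix-choices (takeʳ {p = _ ∷ p} {q} _ m) =
  ∈-++⁺ʳ (map (true ∷_) (choices (length p) (suc (length q)))) (∈-map⁺ (false ∷_) (Mix-choices m))

number-injective : ∀ o (w w′ : List A) → number o w ↭ number o w′ → w ≡ w′
number-injective o []      []       _ = refl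
number-injective o []      (_ ∷ _)  eq with () ← ↭.↭-empty-inv (↭-sym eq)
number-injective o (_ ∷ _) []       eq with () ← ↭.↭-empty-inv eq
number-injective o (x ∷ w) (y ∷ w′) eq with ↭.∈-resp-↭ eq (here refl)
... | here refl = cong (x ∷_) (number-injective (suc o) w w′ (↭.drop-∷ eq))
... | there x∈  = ⊥-elim (ℕ.<-irrefl refl (proj₁ (All.lookup (number-bounds (suc o) w′) x∈)))

-- S tells, for each i, whether the letter i of the permutation u v is in u.
Selects : List Bool → List ℕ → List ℕ → List ℕ → List ℕ → Set
Selects S α β u v = u ≡ map (pos S) α × v ≡ map (pos (map not S)) β

-- Both selectors have `flagged u v` as their numbering, and a word is determined by its numbering.
Selects-unique : ∀ {S S′ u v} α β → S ∈ choices (length (word α)) (length (word β)) →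
                 S′ ∈ choices (length (word α)) (length (word β)) →
                 Selects S (word α) (word β) u v → Selects S′ (word α) (word β) u v → S ≡ S′
Selects-unique {S} {S′} {u} {v} α β S∈ S′∈ sel sel′ =
  number-injective 0 S S′ (↭-trans (flags S∈ sel) (↭-sym (flags S′∈ sel′)))
  where
  flags : ∀ {S} → S ∈ choices (length (word α)) (length (word β)) → Selects S (word α) (word β) u v →
          number 0 S ↭ flagged u v
  flags {S} S∈ (refl , refl) = ↭-trans (Mix-flagged {n = length (word α)} {length (word β)}
    (choices-Mix (length (word α)) (length (word β)) S∈)) (↭-sym
    (↭.++⁺ (↭.map⁺ _ (↭.map⁺ (pos S) (word-Positions α)))
           (↭.map⁺ _ (↭.map⁺ (pos (map not S)) (word-Positions β)))))

Mix-self : ∀ S → ∃₂ λ n m → Mix S (replicate n true) (replicate m false) S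
Mix-self []          = 0 , 0 , []
Mix-self (true ∷ S)  with n , m , mix ← Mix-self S = suc n , m , takeˡ true mix
Mix-self (false ∷ S) with n , m , mix ← Mix-self S = n , suc m , takeʳ false mix

unflag : ∀ (x : Bool) (u : List ℕ) → map proj₁ (map (_, x) u) ≡ u
unflag x u = trans (sym (List.map-∘ u)) (List.map-id u)

unflag-↭ : ∀ {x : Bool} {u u′ : List ℕ} → map (_, x) u ↭ map (_, x) u′ → u ↭ u′
unflag-↭ {x} {u} {u′} eq = subst₂ _↭_ (unflag x u) (unflag x u′) (↭.map⁺ proj₁ eq)

flagged-injective : ∀ {u v u′ v′} → flagged u v ↭ flagged u′ v′ → u ↭ u′ × v ↭ v′
flagged-injective {u} {v} {u′} {v′} eq =
  unflag-↭ {true} (subst₂ _↭_ (keep-true u v) (keep-true u′ v′) (↭.filter-↭ true? eq)) ,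
  unflag-↭ {false} (subst₂ _↭_ (keep-false u v) (keep-false u′ v′) (↭.filter-↭ (¬? ∘ true?) eq))
  where
  true? : ∀ (b : ℕ × Bool) → Dec (proj₂ b ≡ true)
  true? b = proj₂ b Bool.≟ true
  all-true : ∀ (u : List ℕ) → All (λ b → proj₂ b ≡ true) (map (_, true) u)
  all-true u = All.map⁺ (All.universal (λ _ → refl) u)
  none-true : ∀ (v : List ℕ) → All (λ b → proj₂ b ≢ true) (map (_, false) v)
  none-true v = All.map⁺ (All.universal (λ _ ()) v)
  keep-true : ∀ u v → filter true? (flagged u v) ≡ map (_, true) u
  keep-true u v = filter-++-≡ˡ true? (all-true u) (none-true v)
  keep-false : ∀ u v → filter (¬? ∘ true?) (flagged u v) ≡ map (_, false) v
  keep-false u v = filter-++-≡ʳ true? (all-true u) (none-true v)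

std-placed : ∀ {S u n} → u ↭ map (pos S) (Positions 0 n) → u ≡ map (pos S) (word (std u)) × length u ≡ n
std-placed {S} {n = n} eq with α′ , refl , ↭α ← ↭.↭-map-inv (pos S) (↭-sym eq)
  with α , refl ← toPermutation α′ (↭-sym ↭α) =
  cong (map (pos S)) (sym (std-pos S α)) ,
  trans (List.length-map (pos S) α′) (length-word-Positions (↭-sym ↭α))

-- The letters of σ, flagged by the factor they lie in and read in increasing order, spell `S`. As
-- `pos S` is increasing, standardization undoes it.
selector : ∀ σ {u v} → u ++ v ≡ word σ →
           ∃ λ S → S ∈ choices (length u) (length v) × Selects S (word (std u)) (word (std v)) u v
selector σ {u} {v} eq
  with S , S↭ ← fromPositions (flagged u v)
         (↭-trans (↭-reflexive (trans (List.map-++ proj₁ (map (_, true) u) _)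
                                      (trans (cong₂ _++_ (unflag true u) (unflag false v)) eq)))
                  (word-Positions σ))
  with n , m , mix ← Mix-self S
  with ↭u , ↭v ← flagged-injective (↭-trans (↭-sym S↭) (Mix-flagged mix))
  with u≡ , |u| ← std-placed {S} ↭u | v≡ , |v| ← std-placed {map not S} ↭v =
  S , subst₂ (λ n m → S ∈ choices n m) (trans (List.length-replicate n) (sym |u|))
             (trans (List.length-replicate m) (sym |v|)) (Mix-choices mix) , u≡ , v≡

-- Sums of indicators

splits-≡ : ∀ (w : List A) → All (λ (u , v) → u ++ v ≡ w) (splits w)
splits-≡ []      = refl ∷ []
splits-≡ (x ∷ w) = refl ∷ All.map⁺ (All.map (cong (x ∷_)) (splits-≡ w))

length-prefix : ∀ (u : List A) {v w} → u ++ v ≡ w → length u ℕ.≤ length w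
length-prefix u refl = subst (length u ℕ.≤_) (sym (List.length-++ u)) (ℕ.m≤m+n _ _)

module _ {P : A → Set} (P? : ∀ x → Dec (P x)) where

  Mix-filter : ∀ {S p q w} → Mix S p q w → All P p → All (¬_ ∘ P) q →
               filter P? w ≡ p × filter (¬? ∘ P?) w ≡ q
  Mix-filter []          _        _         = refl , refl
  Mix-filter (takeˡ x m) (p ∷ ps) ¬ps       with eq , eq′ ← Mix-filter m ps ¬ps =
    trans (List.filter-accept P? p) (cong (x ∷_) eq) , trans (List.filter-reject (¬? ∘ P?) (λ ¬p → ¬p p)) eq′
  Mix-filter (takeʳ x m) ps       (¬p ∷ ¬ps) with eq , eq′ ← Mix-filter m ps ¬ps =
    trans (List.filter-reject P? ¬p) eq , trans (List.filter-accept (¬? ∘ P?) ¬p) (cong (x ∷_) eq′)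

  filter-≡[] : ∀ w → filter P? w ≡ [] → filter (¬? ∘ P?) w ≡ w
  filter-≡[] []      _  = refl
  filter-≡[] (x ∷ w) eq with P? x
  ... | no _ = cong (x ∷_) (filter-≡[] w eq)

  filter-¬≡[] : ∀ w → filter (¬? ∘ P?) w ≡ [] → filter P? w ≡ w
  filter-¬≡[] []      _  = refl
  filter-¬≡[] (x ∷ w) eq with P? x
  ... | yes _ = cong (x ∷_) (filter-¬≡[] w eq)

  length-filters : ∀ w → length (filter P? w) ℕ.+ length (filter (¬? ∘ P?) w) ≡ length w
  length-filters []      = refl
  length-filters (x ∷ w) with P? x
  ... | yes _ = cong suc (length-filters w)
  ... | no _  = trans (ℕ.+-suc _ _) (cong suc (length-filters w))

module Realization {c ℓ₁ ℓ₂} (K : HeytingField c ℓ₁ ℓ₂) where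

  open OverField K
  open CommutativeRing (HeytingCommutativeRing.commutativeRing (HeytingField.heytingCommutativeRing K))
    using (Carrier; _≈_; _+_; _*_; -_; 0#; 1#; +-cong; +-congˡ; +-congʳ; *-cong; *-congˡ; *-congʳ; +-identityˡ;
           +-identityʳ; *-identityˡ; *-identityʳ; zeroˡ; zeroʳ; +-assoc; *-assoc; *-comm; distribˡ;
           distribʳ; -‿cong; ring; +-abelianGroup; +-group; +-commutativeMonoid)
    renaming (refl to ≈-refl; sym to ≈-sym; trans to ≈-trans; reflexive to ≈-reflexive; setoid to ≈-setoid)
  open import Algebra.Properties.Ring ring using (-‿distribˡ-*)
  open import Algebra.Properties.AbelianGroup +-abelianGroup using (⁻¹-∙-comm)
  open import Algebra.Properties.Group +-group using () renaming (ε⁻¹≈ε to -0≈0)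
  open import Algebra.Properties.CommutativeSemigroup
    (CommutativeMonoid.commutativeSemigroup +-commutativeMonoid) using () renaming (interchange to +-interchange)
  open import Relation.Binary.Reasoning.Setoid ≈-setoid

  private variable
    b : Level
    C D : Set b

  -- The Iverson bracket with values in the field.
  ⟦_⟧ : ∀ {p} {P : Set p} → Dec P → Carrier
  ⟦ d ⟧ = if does d then 1# else 0#

  module _ {p q} {P : Set p} {Q : Set q} where

    ⟦⟧-cong : (d : Dec P) (e : Dec Q) → (P → Q) → (Q → P) → ⟦ d ⟧ ≈ ⟦ e ⟧
    ⟦⟧-cong (yes _)  (yes _)  _ _ = ≈-refl
    ⟦⟧-cong (yes x)  (no ¬y)  f _ = ⊥-elim (¬y (f x))
    ⟦⟧-cong (no ¬x)  (yes y)  _ g = ⊥-elim (¬x (g y))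
    ⟦⟧-cong (no _)   (no _)   _ _ = ≈-refl

    ⟦⟧-× : (d : Dec P) (e : Dec Q) → ⟦ d ×-dec e ⟧ ≈ ⟦ d ⟧ * ⟦ e ⟧
    ⟦⟧-× (yes _) (yes _) = ≈-sym (*-identityˡ 1#)
    ⟦⟧-× (yes _) (no _)  = ≈-sym (*-identityˡ 0#)
    ⟦⟧-× (no _)  e       = ≈-sym (zeroˡ ⟦ e ⟧)

  module _ {p} {P : Set p} where

    ⟦⟧-yes : (d : Dec P) → P → ⟦ d ⟧ ≈ 1#
    ⟦⟧-yes (yes _) _ = ≈-refl
    ⟦⟧-yes (no ¬x) x = ⊥-elim (¬x x)

    ⟦⟧-no : (d : Dec P) → ¬ P → ⟦ d ⟧ ≈ 0#
    ⟦⟧-no (yes x) ¬x = ⊥-elim (¬x x)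
    ⟦⟧-no (no _)  _  = ≈-refl

    ⟦⟧-*-cong : (d : Dec P) {k l : Carrier} → (P → k ≈ l) → k * ⟦ d ⟧ ≈ l * ⟦ d ⟧
    ⟦⟧-*-cong (yes x) k≈l = *-congʳ (k≈l x)
    ⟦⟧-*-cong (no _)  _   = ≈-trans (zeroʳ _) (≈-sym (zeroʳ _))

  -- Finite sums and linear forms

  ∑ : List C → (C → Carrier) → Carrier
  ∑ xs f = sum (map f xs)

  ∑-cong-local : ∀ {f g : C → Carrier} {xs} → All (λ x → f x ≈ g x) xs → ∑ xs f ≈ ∑ xs g
  ∑-cong-local []       = ≈-refl
  ∑-cong-local (p ∷ ps) = +-cong p (∑-cong-local ps)

  ∑-cong : ∀ {f g : C → Carrier} xs → (∀ x → f x ≈ g x) → ∑ xs f ≈ ∑ xs g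
  ∑-cong xs f≈g = ∑-cong-local (All.universal f≈g xs)

  ∑-zero-local : ∀ {f : C → Carrier} {xs} → All (λ x → f x ≈ 0#) xs → ∑ xs f ≈ 0#
  ∑-zero-local []       = ≈-refl
  ∑-zero-local (p ∷ ps) = ≈-trans (+-cong p (∑-zero-local ps)) (+-identityˡ 0#)

  ∑-zero : ∀ {f : C → Carrier} xs → (∀ x → f x ≈ 0#) → ∑ xs f ≈ 0#
  ∑-zero xs f≈0 = ∑-zero-local (All.universal f≈0 xs)

  ∑-++ : ∀ (f : C → Carrier) xs {ys} → ∑ (xs ++ ys) f ≈ ∑ xs f + ∑ ys f
  ∑-++ f []       = ≈-sym (+-identityˡ _)
  ∑-++ f (x ∷ xs) = ≈-trans (+-congˡ (∑-++ f xs)) (≈-sym (+-assoc _ _ _))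

  ∑-map : ∀ (f : D → Carrier) (g : C → D) xs → ∑ (map g xs) f ≈ ∑ xs (f ∘ g)
  ∑-map f g xs = ≈-reflexive (cong sum (sym (List.map-∘ xs)))

  ∑-+ : ∀ (f g : C → Carrier) xs → ∑ xs (λ x → f x + g x) ≈ ∑ xs f + ∑ xs g
  ∑-+ f g []       = ≈-sym (+-identityˡ 0#)
  ∑-+ f g (x ∷ xs) = ≈-trans (+-congˡ (∑-+ f g xs)) (+-interchange _ _ _ _)

  ∑-*ˡ : ∀ k (f : C → Carrier) xs → ∑ xs (λ x → k * f x) ≈ k * ∑ xs f
  ∑-*ˡ k f []       = ≈-sym (zeroʳ k)
  ∑-*ˡ k f (x ∷ xs) = ≈-trans (+-congˡ (∑-*ˡ k f xs)) (≈-sym (distribˡ k _ _))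

  ∑-*ʳ : ∀ k (f : C → Carrier) xs → ∑ xs (λ x → f x * k) ≈ ∑ xs f * k
  ∑-*ʳ k f xs = ≈-trans (∑-cong xs (λ x → *-comm (f x) k)) (≈-trans (∑-*ˡ k f xs) (*-comm k _))

  ∑-swap : ∀ (f : C → D → Carrier) xs ys → ∑ xs (λ x → ∑ ys (f x)) ≈ ∑ ys (λ y → ∑ xs (λ x → f x y))
  ∑-swap f []       ys = ≈-sym (∑-zero ys (λ _ → ≈-refl))
  ∑-swap f (x ∷ xs) ys = ≈-trans (+-congˡ (∑-swap f xs ys)) (≈-sym (∑-+ (f x) _ ys))

  ∑-concatMap : ∀ (f : D → Carrier) (g : C → List D) xs → ∑ (concatMap g xs) f ≈ ∑ xs (λ x → ∑ (g x) f)
  ∑-concatMap f g []       = ≈-refl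
  ∑-concatMap f g (x ∷ xs) = ≈-trans (∑-++ f (g x)) (+-congˡ (∑-concatMap f g xs))

  ∑-cartesianProduct : ∀ (f : C → Carrier) (g : D → Carrier) xs ys →
    ∑ (cartesianProduct xs ys) (λ (x , y) → f x * g y) ≈ ∑ xs f * ∑ ys g
  ∑-cartesianProduct f g []       ys = ≈-sym (zeroˡ _)
  ∑-cartesianProduct f g (x ∷ xs) ys = ≈-trans (∑-++ _ (map (x ,_) ys)) (≈-trans
    (+-cong (≈-trans (∑-map _ (x ,_) ys) (∑-*ˡ (f x) g ys)) (∑-cartesianProduct f g xs ys))
    (≈-sym (distribʳ _ _ _)))

  ∑-filter : ∀ {p} {P : C → Set p} (P? : ∀ x → Dec (P x)) (f : C → Carrier) xs →
             ∑ (filter P? xs) f ≈ ∑ xs (λ x → f x * ⟦ P? x ⟧)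
  ∑-filter P? f []       = ≈-refl
  ∑-filter P? f (x ∷ xs) with P? x
  ... | yes _ = +-cong (≈-sym (*-identityʳ _)) (∑-filter P? f xs)
  ... | no _  = ≈-trans (∑-filter P? f xs) (≈-sym (≈-trans (+-congʳ (zeroʳ _)) (+-identityˡ _)))

  module _ {d} {D : Set d} (_≟_ : ∀ (x y : D) → Dec (x ≡ y)) (f : C → D) where

    ∑-once : ∀ {t xs} → AllPairs (λ x y → f x ≢ f y) xs → Any (λ x → f x ≡ t) xs →
             ∑ xs (λ x → ⟦ f x ≟ t ⟧) ≈ 1#
    ∑-once {xs = x ∷ xs} (x∉ ∷ _) (here refl) = ≈-trans
      (+-cong (⟦⟧-yes (f x ≟ f x) refl)
              (∑-zero-local (All.map (λ {y} fx≢fy → ⟦⟧-no (f y ≟ f x) (fx≢fy ∘ sym)) x∉)))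
      (+-identityʳ 1#)
    ∑-once {t} {x ∷ xs} (x∉ ∷ uniq) (there any) = ≈-trans
      (+-cong (⟦⟧-no (f x ≟ t) (λ fx≡t → All.All¬⇒¬Any x∉ (Any.map (λ fy≡t → trans fx≡t (sym fy≡t)) any)))
              (∑-once uniq any))
      (+-identityˡ 1#)

  -- The linear form with values `φ` on the basis, evaluated at a formal combination. A coefficient
  -- is the case where `φ` is a bracket, which reduces all identities to basis elements.
  ⟨_,_⟩ : List (Carrier × C) → (C → Carrier) → Carrier
  ⟨ x , φ ⟩ = ∑ x (λ (k , e) → k * φ e)

  ⟨⟩-cong : ∀ {φ ψ : C → Carrier} x → (∀ e → φ e ≈ ψ e) → ⟨ x , φ ⟩ ≈ ⟨ x , ψ ⟩
  ⟨⟩-cong x φ≈ψ = ∑-cong x (λ (k , e) → *-congˡ (φ≈ψ e))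

  ⟨⟩-scale : ∀ k (φ : C → Carrier) x → ⟨ map (map₁ (k *_)) x , φ ⟩ ≈ k * ⟨ x , φ ⟩
  ⟨⟩-scale k φ x = ≈-trans (∑-map _ (map₁ (k *_)) x)
    (≈-trans (∑-cong x (λ (l , e) → *-assoc k l (φ e))) (∑-*ˡ k _ x))

  ⟨⟩-neg : ∀ (φ : C → Carrier) x → ⟨ map (map₁ -_) x , φ ⟩ ≈ - ⟨ x , φ ⟩
  ⟨⟩-neg φ []            = ≈-sym -0≈0
  ⟨⟩-neg φ ((k , e) ∷ x) = ≈-trans (+-cong (≈-sym (-‿distribˡ-* k (φ e))) (⟨⟩-neg φ x)) (⁻¹-∙-comm _ _)

  ⟨⟩-basisSum : ∀ (φ : C → Carrier) xs → ⟨ basisSum xs , φ ⟩ ≈ ∑ xs φ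
  ⟨⟩-basisSum φ xs = ≈-trans (∑-map _ (1# ,_) xs) (∑-cong xs (λ _ → *-identityˡ _))

  ⟨⟩-map₂ : ∀ (φ : D → Carrier) (g : C → D) x → ⟨ map (map₂ g) x , φ ⟩ ≈ ⟨ x , φ ∘ g ⟩
  ⟨⟩-map₂ φ g x = ∑-map _ (map₂ g) x

  ⟨⟩-∑ : ∀ (φ : C → D → Carrier) x ys → ⟨ x , (λ e → ∑ ys (φ e)) ⟩ ≈ ∑ ys (λ y → ⟨ x , (λ e → φ e y) ⟩)
  ⟨⟩-∑ φ x ys = ≈-trans (∑-cong x (λ (k , e) → ≈-sym (∑-*ˡ k (φ e) ys))) (∑-swap _ x ys)

  ⟨⟩-*ʳ : ∀ (φ : C → Carrier) k x → ⟨ x , (λ e → φ e * k) ⟩ ≈ ⟨ x , φ ⟩ * k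
  ⟨⟩-*ʳ φ k x = ≈-trans (∑-cong x (λ (l , e) → ≈-sym (*-assoc l (φ e) k))) (∑-*ʳ k _ x)

  ⟨⟩-*ˡ : ∀ k (φ : C → Carrier) x → ⟨ x , (λ e → k * φ e) ⟩ ≈ k * ⟨ x , φ ⟩
  ⟨⟩-*ˡ k φ x = ≈-trans (⟨⟩-cong x (λ e → *-comm k (φ e))) (≈-trans (⟨⟩-*ʳ φ k x) (*-comm _ k))

  module _ {b ℓ} (B : DecSetoid b ℓ) where

    open DecSetoid B using (_≟_) renaming (Carrier to Basis; _≈_ to _≋_)

    coefficient-⟨⟩ : ∀ e x → coefficient B e x ≈ ⟨ x , (λ e′ → ⟦ e′ ≟ e ⟧) ⟩
    coefficient-⟨⟩ e x = ∑-cong x term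
      where
      term : ∀ ((k , e′) : Carrier × Basis) → (if does (e′ ≟ e) then k else 0#) ≈ k * ⟦ e′ ≟ e ⟧
      term (k , e′) with does (e′ ≟ e)
      ... | true  = ≈-sym (*-identityʳ k)
      ... | false = ≈-sym (zeroʳ k)

    ⟨⟩-extend : ∀ (f : C → List (Carrier × Basis)) (φ : Basis → Carrier) x →
                ⟨ extend (free B) f x , φ ⟩ ≈ ⟨ x , (λ e → ⟨ f e , φ ⟩) ⟩
    ⟨⟩-extend f φ []            = ≈-refl
    ⟨⟩-extend f φ ((k , e) ∷ x) = ≈-trans (∑-++ _ (map (map₁ (k *_)) (f e)))
      (+-cong (⟨⟩-scale k φ (f e)) (⟨⟩-extend f φ x))

    -- A combination whose coefficients only depend on f e is spread over the
    -- classes of f, one representative being chosen in each class of its support.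
    class-combination : ∀ {t} {T : Set t} (_≟ᵗ_ : ∀ (s t : T) → Dec (s ≡ t)) (f : Basis → T) →
      (∀ {e e′} → e ≋ e′ → f e ≡ f e′) → ∀ y →
      (∀ {e e′} → f e ≡ f e′ → coefficient B e y ≈ coefficient B e′ y) →
      ∃ λ z → ∀ e → ⟨ z , (λ e′ → ⟦ f e ≟ᵗ f e′ ⟧) ⟩ ≈ coefficient B e y
    class-combination _≟ᵗ_ f f-cong y const = map (λ e → coefficient B e y , e) reps , λ e → begin
      ⟨ map (λ e → coefficient B e y , e) reps , (λ e′ → ⟦ f e ≟ᵗ f e′ ⟧) ⟩
        ≈⟨ ∑-map _ (λ e → coefficient B e y , e) reps ⟩
      ∑ reps (λ e′ → coefficient B e′ y * ⟦ f e ≟ᵗ f e′ ⟧)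
        ≈⟨ ∑-cong reps (λ e′ → ⟦⟧-*-cong (f e ≟ᵗ f e′) (const ∘ sym)) ⟩
      ∑ reps (λ e′ → coefficient B e y * ⟦ f e ≟ᵗ f e′ ⟧)
        ≈⟨ ∑-*ˡ (coefficient B e y) _ reps ⟩
      coefficient B e y * ∑ reps (λ e′ → ⟦ f e ≟ᵗ f e′ ⟧)
        ≈⟨ *-congˡ (∑-cong reps (λ e′ → ⟦⟧-cong (f e ≟ᵗ f e′) (f e′ ≟ᵗ f e) sym sym)) ⟩
      coefficient B e y * ∑ reps (λ e′ → ⟦ f e′ ≟ᵗ f e ⟧)
        ≈⟨ represented e ⟩
      coefficient B e y ∎
      where
      S : DecSetoid _ _
      S = On.decSetoid (decSetoid _≟ᵗ_) f
      reps : List Basis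
      reps = deduplicate (DecSetoid._≟_ S) (map proj₂ y)
      -- Either the class of `e` occurs in `y` and has exactly one representative, or it does not
      -- occur and both sides vanish.
      represented : ∀ e → coefficient B e y * ∑ reps (λ e′ → ⟦ f e′ ≟ᵗ f e ⟧) ≈ coefficient B e y
      represented e with Any.any? (λ e′ → f e′ ≟ᵗ f e) (map proj₂ y)
      ... | yes any = ≈-trans (*-congˡ (∑-once _≟ᵗ_ f (deduplicate-! S (map proj₂ y))
                        (Any.deduplicate⁺ (DecSetoid._≟_ S) (λ eq eq′ → trans eq eq′) any))) (*-identityʳ _)
      ... | no ¬any = ≈-trans (*-congʳ absent) (≈-trans (zeroˡ _) (≈-sym absent))
        where
        absent : coefficient B e y ≈ 0#
        absent = ≈-trans (coefficient-⟨⟩ e y) (∑-zero-local (All.map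
          (λ {(k , e′)} fe′≢fe → ≈-trans (*-congˡ (⟦⟧-no (e′ ≟ e) (fe′≢fe ∘ f-cong))) (zeroʳ k))
          (All.map⁻ (All.¬Any⇒All¬ _ ¬any))))

  -- Counting shuffles and permutations

  module _ (_≟_ : ∀ (x y : A) → Dec (x ≡ y)) where

    private
      _≟ʷ_ : ∀ (u v : List A) → Dec (u ≡ v)
      _≟ʷ_ = List.≡-dec _≟_

    ∑-∷ : ∀ x z w (L : List (List A)) →
          ∑ (map (x ∷_) L) (λ s → ⟦ s ≟ʷ (z ∷ w) ⟧) ≈ ⟦ x ≟ z ⟧ * ∑ L (λ s → ⟦ s ≟ʷ w ⟧)
    ∑-∷ x z w L = ≈-trans (∑-map _ (x ∷_) L) (≈-trans (∑-cong L term) (∑-*ˡ ⟦ x ≟ z ⟧ _ L))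
      where
      term : ∀ s → ⟦ (x ∷ s) ≟ʷ (z ∷ w) ⟧ ≈ ⟦ x ≟ z ⟧ * ⟦ s ≟ʷ w ⟧
      term s = ≈-trans (⟦⟧-cong ((x ∷ s) ≟ʷ (z ∷ w)) ((x ≟ z) ×-dec (s ≟ʷ w)) List.∷-injective
                                (λ (p , q) → cong₂ _∷_ p q))
                       (⟦⟧-× (x ≟ z) (s ≟ʷ w))

    ∑-∷-[] : ∀ x (L : List (List A)) → ∑ (map (x ∷_) L) (λ s → ⟦ s ≟ʷ [] ⟧) ≈ 0#
    ∑-∷-[] x L = ≈-trans (∑-map _ (x ∷_) L) (∑-zero L (λ s → ⟦⟧-no ((x ∷ s) ≟ʷ []) (λ ())))

    module _ {P : A → Set} (P? : ∀ x → Dec (P x)) where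

      private
        P̄? : ∀ x → Dec (¬ P x)
        P̄? x = ¬? (P? x)

      Unshuffles : List A → List A → List A → Set
      Unshuffles u v w = filter P? w ≡ u × filter P̄? w ≡ v

      unshuffles? : ∀ u v w → Dec (Unshuffles u v w)
      unshuffles? u v w = (filter P? w ≟ʷ u) ×-dec (filter P̄? w ≟ʷ v)

      -- P separates the letters of u from those of v, so that w is a shuffle of
      -- them in at most one way.
      ∑-shuffles : ∀ u v w → All P u → All (¬_ ∘ P) v →
                   ∑ (shuffles u v) (λ s → ⟦ s ≟ʷ w ⟧) ≈ ⟦ unshuffles? u v w ⟧
      ∑-shuffles [] v w _ pv = ≈-trans (+-identityʳ _) (⟦⟧-cong (v ≟ʷ w) (unshuffles? [] v w)
        (λ { refl → List.filter-none P? pv , List.filter-all P̄? pv })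
        (λ (p , q) → trans (sym q) (filter-≡[] P? w p)))
      ∑-shuffles (x ∷ u) [] w pu _ = ≈-trans (+-identityʳ _) (⟦⟧-cong ((x ∷ u) ≟ʷ w) (unshuffles? (x ∷ u) [] w)
        (λ { refl → List.filter-all P? pu , List.filter-none P̄? (All.map (λ p ¬p → ¬p p) pu) })
        (λ (p , q) → trans (sym p) (filter-¬≡[] P? w q)))
      ∑-shuffles (x ∷ u) (y ∷ v) [] _ _ = ≈-trans (∑-++ _ (map (x ∷_) (shuffles u (y ∷ v))))
        (≈-trans (+-cong (∑-∷-[] x (shuffles u (y ∷ v))) (∑-∷-[] y (shuffles (x ∷ u) v))) (≈-trans (+-identityˡ 0#)
                 (≈-sym (⟦⟧-no (unshuffles? (x ∷ u) (y ∷ v) []) λ ()))))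
      ∑-shuffles (x ∷ u) (y ∷ v) (z ∷ w) (px ∷ pu) (¬py ∷ pv) = begin
        ∑ (map (x ∷_) (shuffles u (y ∷ v)) ++ map (y ∷_) (shuffles (x ∷ u) v)) (λ s → ⟦ s ≟ʷ (z ∷ w) ⟧)
          ≈⟨ ∑-++ _ (map (x ∷_) (shuffles u (y ∷ v))) ⟩
        _ ≈⟨ +-cong (∑-∷ x z w (shuffles u (y ∷ v))) (∑-∷ y z w (shuffles (x ∷ u) v)) ⟩
        ⟦ x ≟ z ⟧ * ∑ (shuffles u (y ∷ v)) (λ s → ⟦ s ≟ʷ w ⟧) + ⟦ y ≟ z ⟧ * ∑ (shuffles (x ∷ u) v) (λ s → ⟦ s ≟ʷ w ⟧)
          ≈⟨ +-cong (*-congˡ (∑-shuffles u (y ∷ v) w pu (¬py ∷ pv))) (*-congˡ (∑-shuffles (x ∷ u) v w (px ∷ pu) pv)) ⟩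
        ⟦ x ≟ z ⟧ * ⟦ unshuffles? u (y ∷ v) w ⟧ + ⟦ y ≟ z ⟧ * ⟦ unshuffles? (x ∷ u) v w ⟧
          ≈⟨ first-letter (P? z) ⟩
        ⟦ unshuffles? (x ∷ u) (y ∷ v) (z ∷ w) ⟧ ∎
        where
        -- `P` tells which of the two words `z` can come from, so one summand vanishes.
        first-letter : Dec (P z) → ⟦ x ≟ z ⟧ * ⟦ unshuffles? u (y ∷ v) w ⟧ + ⟦ y ≟ z ⟧ * ⟦ unshuffles? (x ∷ u) v w ⟧
                                   ≈ ⟦ unshuffles? (x ∷ u) (y ∷ v) (z ∷ w) ⟧
        first-letter (yes pz) = ≈-trans
          (+-cong (≈-sym (⟦⟧-× (x ≟ z) (unshuffles? u (y ∷ v) w)))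
                  (≈-trans (*-congʳ (⟦⟧-no (y ≟ z) (λ { refl → ¬py pz }))) (zeroˡ _)))
          (≈-trans (+-identityʳ _) (⟦⟧-cong ((x ≟ z) ×-dec unshuffles? u (y ∷ v) w) (unshuffles? (x ∷ u) (y ∷ v) (z ∷ w))
            (λ { (refl , p , q) → trans (List.filter-accept P? pz) (cong (x ∷_) p) ,
                                  trans (List.filter-reject P̄? (λ ¬pz → ¬pz pz)) q })
            (λ (p , q) → let x≡z , p′ = List.∷-injective (trans (sym (List.filter-accept P? pz)) p) in
                         sym x≡z , p′ , trans (sym (List.filter-reject P̄? (λ ¬pz → ¬pz pz))) q)))
        first-letter (no ¬pz) = ≈-trans
          (+-cong (≈-trans (*-congʳ (⟦⟧-no (x ≟ z) (λ { refl → ¬pz px }))) (zeroˡ _))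
                  (≈-sym (⟦⟧-× (y ≟ z) (unshuffles? (x ∷ u) v w))))
          (≈-trans (+-identityˡ _) (⟦⟧-cong ((y ≟ z) ×-dec unshuffles? (x ∷ u) v w) (unshuffles? (x ∷ u) (y ∷ v) (z ∷ w))
            (λ { (refl , p , q) → trans (List.filter-reject P? ¬pz) p ,
                                  trans (List.filter-accept P̄? ¬pz) (cong (y ∷_) q) })
            (λ (p , q) → let y≡z , q′ = List.∷-injective (trans (sym (List.filter-accept P̄? ¬pz)) q) in
                         sym y≡z , trans (sym (List.filter-reject P? ¬pz)) p , q′)))

    ∑-splits-≡ : ∀ u v w → ∑ (splits w) (λ (u′ , v′) → ⟦ (u′ ≟ʷ u) ×-dec (v′ ≟ʷ v) ⟧) ≈ ⟦ w ≟ʷ (u ++ v) ⟧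
    ∑-splits-≡ u v [] = ≈-trans (+-identityʳ _) (⟦⟧-cong (([] ≟ʷ u) ×-dec ([] ≟ʷ v)) ([] ≟ʷ (u ++ v))
      (λ { (refl , refl) → refl }) (λ eq → sym (List.++-conicalˡ u v (sym eq)) , sym (List.++-conicalʳ u v (sym eq))))
    ∑-splits-≡ [] v (x ∷ w) = ≈-trans
      (+-cong (⟦⟧-cong (([] ≟ʷ []) ×-dec ((x ∷ w) ≟ʷ v)) ((x ∷ w) ≟ʷ v) proj₂ (refl ,_))
              (≈-trans (∑-map _ (map₁ (x ∷_)) (splits w))
                       (∑-zero (splits w) (λ (u′ , v′) → ⟦⟧-no (((x ∷ u′) ≟ʷ []) ×-dec (v′ ≟ʷ v)) λ ()))))
      (+-identityʳ _)
    ∑-splits-≡ (y ∷ u) v (x ∷ w) = ≈-trans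
      (+-cong (⟦⟧-no (([] ≟ʷ (y ∷ u)) ×-dec ((x ∷ w) ≟ʷ v)) λ ())
              (≈-trans (∑-map _ (map₁ (x ∷_)) (splits w)) (≈-trans (∑-cong (splits w) term)
                (≈-trans (∑-*ˡ ⟦ x ≟ y ⟧ _ (splits w)) (*-congˡ (∑-splits-≡ u v w))))))
      (≈-trans (+-identityˡ _) (≈-trans (≈-sym (⟦⟧-× (x ≟ y) (w ≟ʷ (u ++ v))))
        (⟦⟧-cong ((x ≟ y) ×-dec (w ≟ʷ (u ++ v))) ((x ∷ w) ≟ʷ (y ∷ u ++ v))
                 (λ (p , q) → cong₂ _∷_ p q) List.∷-injective)))
      where
      term : ∀ ((u′ , v′) : List A × List A) →
             ⟦ ((x ∷ u′) ≟ʷ (y ∷ u)) ×-dec (v′ ≟ʷ v) ⟧ ≈ ⟦ x ≟ y ⟧ * ⟦ (u′ ≟ʷ u) ×-dec (v′ ≟ʷ v) ⟧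
      term (u′ , v′) = ≈-trans
        (⟦⟧-cong (((x ∷ u′) ≟ʷ (y ∷ u)) ×-dec (v′ ≟ʷ v)) ((x ≟ y) ×-dec ((u′ ≟ʷ u) ×-dec (v′ ≟ʷ v)))
          (λ (p , q) → let x≡y , p′ = List.∷-injective p in x≡y , p′ , q)
          (λ (x≡y , p , q) → cong₂ _∷_ x≡y p , q))
        (⟦⟧-× (x ≟ y) ((u′ ≟ʷ u) ×-dec (v′ ≟ʷ v)))

  ∑-splits-at : ∀ (t : List A × List A → Carrier) k w → (∀ u v → u ++ v ≡ w → length u ≢ k → t (u , v) ≈ 0#) →
                k ℕ.≤ length w → ∑ (splits w) t ≈ t (take k w , drop k w)
  ∑-splits-at t zero    []      off _ = +-identityʳ _
  ∑-splits-at t zero    (x ∷ w) off _ = ≈-trans (+-congˡ (≈-trans (∑-map t (map₁ (x ∷_)) (splits w))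
    (∑-zero-local (All.map (λ {(u , v)} eq → off (x ∷ u) v (cong (x ∷_) eq) (λ ())) (splits-≡ w)))))
    (+-identityʳ _)
  ∑-splits-at t (suc k) (x ∷ w) off (s≤s k≤) = ≈-trans
    (+-cong (off [] (x ∷ w) refl (λ ())) (≈-trans (∑-map t (map₁ (x ∷_)) (splits w))
      (∑-splits-at (t ∘ map₁ (x ∷_)) k w (λ u v eq ne → off (x ∷ u) v (cong (x ∷_) eq) (ne ∘ ℕ.suc-injective)) k≤)))
    (+-identityˡ _)

  infix 4 _≟ʷ_
  _≟ʷ_ : ∀ (u v : List ℕ) → Dec (u ≡ v)
  _≟ʷ_ = List.≡-dec ℕ._≟_

  low high : ℕ → List ℕ → List ℕ
  low n  = filter (ℕ._≤? n)
  high n = filter (λ i → ¬? (i ℕ.≤? n))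

  lowHigh? : ∀ n u v π → Dec (low n π ≡ u × high n π ≡ v)
  lowHigh? n u v π = (low n π ≟ʷ u) ×-dec (high n π ≟ʷ v)

  -- The letters of σ are at most `n` and the shifted letters of ν exceed it, so comparison with `n`
  -- is a separating predicate for `∑-shuffles`.
  ∑-⧢ : ∀ σ ν π → let n = length (word σ) in
        ∑ (σ ⧢ ν) (λ τ → ⟦ word τ ≟ʷ π ⟧) ≈ ⟦ lowHigh? n (word σ) (map (n ℕ.+_) (word ν)) π ⟧
  ∑-⧢ σ ν π = ≈-trans
    (≈-trans (≈-sym (∑-map (λ u → ⟦ u ≟ʷ π ⟧) word (σ ⧢ ν)))
             (≈-reflexive (cong (λ L → ∑ L (λ u → ⟦ u ≟ʷ π ⟧))
               (trans (map-mapWith∈ (shuffles (word σ) shifted) fromShuffle word)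
                      (trans (mapWith∈≗map id (shuffles (word σ) shifted)) (List.map-id _))))))
    (∑-shuffles ℕ._≟_ (ℕ._≤? n) (word σ) shifted π (All.map proj₂ (range σ))
      (All.map⁺ (All.map (λ (1≤i , _) n+i≤n → ℕ.<⇒≱ (ℕ.m<m+n n 1≤i) n+i≤n) (range ν))))
    where
    open ShiftedShuffle σ ν
    n = length (word σ)

  Positions-∷ʳ : ∀ o n → Positions o (suc n) ≡ Positions o n ++ [ suc (o ℕ.+ n) ]
  Positions-∷ʳ o zero    = cong (λ k → [ suc k ]) (sym (ℕ.+-identityʳ o))
  Positions-∷ʳ o (suc n) = cong (suc o ∷_) (trans (Positions-∷ʳ (suc o) n)
    (cong (λ k → Positions (suc o) n ++ [ suc k ]) (sym (ℕ.+-suc o n))))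

  low-high-last : ∀ n {π} → π ↭ Positions 0 (suc n) → low n π ↭ Positions 0 n × high n π ≡ [ suc n ]
  low-high-last n {π} π↭ =
    ↭-trans (↭.filter-↭ _ π↭′) (↭-reflexive (filter-++-≡ˡ (ℕ._≤? n) ≤n ≰n)) ,
    ↭.↭-singleton-inv (↭-trans (↭.filter-↭ _ π↭′) (↭-reflexive (filter-++-≡ʳ (ℕ._≤? n) ≤n ≰n)))
    where
    π↭′ : π ↭ Positions 0 n ++ [ suc n ]
    π↭′ = ↭-trans π↭ (↭-reflexive (Positions-∷ʳ 0 n))
    ≤n = All.map proj₂ (Positions-bounds 0 n)
    ≰n : All (λ i → ¬ i ℕ.≤ n) [ suc n ]
    ≰n = ℕ.1+n≰n ∷ []

  -- Erasing the letter n + 1 from τ gives the only permutation of size n from which τ arises by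
  -- insertion.
  ∑-permutations : ∀ n τ → length (word τ) ≡ n → ∑ (permutations n) (λ σ → ⟦ word σ ≟ʷ word τ ⟧) ≈ 1#
  ∑-permutations zero    record { word = [] } _ = +-identityʳ 1#
  ∑-permutations (suc n) τ τ≡
    with low↭ , high≡ ← low-high-last n (subst (λ m → word τ ↭ Positions 0 m) τ≡ (word-Positions τ))
    with τ′ , τ′≡ ← toPermutation _ low↭ = begin
      ∑ (concatMap (_⧢ singletonPermutation) (permutations n)) (λ σ → ⟦ word σ ≟ʷ word τ ⟧)
        ≈⟨ ∑-concatMap _ (_⧢ singletonPermutation) (permutations n) ⟩
      ∑ (permutations n) (λ σ → ∑ (σ ⧢ singletonPermutation) (λ ρ → ⟦ word ρ ≟ʷ word τ ⟧))
        ≈⟨ ∑-cong (permutations n) (λ σ → ≈-trans (∑-⧢ σ singletonPermutation (word τ)) (extends σ)) ⟩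
      ∑ (permutations n) (λ σ → ⟦ word σ ≟ʷ word τ′ ⟧)
        ≈⟨ ∑-permutations n τ′ (trans (cong length τ′≡) (length-word-Positions low↭)) ⟩
      1# ∎
    where
    extends : ∀ σ → ⟦ lowHigh? (length (word σ)) (word σ) [ length (word σ) ℕ.+ 1 ] (word τ) ⟧ ≈ ⟦ word σ ≟ʷ word τ′ ⟧
    extends σ = ⟦⟧-cong (lowHigh? (length (word σ)) (word σ) [ length (word σ) ℕ.+ 1 ] (word τ)) (word σ ≟ʷ word τ′)
      -- The size of σ is recovered by counting: its letters and the single high one make up the n +
      -- 1 letters of τ.
      (λ (p , q) → trans (sym p) (trans (cong (λ m → low m (word τ)) (ℕ.suc-injective
        (trans (ℕ.+-comm 1 _) (trans (sym (cong₂ ℕ._+_ (cong length p) (cong length q)))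
               (trans (length-filters (ℕ._≤? length (word σ)) (word τ)) τ≡))))) (sym τ′≡)))
      (λ eq → let |σ| = trans (cong length (trans eq τ′≡)) (length-word-Positions low↭) in
        trans (cong (λ m → low m (word τ)) |σ|) (trans (sym τ′≡) (sym eq)) ,
        trans (cong (λ m → high m (word τ)) |σ|)
              (trans high≡ (cong [_] (trans (ℕ.+-comm 1 n) (cong (ℕ._+ 1) (sym |σ|))))))

  -- `fibre` searches a single size, which suffices because `Pˢ` determines the size of τ.
  ∑-fibre : ∀ J τ → ∑ (fibre J) (λ σ → ⟦ word σ ≟ʷ word τ ⟧) ≈ ⟦ Pˢ τ ≟ˢˢ shapes J ⟧
  ∑-fibre J τ = begin
    ∑ (fibre J) (λ σ → ⟦ word σ ≟ʷ word τ ⟧)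
      ≈⟨ ∑-filter (λ σ → Pˢ σ ≟ˢˢ shapes J) _ all ⟩
    ∑ all (λ σ → ⟦ word σ ≟ʷ word τ ⟧ * ⟦ Pˢ σ ≟ˢˢ shapes J ⟧)
      ≈⟨ ∑-cong all (λ σ → ≈-trans (*-comm _ _) (⟦⟧-*-cong (word σ ≟ʷ word τ) (λ eq →
           ≈-reflexive (cong (λ s → ⟦ s ≟ˢˢ shapes J ⟧) (Pˢ-cong σ eq))))) ⟩
    ∑ all (λ σ → ⟦ Pˢ τ ≟ˢˢ shapes J ⟧ * ⟦ word σ ≟ʷ word τ ⟧)
      ≈⟨ ∑-*ˡ _ _ all ⟩
    ⟦ Pˢ τ ≟ˢˢ shapes J ⟧ * ∑ all (λ σ → ⟦ word σ ≟ʷ word τ ⟧)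
      ≈⟨ *-comm _ _ ⟩
    ∑ all (λ σ → ⟦ word σ ≟ʷ word τ ⟧) * ⟦ Pˢ τ ≟ˢˢ shapes J ⟧
      ≈⟨ ⟦⟧-*-cong (Pˢ τ ≟ˢˢ shapes J) (λ eq → ∑-permutations (#nodes (left J)) τ
           (trans (sym (#nodes-Pˢ τ)) (cong (#nodes ∘ proj₁) eq))) ⟩
    1# * ⟦ Pˢ τ ≟ˢˢ shapes J ⟧
      ≈⟨ *-identityˡ _ ⟩
    ⟦ Pˢ τ ≟ˢˢ shapes J ⟧ ∎
    where
    all = permutations (#nodes (left J))
    Pˢ-cong : ∀ σ → word σ ≡ word τ → Pˢ σ ≡ Pˢ τ
    Pˢ-cong σ = cong insertionShapes

  -- Coefficients of products and coproducts

  -- Indexed by bare shapes instead of `TwinTrees`, so that an equality of `treeShapes` transports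
  -- by `cong`.
  shapeCoefficient : ShapePair → Baxter.Carrierᴹ → Carrier
  shapeCoefficient s x = ⟨ x , (λ J → ⟦ s ≟ˢˢ shapes J ⟧) ⟩

  wordCoefficient : List ℕ → FQSym.Carrierᴹ → Carrier
  wordCoefficient π x = ⟨ x , (λ σ → ⟦ word σ ≟ʷ π ⟧) ⟩

  wordCoefficient-ι : ∀ x τ → wordCoefficient (word τ) (ι x) ≈ shapeCoefficient (Pˢ τ) x
  wordCoefficient-ι x τ = ≈-trans (⟨⟩-extend permutationDecSetoid (basisSum ∘ fibre) _ x)
    (⟨⟩-cong x (λ J → ≈-trans (⟨⟩-basisSum _ (fibre J)) (∑-fibre J τ)))

  wordCoefficient-ι-Sorts : ∀ X x {π} w → Sorts (_≼_ X) 0 π w →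
    wordCoefficient π (ι x) ≈ shapeCoefficient (IncrDecr.treeShapes X w) x
  wordCoefficient-ι-Sorts X x {π} w s with τ , refl ← toPermutation π (Sorts-positions s) =
    ≈-trans (wordCoefficient-ι x τ)
            (≈-reflexive (cong (λ t → shapeCoefficient t x) (sym (treeShapes-Pˢ X {w} τ s))))

  coef-r : ∀ X x w → Polynomials.coef (r X x) w ≈ shapeCoefficient (IncrDecr.treeShapes X w) x
  coef-r X []      w = ≈-refl
  coef-r X (_ ∷ x) w = +-congˡ (coef-r X x w)

  module _ {R : Rel A 0ℓ} {π w} (s : Sorts R 0 π w) where

    private
      Sorts-split : ∀ u v → u ++ v ≡ w → Sorts R 0 (low (length u) π) u ×
                                           Sorts R (length u) (high (length u) π) v
      Sorts-split u v refl = Sorts-++ u s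

      unshift : ℕ → List ℕ
      unshift n = map (ℕ._∸ n) (high n π)

      shift-unshift : ∀ n → map (n ℕ.+_) (unshift n) ≡ high n π
      shift-unshift n = trans (sym (List.map-∘ (high n π))) (List.map-id-local
        (All.map (λ i≰n → ℕ.m+[n∸m]≡n (ℕ.<⇒≤ (ℕ.≰⇒> i≰n))) (All.all-filter (λ i → ¬? (i ℕ.≤? n)) π)))

      unshift-shift : ∀ n ν → map (ℕ._∸ n) (map (n ℕ.+_) ν) ≡ ν
      unshift-shift n ν = trans (sym (List.map-∘ ν)) (trans (List.map-cong (ℕ.m+n∸m≡n n) ν) (List.map-id ν))

    Sorts-unshift : ∀ u v → u ++ v ≡ w → Sorts R 0 (low (length u) π) u × Sorts R 0 (unshift (length u)) v
    Sorts-unshift u v eq with sˡ , sʳ ← Sorts-split u v eq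
      with ν , high≡ , sν ← Sorts-shift (length u)
             (subst (λ o → Sorts R o (high (length u) π) v) (sym (ℕ.+-identityʳ (length u))) sʳ) =
      sˡ , subst (λ ν → Sorts R 0 ν v)
                 (trans (sym (unshift-shift (length u) ν)) (cong (map (ℕ._∸ length u)) (sym high≡))) sν

    -- Only the cut with `length u` equal to the size of σ contributes. Summing over all cuts frees
    -- their range from σ, so that linearity applies in each argument separately.
    ∑-⧢-splits : ∀ σ ν → ∑ (σ ⧢ ν) (λ τ → ⟦ word τ ≟ʷ π ⟧) ≈
      ∑ (splits w) (λ (u , v) → ⟦ word σ ≟ʷ low (length u) π ⟧ * ⟦ word ν ≟ʷ unshift (length u) ⟧)
    ∑-⧢-splits σ ν = ≈-trans (∑-⧢ σ ν π) (≈-sym (at (k ℕ.≤? length w)))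
      where
      k = length (word σ)
      term : ℕ → Carrier
      term j = ⟦ word σ ≟ʷ low j π ⟧ * ⟦ word ν ≟ʷ unshift j ⟧
      off : ∀ u v → u ++ v ≡ w → length u ≢ k → term (length u) ≈ 0#
      off u v eq ne = ≈-trans (*-congʳ (⟦⟧-no (word σ ≟ʷ low (length u) π) (λ σ≡ →
        ne (sym (trans (cong length σ≡) (length-sorted (proj₁ (Sorts-split u v eq)))))))) (zeroˡ _)
      at : Dec (k ℕ.≤ length w) → ∑ (splits w) (λ (u , v) → term (length u)) ≈
                                  ⟦ lowHigh? k (word σ) (map (k ℕ.+_) (word ν)) π ⟧
      at (yes k≤w) = begin
        ∑ (splits w) (λ (u , v) → term (length u))
          ≈⟨ ∑-splits-at (term ∘ length ∘ proj₁) k w off k≤w ⟩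
        term (length (take k w))
          ≈⟨ ≈-reflexive (cong term (trans (List.length-take k w) (ℕ.m≤n⇒m⊓n≡m k≤w))) ⟩
        term k
          ≈⟨ ⟦⟧-× (word σ ≟ʷ low k π) (word ν ≟ʷ unshift k) ⟨
        ⟦ (word σ ≟ʷ low k π) ×-dec (word ν ≟ʷ unshift k) ⟧
          ≈⟨ ⟦⟧-cong ((word σ ≟ʷ low k π) ×-dec (word ν ≟ʷ unshift k)) (lowHigh? k (word σ) (map (k ℕ.+_) (word ν)) π)
               (λ (p , q) → sym p , trans (sym (shift-unshift k)) (cong (map (k ℕ.+_)) (sym q)))
               (λ (p , q) → sym p , trans (sym (unshift-shift k (word ν))) (cong (map (ℕ._∸ k)) (sym q))) ⟩
        ⟦ lowHigh? k (word σ) (map (k ℕ.+_) (word ν)) π ⟧ ∎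
      at (no k≰w) = ≈-trans
        (∑-zero-local (All.map (λ {(u , v)} eq → off u v eq (λ |u|≡k →
          k≰w (subst (ℕ._≤ length w) |u|≡k (length-prefix u eq)))) (splits-≡ w)))
        (≈-sym (⟦⟧-no (lowHigh? k (word σ) (map (k ℕ.+_) (word ν)) π) (λ (p , _) →
          k≰w (subst₂ ℕ._≤_ (cong length p) (length-sorted s) (List.length-filter (ℕ._≤? k) π)))))

    wordCoefficient-∙ᶠ : ∀ x y → wordCoefficient π (x ∙ᶠ y) ≈
      ∑ (splits w) (λ (u , v) → wordCoefficient (low (length u) π) x * wordCoefficient (unshift (length u)) y)
    wordCoefficient-∙ᶠ x y = begin
      wordCoefficient π (x ∙ᶠ y)
        ≈⟨ ⟨⟩-extend permutationDecSetoid (λ σ → extend FQSym (λ ν → basisSum (σ ⧢ ν)) y) _ x ⟩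
      ⟨ x , (λ σ → wordCoefficient π (extend FQSym (λ ν → basisSum (σ ⧢ ν)) y)) ⟩
        ≈⟨ ⟨⟩-cong x (λ σ → ≈-trans (⟨⟩-extend permutationDecSetoid (λ ν → basisSum (σ ⧢ ν)) _ y)
             (≈-trans (⟨⟩-cong y (λ ν → ≈-trans (⟨⟩-basisSum _ (σ ⧢ ν)) (∑-⧢-splits σ ν)))
             (≈-trans (⟨⟩-∑ _ y (splits w)) (∑-cong (splits w) (λ _ → ⟨⟩-*ˡ _ _ y))))) ⟩
      ⟨ x , (λ σ → ∑ (splits w) (λ (u , v) →
        ⟦ word σ ≟ʷ low (length u) π ⟧ * wordCoefficient (unshift (length u)) y)) ⟩
        ≈⟨ ⟨⟩-∑ _ x (splits w) ⟩
      ∑ (splits w) (λ (u , v) → ⟨ x , (λ σ →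
        ⟦ word σ ≟ʷ low (length u) π ⟧ * wordCoefficient (unshift (length u)) y) ⟩)
        ≈⟨ ∑-cong (splits w) (λ _ → ⟨⟩-*ʳ _ _ x) ⟩
      ∑ (splits w) (λ (u , v) → wordCoefficient (low (length u) π) x * wordCoefficient (unshift (length u)) y) ∎

  -- At each cut the low part of `π` sorts the prefix and the lowered high part sorts the suffix, so
  -- both factors are coefficients of words.
  wordCoefficient-product : ∀ X x y {π w} → Sorts (_≼_ X) 0 π w →
    wordCoefficient π (ι x ∙ᶠ ι y) ≈ Polynomials.coef (Polynomials._∙ᵖ_ X (r X x) (r X y)) w
  wordCoefficient-product X x y {π} {w} s = ≈-trans (wordCoefficient-∙ᶠ s (ι x) (ι y))
    (∑-cong-local (All.map (λ {(u , v)} eq → let sˡ , sʳ = Sorts-unshift s u v eq in *-cong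
      (≈-trans (wordCoefficient-ι-Sorts X x u sˡ) (≈-sym (coef-r X x u)))
      (≈-trans (wordCoefficient-ι-Sorts X y v sʳ) (≈-sym (coef-r X y v)))) (splits-≡ w)))

  place₂ : List Bool → List ℕ → List ℕ → List ℕ
  place₂ S α β = map (pos S) α ++ map (pos (map not S)) β

  ∑-choices : ∀ n m {S} → S ∈ choices n m → ∑ (choices n m) (λ S′ → ⟦ List.≡-dec Bool._≟_ S′ S ⟧) ≈ 1#
  ∑-choices n m {S} S∈ = ≈-trans
    (∑-shuffles Bool._≟_ (Bool._≟ true) (replicate n true) (replicate m false) S
      (All.replicate⁺ n refl) (All.replicate⁺ m λ ()))
    (⟦⟧-yes (unshuffles? Bool._≟_ (Bool._≟ true) (replicate n true) (replicate m false) S)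
      (Mix-filter (Bool._≟ true) (choices-Mix n m S∈) (All.replicate⁺ n refl) (All.replicate⁺ m λ ())))

  -- Double counting of pairs of a cut and a selector: a cut with the required standardizations has
  -- exactly one selector, and for a given selector the factors are known, so a cut exists only if σ
  -- is their concatenation.
  ∑-std : ∀ α β σ → ∑ (splits (word σ)) (λ (u , v) → ⟦ (word (std u) ≟ʷ word α) ×-dec (word (std v) ≟ʷ word β) ⟧) ≈
          ∑ (choices (length (word α)) (length (word β))) (λ S → ⟦ word σ ≟ʷ place₂ S (word α) (word β) ⟧)
  ∑-std α β σ = begin
    ∑ (splits (word σ)) (λ (u , v) → ⟦ std? u v ⟧)
      ≈⟨ ∑-cong-local (All.map (λ {(u , v)} eq → selectors u v eq (std? u v)) (splits-≡ (word σ))) ⟩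
    ∑ (splits (word σ)) (λ (u , v) → ∑ Ss (λ S → ⟦ selects? S u v ⟧))
      ≈⟨ ∑-swap _ (splits (word σ)) Ss ⟩
    ∑ Ss (λ S → ∑ (splits (word σ)) (λ (u , v) → ⟦ selects? S u v ⟧))
      ≈⟨ ∑-cong Ss (λ S → ∑-splits-≡ ℕ._≟_ (map (pos S) (word α)) (map (pos (map not S)) (word β)) (word σ)) ⟩
    ∑ Ss (λ S → ⟦ word σ ≟ʷ place₂ S (word α) (word β) ⟧) ∎
    where
    Ss = choices (length (word α)) (length (word β))
    std? : ∀ u v → Dec (word (std u) ≡ word α × word (std v) ≡ word β)
    std? u v = (word (std u) ≟ʷ word α) ×-dec (word (std v) ≟ʷ word β)
    selects? : ∀ S u v → Dec (Selects S (word α) (word β) u v)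
    selects? S u v = (u ≟ʷ map (pos S) (word α)) ×-dec (v ≟ʷ map (pos (map not S)) (word β))
    length-std : ∀ u α → word (std u) ≡ word α → length u ≡ length (word α)
    length-std u α eq = trans (sym (List.length-tabulate (Standardization.rank u))) (cong length eq)
    selectors : ∀ u v → u ++ v ≡ word σ → Dec (word (std u) ≡ word α × word (std v) ≡ word β) →
                ⟦ std? u v ⟧ ≈ ∑ Ss (λ S → ⟦ selects? S u v ⟧)
    selectors u v eq (yes (p , q)) with S₀ , S₀∈ , sel ← selector σ {u} {v} eq =
      ≈-trans (⟦⟧-yes (std? u v) (p , q)) (≈-sym (≈-trans
        (∑-cong-local (All.tabulate λ {S} S∈ → ⟦⟧-cong (selects? S u v) (List.≡-dec Bool._≟_ S S₀)
          (λ sel′ → Selects-unique α β S∈ S₀∈′ sel′ sel′₀) (λ { refl → sel′₀ })))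
        (∑-choices (length (word α)) (length (word β)) S₀∈′)))
      where
      S₀∈′ : S₀ ∈ Ss
      S₀∈′ = subst₂ (λ n m → S₀ ∈ choices n m) (length-std u α p) (length-std v β q) S₀∈
      sel′₀ : Selects S₀ (word α) (word β) u v
      sel′₀ = subst₂ (λ a b → Selects S₀ a b u v) p q sel
    selectors u v eq (no ¬std) = ≈-trans (⟦⟧-no (std? u v) ¬std) (≈-sym
      (∑-zero Ss λ S → ⟦⟧-no (selects? S u v) λ { (refl , refl) → ¬std (std-pos S α , std-pos (map not S) β) }))

  Permutation² : DecSetoid 0ℓ 0ℓ
  Permutation² = ×-decSetoid permutationDecSetoid permutationDecSetoid

  coefficient-Δ : ∀ α β x → coefficient Permutation² (α , β) (Δ x) ≈
    ∑ (choices (length (word α)) (length (word β))) (λ S → wordCoefficient (place₂ S (word α) (word β)) x)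
  coefficient-Δ α β x = begin
    coefficient Permutation² (α , β) (Δ x)
      ≈⟨ coefficient-⟨⟩ Permutation² (α , β) (Δ x) ⟩
    ⟨ Δ x , (λ e → ⟦ e ≟² (α , β) ⟧) ⟩
      ≈⟨ ⟨⟩-extend Permutation² _ _ x ⟩
    ⟨ x , (λ σ → ⟨ basisSum (map (λ (u , v) → std u , std v) (splits (word σ))) , (λ e → ⟦ e ≟² (α , β) ⟧) ⟩) ⟩
      ≈⟨ ⟨⟩-cong x (λ σ → ≈-trans (⟨⟩-basisSum _ (map (λ (u , v) → std u , std v) (splits (word σ))))
           (≈-trans (∑-map _ (λ (u , v) → std u , std v) (splits (word σ))) (≈-trans
             (∑-cong (splits (word σ)) (λ (u , v) → ⟦⟧-cong ((std u , std v) ≟² (α , β))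
               ((word (std u) ≟ʷ word α) ×-dec (word (std v) ≟ʷ word β)) id id))
             (∑-std α β σ)))) ⟩
    ⟨ x , (λ σ → ∑ Ss (λ S → ⟦ word σ ≟ʷ place₂ S (word α) (word β) ⟧)) ⟩
      ≈⟨ ⟨⟩-∑ _ x Ss ⟩
    ∑ Ss (λ S → wordCoefficient (place₂ S (word α) (word β)) x) ∎
    where
    open DecSetoid Permutation² using () renaming (_≟_ to _≟²_)
    Ss = choices (length (word α)) (length (word β))

  commute-r : ∀ X Y x p q → commute X Y (r (X ⊕ Y) x) p q ≈ ∑ (choices (length p) (length q)) (λ S →
    shapeCoefficient (IncrDecr.treeShapes (X ⊕ Y) (merge S (map inj₁ p) (map inj₂ q))) x)
  commute-r X Y x p q = ≈-trans
    (≈-reflexive (cong (λ L → ∑ L (Polynomials.coef (r (X ⊕ Y) x)))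
      (trans (shuffles-merge (map inj₁ p) (map inj₂ q)) (cong (map _)
        (cong₂ choices (List.length-map inj₁ p) (List.length-map inj₂ q))))))
    (≈-trans (∑-map _ (λ S → merge S (map inj₁ p) (map inj₂ q)) (choices (length p) (length q)))
             (∑-cong (choices (length p) (length q)) (λ S → coef-r (X ⊕ Y) x (merge S (map inj₁ p) (map inj₂ q)))))

  -- Selectors index both sums, and the terms agree: by `Sorts-Mix`, the permutation that `S`
  -- assembles from α and β sorts the shuffle of `p` and `q` chosen by `S`.
  coefficient-Δ-ι : ∀ X Y x {α β p q} → Sorts (_≼_ X) 0 (word α) p → Sorts (_≼_ Y) 0 (word β) q →
    coefficient Permutation² (α , β) (Δ (ι x)) ≈ commute X Y (r (X ⊕ Y) x) p q
  coefficient-Δ-ι X Y x {α} {β} {p} {q} s t = ≈-trans (coefficient-Δ α β (ι x)) (≈-sym (≈-trans (commute-r X Y x p q)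
    (≈-trans (≈-reflexive (cong₂ (λ n m → ∑ (choices n m) _) (sym (length-sorted s)) (sym (length-sorted t))))
    (∑-cong-local (All.tabulate λ {S} S∈ → ≈-sym (wordCoefficient-ι-Sorts (X ⊕ Y) x _ (merged S∈)))))))
    where
    merged : ∀ {S} → S ∈ choices (length (word α)) (length (word β)) →
             Sorts (_≼_ (X ⊕ Y)) 0 (place₂ S (word α) (word β)) (merge S (map inj₁ p) (map inj₂ q))
    merged {S} S∈ = Sorts-Mix (Sorts-map inj₁ (_∘ drop-inj₁) (_∘ ₁∼₁) s) (Sorts-map inj₂ (_∘ drop-inj₂) (_∘ ₂∼₂) t)
      (Mix-⊕ p q (subst₂ (λ n m → S ∈ choices n m) (length-sorted s) (length-sorted t) S∈)) (≼-wins X Y p q)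

  -- The Hopf subalgebra and its realization

  splits-Pointwise : ∀ (u v : List A) → length u ≡ length v →
    Pointwise (λ (p , q) (p′ , q′) → length p ≡ length p′ × p ++ q ≡ u × p′ ++ q′ ≡ v) (splits u) (splits v)
  splits-Pointwise []      []      _  = (refl , refl , refl) ∷ []
  splits-Pointwise (x ∷ u) (y ∷ v) eq = (refl , refl , refl) ∷ Pointwise.map⁺ _ _
    (Pointwise.map (λ (p , q , q′) → cong suc p , cong (x ∷_) q , cong (y ∷_) q′)
                   (splits-Pointwise u v (ℕ.suc-injective eq)))

  ∑-Pointwise : ∀ {f g : C → Carrier} {xs ys} → Pointwise (λ x y → f x ≈ g y) xs ys → ∑ xs f ≈ ∑ ys g
  ∑-Pointwise []       = ≈-refl
  ∑-Pointwise (p ∷ ps) = +-cong p (∑-Pointwise ps)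

  coefficient-shape : ∀ J x → coefficient twinTreesDecSetoid J x ≈ shapeCoefficient (shapes J) x
  coefficient-shape J x = ≈-trans (coefficient-⟨⟩ twinTreesDecSetoid J x)
    (⟨⟩-cong x (λ J′ → ⟦⟧-cong (shapes J′ ≟ˢˢ shapes J) (shapes J ≟ˢˢ shapes J′) sym sym))

  coefficient-word : ∀ σ x → coefficient permutationDecSetoid σ x ≈ wordCoefficient (word σ) x
  coefficient-word = coefficient-⟨⟩ permutationDecSetoid

  coefficient-ι : ∀ σ x → coefficient permutationDecSetoid σ (ι x) ≈ shapeCoefficient (Pˢ σ) x
  coefficient-ι σ x = ≈-trans (coefficient-word σ (ι x)) (wordCoefficient-ι x σ)

  shapeCoefficient-cong : ∀ x y → x Baxter.≈ᴹ y → ∀ J {s} → shapes J ≡ s → shapeCoefficient s x ≈ shapeCoefficient s y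
  shapeCoefficient-cong x y x≈y J refl =
    ≈-trans (≈-sym (coefficient-shape J x)) (≈-trans (x≈y J) (coefficient-shape J y))

  ι-mono : LeftModuleMorphisms.IsLeftModuleMonomorphism Baxter FQSym ι
  ι-mono = record
    { isLeftModuleHomomorphism = record
      { +ᴹ-isGroupHomomorphism = record
        { isMonoidHomomorphism = record
          { isMagmaHomomorphism = record
            { isRelHomomorphism = record { cong = λ {x} {y} x≈y σ → let J , eq = Pˢ-twin σ in
                ≈-trans (coefficient-ι σ x) (≈-trans (shapeCoefficient-cong x y x≈y J eq) (≈-sym (coefficient-ι σ y))) }
            ; homo = λ x y σ → begin
                coefficient permutationDecSetoid σ (ι (x ++ y))      ≈⟨ coefficient-ι σ (x ++ y) ⟩
                shapeCoefficient (Pˢ σ) (x ++ y)                     ≈⟨ ∑-++ _ x ⟩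
                shapeCoefficient (Pˢ σ) x + shapeCoefficient (Pˢ σ) y
                  ≈⟨ +-cong (wordCoefficient-ι x σ) (wordCoefficient-ι y σ) ⟨
                wordCoefficient (word σ) (ι x) + wordCoefficient (word σ) (ι y) ≈⟨ ∑-++ _ (ι x) ⟨
                wordCoefficient (word σ) (ι x ++ ι y)                ≈⟨ coefficient-word σ (ι x ++ ι y) ⟨
                coefficient permutationDecSetoid σ (ι x ++ ι y)      ∎ }
          ; ε-homo = λ _ → ≈-refl }
        ; ⁻¹-homo = λ x σ → begin
            coefficient permutationDecSetoid σ (ι (Baxter.-ᴹ x)) ≈⟨ coefficient-ι σ (Baxter.-ᴹ x) ⟩
            shapeCoefficient (Pˢ σ) (Baxter.-ᴹ x)                ≈⟨ ⟨⟩-neg _ x ⟩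
            - shapeCoefficient (Pˢ σ) x                          ≈⟨ -‿cong (wordCoefficient-ι x σ) ⟨
            - wordCoefficient (word σ) (ι x)                     ≈⟨ ⟨⟩-neg _ (ι x) ⟨
            wordCoefficient (word σ) (FQSym.-ᴹ ι x)              ≈⟨ coefficient-word σ (FQSym.-ᴹ ι x) ⟨
            coefficient permutationDecSetoid σ (FQSym.-ᴹ ι x)    ∎ }
      ; *ₗ-homo = λ k x σ → begin
          coefficient permutationDecSetoid σ (ι (k Baxter.*ₗ x)) ≈⟨ coefficient-ι σ (k Baxter.*ₗ x) ⟩
          shapeCoefficient (Pˢ σ) (k Baxter.*ₗ x)                ≈⟨ ⟨⟩-scale k _ x ⟩
          k * shapeCoefficient (Pˢ σ) x                          ≈⟨ *-congˡ (wordCoefficient-ι x σ) ⟨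
          k * wordCoefficient (word σ) (ι x)                     ≈⟨ ⟨⟩-scale k _ (ι x) ⟨
          wordCoefficient (word σ) (k FQSym.*ₗ ι x)              ≈⟨ coefficient-word σ (k FQSym.*ₗ ι x) ⟨
          coefficient permutationDecSetoid σ (k FQSym.*ₗ ι x)    ∎ }
    ; injective = λ {x} {y} ιx≈ιy J → let σ , eq = twin-permutation J in
        ≈-trans (via J x σ eq) (≈-trans (ιx≈ιy σ) (≈-sym (via J y σ eq))) }
    where
    via : ∀ J x σ → Pˢ σ ≡ shapes J → coefficient twinTreesDecSetoid J x ≈ coefficient permutationDecSetoid σ (ι x)
    via J x σ eq = ≈-trans (coefficient-shape J x)
      (≈-trans (≈-reflexive (cong (λ s → shapeCoefficient s x) (sym eq))) (≈-sym (coefficient-ι σ x)))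

  r-mono : LeftModuleMorphisms.IsLeftModuleMonomorphism Baxter (Polynomials.polynomials 𝔸) (r 𝔸)
  r-mono = record
    { isLeftModuleHomomorphism = record
      { +ᴹ-isGroupHomomorphism = record
        { isMonoidHomomorphism = record
          { isMagmaHomomorphism = record
            { isRelHomomorphism = record { cong = λ {x} {y} x≈y w → let J , eq = treeShapes-twin 𝔸 w in
                ≈-trans (coef-r 𝔸 x w) (≈-trans (shapeCoefficient-cong x y x≈y J eq) (≈-sym (coef-r 𝔸 y w))) }
            ; homo = λ x y w → ≈-trans (coef-r 𝔸 (x ++ y) w) (≈-trans (∑-++ _ x)
                (≈-sym (+-cong (coef-r 𝔸 x w) (coef-r 𝔸 y w)))) }
          ; ε-homo = λ _ → ≈-refl }
        ; ⁻¹-homo = λ x w → ≈-trans (coef-r 𝔸 (Baxter.-ᴹ x) w) (≈-trans (⟨⟩-neg _ x)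
            (-‿cong (≈-sym (coef-r 𝔸 x w)))) }
      ; *ₗ-homo = λ k x w → ≈-trans (coef-r 𝔸 (k Baxter.*ₗ x) w) (≈-trans (⟨⟩-scale k _ x)
          (*-congˡ (≈-sym (coef-r 𝔸 x w)))) }
    ; injective = λ {x} {y} rx≈ry J → let w , eq = twin-word J in
        ≈-trans (via J x eq) (≈-trans (rx≈ry w) (≈-sym (via J y eq))) }
    where
    via : ∀ J x {w} → IncrDecr.treeShapes 𝔸 w ≡ shapes J →
          coefficient twinTreesDecSetoid J x ≈ Polynomials.coef (r 𝔸 x) w
    via J x {w} eq = ≈-trans (coefficient-shape J x)
      (≈-trans (≈-reflexive (cong (λ s → shapeCoefficient s x) (sym eq))) (≈-sym (coef-r 𝔸 x w)))

  -- The combination is spread over the classes of `Pˢ`, and each class is then named by its pair of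
  -- twin trees.
  ι-image : ∀ y → (∀ {σ τ} → Pˢ σ ≡ Pˢ τ →
    coefficient permutationDecSetoid σ y ≈ coefficient permutationDecSetoid τ y) → ∃ λ z → ι z FQSym.≈ᴹ y
  ι-image y const
    with z , z≈ ← class-combination permutationDecSetoid _≟ˢˢ_ Pˢ
                    (cong insertionShapes) y (λ {σ} {τ} → const {σ} {τ}) =
    map (map₂ (proj₁ ∘ Pˢ-twin)) z , λ σ → begin
      coefficient permutationDecSetoid σ (ι (map (map₂ (proj₁ ∘ Pˢ-twin)) z))
        ≈⟨ coefficient-ι σ (map (map₂ (proj₁ ∘ Pˢ-twin)) z) ⟩
      shapeCoefficient (Pˢ σ) (map (map₂ (proj₁ ∘ Pˢ-twin)) z)
        ≈⟨ ⟨⟩-map₂ _ (proj₁ ∘ Pˢ-twin) z ⟩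
      ⟨ z , (λ τ → ⟦ Pˢ σ ≟ˢˢ shapes (proj₁ (Pˢ-twin τ)) ⟧) ⟩
        ≈⟨ ⟨⟩-cong z (λ τ → ≈-reflexive (cong (λ s → ⟦ Pˢ σ ≟ˢˢ s ⟧) (proj₂ (Pˢ-twin τ)))) ⟩
      ⟨ z , (λ τ → ⟦ Pˢ σ ≟ˢˢ Pˢ τ ⟧) ⟩
        ≈⟨ z≈ σ ⟩
      coefficient permutationDecSetoid σ y ∎

  coefficient-1ᶠ : ∀ σ → coefficient permutationDecSetoid σ 1ᶠ ≈ ⟦ [] ≟ʷ word σ ⟧
  coefficient-1ᶠ σ = ≈-trans (coefficient-word σ 1ᶠ) (≈-trans (+-identityʳ _) (*-identityˡ _))

  unit : ∃ λ z → IsUnit z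
  unit = ι-image 1ᶠ λ {σ} {τ} eq → ≈-trans (coefficient-1ᶠ σ) (≈-trans
    (⟦⟧-cong ([] ≟ʷ word σ) ([] ≟ʷ word τ) (empty (same-length {σ} {τ} eq)) (empty (same-length {τ} {σ} (sym eq))))
    (≈-sym (coefficient-1ᶠ τ)))
    where
    same-length : ∀ {σ τ} → Pˢ σ ≡ Pˢ τ → length (word σ) ≡ length (word τ)
    same-length {σ} {τ} eq = trans (sym (#nodes-Pˢ σ)) (trans (cong (#nodes ∘ proj₁) eq) (#nodes-Pˢ τ))
    empty : ∀ {u v : List ℕ} → length u ≡ length v → [] ≡ u → [] ≡ v
    empty {v = []} _ _ = refl
    empty {v = _ ∷ _} () refl

  coef-r-ι : ∀ x {σ w} → Sorts (_≼_ 𝔸) 0 (word σ) w →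
             Polynomials.coef (r 𝔸 x) w ≈ coefficient permutationDecSetoid σ (ι x)
  coef-r-ι x {σ} {w} s = ≈-trans (coef-r 𝔸 x w) (≈-sym (≈-trans (coefficient-word σ (ι x))
    (wordCoefficient-ι-Sorts 𝔸 x w s)))

  unit-homo : ∀ z → IsUnit z → ∀ w → Polynomials.coef (r 𝔸 z) w ≈ Polynomials.coef (Polynomials.1ᵖ 𝔸) w
  unit-homo z z≈1 w with σ , s ← sorted-permutation 𝔸 w =
    ≈-trans (coef-r-ι z {σ} {w} s) (≈-trans (z≈1 σ) (≈-trans (coefficient-1ᶠ σ) (empty w (length-sorted s))))
    where
    empty : ∀ w → length (word σ) ≡ length w → ⟦ [] ≟ʷ word σ ⟧ ≈ Polynomials.coef (Polynomials.1ᵖ 𝔸) w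
    empty w eq with word σ
    empty []      _ | []    = ≈-refl
    empty (_ ∷ _) _ | _ ∷ _ = ≈-refl

  coefficient-product : ∀ x y {σ w} → Sorts (_≼_ 𝔸) 0 (word σ) w →
    coefficient permutationDecSetoid σ (ι x ∙ᶠ ι y) ≈ Polynomials.coef (Polynomials._∙ᵖ_ 𝔸 (r 𝔸 x) (r 𝔸 y)) w
  coefficient-product x y {σ} s =
    ≈-trans (coefficient-word σ (ι x ∙ᶠ ι y)) (wordCoefficient-product 𝔸 x y s)

  -- Permutations with equal `Pˢ` are exchanged for words of equal shapes. Cuts at equal lengths
  -- give prefixes and suffixes of equal shapes, so the two sums over cuts agree term by term.
  prod : ∀ x y → ∃ λ z → IsProduct x y z
  prod x y = ι-image (ι x ∙ᶠ ι y) (λ {σ} {τ} → same {σ} {τ})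
    where
    coef-cong : ∀ x {u v} → IncrDecr.treeShapes 𝔸 u ≡ IncrDecr.treeShapes 𝔸 v →
                Polynomials.coef (r 𝔸 x) u ≈ Polynomials.coef (r 𝔸 x) v
    coef-cong x {u} {v} eq = ≈-trans (coef-r 𝔸 x u)
      (≈-trans (≈-reflexive (cong (λ s → shapeCoefficient s x) eq)) (≈-sym (coef-r 𝔸 x v)))
    same : ∀ {σ τ} → Pˢ σ ≡ Pˢ τ →
           coefficient permutationDecSetoid σ (ι x ∙ᶠ ι y) ≈ coefficient permutationDecSetoid τ (ι x ∙ᶠ ι y)
    same {σ} {τ} eq with u , s ← unsort σ | v , t ← unsort τ = ≈-trans (coefficient-product x y {σ} {u} s)
      (≈-trans (∑-Pointwise (Pointwise.map factors (splits-Pointwise u v (length-treeShapes 𝔸 u≃v))))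
               (≈-sym (coefficient-product x y {τ} {v} t)))
      where
      u≃v : IncrDecr.treeShapes 𝔸 u ≡ IncrDecr.treeShapes 𝔸 v
      u≃v = trans (treeShapes-Pˢ 𝔸 σ s) (trans eq (sym (treeShapes-Pˢ 𝔸 τ t)))
      factors : ∀ {(p , q) (p′ , q′) : List ℕ × List ℕ} → length p ≡ length p′ × p ++ q ≡ u × p′ ++ q′ ≡ v →
                Polynomials.coef (r 𝔸 x) p * Polynomials.coef (r 𝔸 y) q ≈
                Polynomials.coef (r 𝔸 x) p′ * Polynomials.coef (r 𝔸 y) q′
      factors {p , q} {p′ , q′} (p≡ , refl , refl) with p≃ , q≃ ← treeShapes-++ 𝔸 p {q} {p′} {q′} p≡ u≃v =
        *-cong (coef-cong x {p} {p′} p≃) (coef-cong y {q} {q′} q≃)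

  prod-homo : ∀ x y z → IsProduct x y z → ∀ w →
    Polynomials.coef (r 𝔸 z) w ≈ Polynomials.coef (Polynomials._∙ᵖ_ 𝔸 (r 𝔸 x) (r 𝔸 y)) w
  prod-homo x y z z≈xy w with σ , s ← sorted-permutation 𝔸 w =
    ≈-trans (coef-r-ι z {σ} {w} s) (≈-trans (z≈xy σ) (coefficient-product x y {σ} {w} s))

  coefficient-ι⊗ι : ∀ α β d → coefficient Permutation² (α , β) (ι⊗ι d) ≈
                    ⟨ d , (λ (J , J′) → ⟦ Pˢ α ≟ˢˢ shapes J ⟧ * ⟦ Pˢ β ≟ˢˢ shapes J′ ⟧) ⟩
  coefficient-ι⊗ι α β d = ≈-trans (coefficient-⟨⟩ Permutation² (α , β) (ι⊗ι d))
    (≈-trans (⟨⟩-extend Permutation² _ _ d) (⟨⟩-cong d (λ (J , J′) → begin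
      ⟨ basisSum (cartesianProduct (fibre J) (fibre J′)) , (λ e → ⟦ e ≟² (α , β) ⟧) ⟩
        ≈⟨ ⟨⟩-basisSum _ (cartesianProduct (fibre J) (fibre J′)) ⟩
      ∑ (cartesianProduct (fibre J) (fibre J′)) (λ e → ⟦ e ≟² (α , β) ⟧)
        ≈⟨ ∑-cong (cartesianProduct (fibre J) (fibre J′)) (λ (σ , τ) → ≈-trans
             (⟦⟧-cong ((σ , τ) ≟² (α , β)) ((word σ ≟ʷ word α) ×-dec (word τ ≟ʷ word β)) id id)
             (⟦⟧-× (word σ ≟ʷ word α) (word τ ≟ʷ word β))) ⟩
      ∑ (cartesianProduct (fibre J) (fibre J′)) (λ (σ , τ) → ⟦ word σ ≟ʷ word α ⟧ * ⟦ word τ ≟ʷ word β ⟧)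
        ≈⟨ ∑-cartesianProduct _ _ (fibre J) (fibre J′) ⟩
      ∑ (fibre J) (λ σ → ⟦ word σ ≟ʷ word α ⟧) * ∑ (fibre J′) (λ τ → ⟦ word τ ≟ʷ word β ⟧)
        ≈⟨ *-cong (∑-fibre J α) (∑-fibre J′ β) ⟩
      ⟦ Pˢ α ≟ˢˢ shapes J ⟧ * ⟦ Pˢ β ≟ˢˢ shapes J′ ⟧ ∎)))
    where open DecSetoid Permutation² using () renaming (_≟_ to _≟²_)

  coprod : ∀ x → ∃ λ d → IsCoproduct x d
  coprod x = map (map₂ twins) z , λ (α , β) → begin
    coefficient Permutation² (α , β) (ι⊗ι (map (map₂ twins) z))
      ≈⟨ coefficient-ι⊗ι α β (map (map₂ twins) z) ⟩
    _ ≈⟨ ⟨⟩-map₂ _ twins z ⟩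
    ⟨ z , (λ (σ , τ) → ⟦ Pˢ α ≟ˢˢ shapes (proj₁ (Pˢ-twin σ)) ⟧ * ⟦ Pˢ β ≟ˢˢ shapes (proj₁ (Pˢ-twin τ)) ⟧) ⟩
      ≈⟨ ⟨⟩-cong z (λ (σ , τ) → ≈-trans
           (≈-reflexive (cong₂ (λ s t → ⟦ Pˢ α ≟ˢˢ s ⟧ * ⟦ Pˢ β ≟ˢˢ t ⟧) (proj₂ (Pˢ-twin σ)) (proj₂ (Pˢ-twin τ))))
           (≈-trans (≈-sym (⟦⟧-× (Pˢ α ≟ˢˢ Pˢ σ) (Pˢ β ≟ˢˢ Pˢ τ)))
             (⟦⟧-cong ((Pˢ α ≟ˢˢ Pˢ σ) ×-dec (Pˢ β ≟ˢˢ Pˢ τ)) (Pˢ² (α , β) ≟ᵗ Pˢ² (σ , τ))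
               (λ (p , q) → cong₂ _,_ p q) (λ eq → cong proj₁ eq , cong proj₂ eq)))) ⟩
    ⟨ z , (λ e → ⟦ Pˢ² (α , β) ≟ᵗ Pˢ² e ⟧) ⟩
      ≈⟨ proj₂ classes (α , β) ⟩
    coefficient Permutation² (α , β) (Δ (ι x)) ∎
    where
    _≟ᵗ_ : ∀ (s t : ShapePair × ShapePair) → Dec (s ≡ t)
    _≟ᵗ_ = ×-≡-dec _≟ˢˢ_ _≟ˢˢ_
    Pˢ² : Permutation × Permutation → ShapePair × ShapePair
    Pˢ² (σ , τ) = Pˢ σ , Pˢ τ
    twins : Permutation × Permutation → TwinTrees × TwinTrees
    twins (σ , τ) = proj₁ (Pˢ-twin σ) , proj₁ (Pˢ-twin τ)
    -- On words, `coefficient-Δ-ι` gives a sum over selectors; for each selector, shuffles of words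
    -- of equal shapes have equal shapes.
    same : ∀ {e e′} → Pˢ² e ≡ Pˢ² e′ →
           coefficient Permutation² e (Δ (ι x)) ≈ coefficient Permutation² e′ (Δ (ι x))
    same {α , β} {α′ , β′} eq
      with p , s ← unsort α | q , t ← unsort β | p′ , s′ ← unsort α′ | q′ , t′ ← unsort β′ = begin
        coefficient Permutation² (α , β) (Δ (ι x))
          ≈⟨ coefficient-Δ-ι 𝔸 𝔸 x {α} {β} {p} {q} s t ⟩
        commute 𝔸 𝔸 (r (𝔸 ⊕ 𝔸) x) p q
          ≈⟨ commute-r 𝔸 𝔸 x p q ⟩
        ∑ (choices (length p) (length q)) (λ S → shapeCoefficient (merged S p q) x)
          ≈⟨ ∑-cong-local (All.tabulate λ {S} S∈ → ≈-reflexive (cong (λ s → shapeCoefficient s x)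
               (treeShapes-merge 𝔸 𝔸 p p′ q q′ S∈ p≃ q≃))) ⟩
        ∑ (choices (length p) (length q)) (λ S → shapeCoefficient (merged S p′ q′) x)
          ≈⟨ ≈-reflexive (cong₂ (λ n m → ∑ (choices n m) (λ S → shapeCoefficient (merged S p′ q′) x))
               (length-treeShapes 𝔸 p≃) (length-treeShapes 𝔸 q≃)) ⟩
        ∑ (choices (length p′) (length q′)) (λ S → shapeCoefficient (merged S p′ q′) x)
          ≈⟨ commute-r 𝔸 𝔸 x p′ q′ ⟨
        commute 𝔸 𝔸 (r (𝔸 ⊕ 𝔸) x) p′ q′
          ≈⟨ coefficient-Δ-ι 𝔸 𝔸 x {α′} {β′} {p′} {q′} s′ t′ ⟨
        coefficient Permutation² (α′ , β′) (Δ (ι x)) ∎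
      where
      merged : List Bool → List ℕ → List ℕ → ShapePair
      merged S p q = IncrDecr.treeShapes (𝔸 ⊕ 𝔸) (merge S (map inj₁ p) (map inj₂ q))
      p≃ : IncrDecr.treeShapes 𝔸 p ≡ IncrDecr.treeShapes 𝔸 p′
      p≃ = trans (treeShapes-Pˢ 𝔸 α s) (trans (cong proj₁ eq) (sym (treeShapes-Pˢ 𝔸 α′ s′)))
      q≃ : IncrDecr.treeShapes 𝔸 q ≡ IncrDecr.treeShapes 𝔸 q′
      q≃ = trans (treeShapes-Pˢ 𝔸 β t) (trans (cong proj₂ eq) (sym (treeShapes-Pˢ 𝔸 β′ t′)))
    classes : ∃ λ z → ∀ e → ⟨ z , (λ e′ → ⟦ Pˢ² e ≟ᵗ Pˢ² e′ ⟧) ⟩ ≈ coefficient Permutation² e (Δ (ι x))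
    classes = class-combination Permutation² _≟ᵗ_ Pˢ²
      (λ (p , q) → cong₂ _,_ (cong insertionShapes p) (cong insertionShapes q)) (Δ (ι x))
      (λ {e} {e′} → same {e} {e′})
    z = proj₁ classes

  tensor-r : ∀ X Y d p q → tensor X Y (r X) (r Y) d p q ≈ ⟨ d , (λ (J , J′) →
    ⟦ IncrDecr.treeShapes X p ≟ˢˢ shapes J ⟧ * ⟦ IncrDecr.treeShapes Y q ≟ˢˢ shapes J′ ⟧) ⟩
  tensor-r X Y []                  p q = ≈-refl
  tensor-r X Y ((k , J , J′) ∷ d) p q =
    +-cong (*-congˡ (*-cong (≈-trans (+-identityʳ _) (*-identityˡ _)) (≈-trans (+-identityʳ _) (*-identityˡ _))))
           (tensor-r X Y d p q)

  -- The coefficients at `p` and `q` are those at the permutations sorting them, where the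
  -- hypothesis on `d` can be read off.
  doubling : ∀ x d → IsCoproduct x d → ∀ p q →
             commute 𝔸 𝔸 (r (𝔸 ⊕ 𝔸) x) p q ≈ tensor 𝔸 𝔸 (r 𝔸) (r 𝔸) d p q
  doubling x d d≈Δ p q with α , s ← sorted-permutation 𝔸 p | β , t ← sorted-permutation 𝔸 q = begin
    commute 𝔸 𝔸 (r (𝔸 ⊕ 𝔸) x) p q
      ≈⟨ coefficient-Δ-ι 𝔸 𝔸 x {α} {β} {p} {q} s t ⟨
    coefficient Permutation² (α , β) (Δ (ι x))
      ≈⟨ d≈Δ (α , β) ⟨
    coefficient Permutation² (α , β) (ι⊗ι d)
      ≈⟨ coefficient-ι⊗ι α β d ⟩
    ⟨ d , (λ (J , J′) → ⟦ Pˢ α ≟ˢˢ shapes J ⟧ * ⟦ Pˢ β ≟ˢˢ shapes J′ ⟧) ⟩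
      ≈⟨ ⟨⟩-cong d (λ (J , J′) → ≈-reflexive (cong₂ (λ s t → ⟦ s ≟ˢˢ shapes J ⟧ * ⟦ t ≟ˢˢ shapes J′ ⟧)
           (treeShapes-Pˢ 𝔸 α s) (treeShapes-Pˢ 𝔸 β t))) ⟨
    _ ≈⟨ tensor-r 𝔸 𝔸 d p q ⟨
    tensor 𝔸 𝔸 (r 𝔸) (r 𝔸) d p q ∎

theorem6p3 : ∀ {c ℓ₁ ℓ₂} (K : HeytingField c ℓ₁ ℓ₂) → CharacteristicZero K →
    OverField.BaxterIsHopfSubalgebra K × OverField.IsPolynomialRealization K (OverField.r K)
theorem6p3 K _ =
  record { ι-mono = ι-mono ; unit = unit ; prod = prod ; coprod = coprod } ,
  record { linear-injective = r-mono ; unit-homo = unit-homo ; prod-homo = prod-homo ; doubling = doubling }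
  where open Realization K
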